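{- Let $G=(V,E)$ be a simple, finite, connected graph. The following are equivalent: (i) $G$ is reflective; (ii) $G$ is one of: a cocktail party graph, a Johnson graph, a halved cube, the Schläfli graph, the Gosset graph, or a cartesian product of graphs from this list.
   Context: $d$ is the graph distance. For adjacent $x\sim y$ let $V_x^y=\{x': d(x',x)<d(x',y)\}$, $V^{xy}=\{z: d(z,x)=d(z,y)\}$. A reflection from $x$ to $y$ is a map $\phi:V\to V$ which is a graph automorphism with $\phi^2=\mathrm{id}$, $\phi(x)=y$, such that the set of edges between $V_x^y$ and $V_y^x$ is exactly $\{(x',\phi(x')):x'\in V_x^y\}$, and $\phi(z)=z$ for all $z\in V^{xy}$. $G$ is reflective if a reflection from $x$ to $y$ exists for every edge $x\sim y$. -}

module Defs where

open import Level using (0ℓ)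
open import Data.Nat using (ℕ; zero; suc; _+_; _<_; _≤_; _%_)
open import Data.Fin using (Fin; zero; suc)
open import Data.Fin.Subset using (Subset; ∣_∣; _∩_; _∪_; _─_; ⊥; ⁅_⁆)
open import Data.Bool using (Bool; true; false)
open import Data.Product using (Σ; ∃; _×_; _,_; proj₁; proj₂)
open import Data.Sum using (_⊎_)
open import Relation.Nullary using (¬_)
open import Relation.Binary.PropositionalEquality using (_≡_; refl)
open import Function.Bundles using (_↔_; _⇔_; Inverse)

record Graph : Set₁ where
  field
    V   : Set
    adj : V → V → Set
open Graph public

Simple : Graph → Set
Simple G = (∀ x → ¬ adj G x x) × (∀ x y → adj G x y → adj G y x)

Finite : Graph → Set
Finite G = Σ ℕ λ n → V G ↔ Fin n

data Reach (G : Graph) : ℕ → V G → V G → Set where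
  here : ∀ {k x} → Reach G k x x
  step : ∀ {k x z y} → adj G x z → Reach G k z y → Reach G (suc k) x y

Connected : Graph → Set
Connected G = V G × (∀ x y → Σ ℕ λ k → Reach G k x y)

Dist : (G : Graph) → V G → V G → ℕ → Set
Dist G x y k = Reach G k x y × (∀ j → Reach G j x y → k ≤ j)

InV : (G : Graph) → V G → V G → V G → Set
InV G x y x' = Σ ℕ λ a → Σ ℕ λ b → Dist G x' x a × Dist G x' y b × a < b

InVmid : (G : Graph) → V G → V G → V G → Set
InVmid G x y z = Σ ℕ λ a → Dist G z x a × Dist G z y a

record IsReflection (G : Graph) (x y : V G) (φ : V G → V G) : Set where
  field
    automorphism : ∀ u v → (adj G u v ⇔ adj G (φ u) (φ v))
    involution   : ∀ u → φ (φ u) ≡ u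
    maps-x-to-y  : φ x ≡ y
    edges-⊇      : ∀ u → InV G x y u → InV G y x (φ u) × adj G u (φ u)
    edges-⊆      : ∀ u v → InV G x y u → InV G y x v → adj G u v → v ≡ φ u
    fixes-mid    : ∀ z → InVmid G x y z → φ z ≡ z

Reflective : Graph → Set
Reflective G = ∀ x y → adj G x y → Σ (V G → V G) (IsReflection G x y)

_≅_ : Graph → Graph → Set
G ≅ H = Σ (V G ↔ V H) λ f →
          ∀ u v → (adj G u v ⇔ adj H (Inverse.to f u) (Inverse.to f v))

_□_ : Graph → Graph → Graph
G □ H = record
  { V   = V G × V H
  ; adj = λ p q → (adj G (proj₁ p) (proj₁ q) × proj₂ p ≡ proj₂ q)
                ⊎ (proj₁ p ≡ proj₁ q × adj H (proj₂ p) (proj₂ q))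
  }

CocktailParty : ℕ → Graph
CocktailParty m = record
  { V   = Fin m × Bool
  ; adj = λ p q → ¬ (proj₁ p ≡ proj₁ q)
  }

KSubset : ℕ → ℕ → Set
KSubset n k = Σ (Subset n) λ s → ∣ s ∣ ≡ k

Johnson : ℕ → ℕ → Graph
Johnson n k = record
  { V   = KSubset n k
  ; adj = λ s t → ∣ proj₁ s ∩ proj₁ t ∣ + 1 ≡ k
  }

HalvedCube : ℕ → Graph
HalvedCube n = record
  { V   = Σ (Subset n) λ s → ∣ s ∣ % 2 ≡ 0
  ; adj = λ s t → ∣ (proj₁ s ─ proj₁ t) ∪ (proj₁ t ─ proj₁ s) ∣ ≡ 2
  }

-- Gosset graph (56 vertices): two copies of the 2-subsets of {0,…,7};
-- vertices in the same copy adjacent iff they meet in exactly one point,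
-- vertices in different copies adjacent iff disjoint.
-- (Equivalently ±(3,3,-1,…,-1) permuted, adjacent iff inner product 8.)
gossetAdj : Bool → Bool → KSubset 8 2 → KSubset 8 2 → Set
gossetAdj true  true  s t = ∣ proj₁ s ∩ proj₁ t ∣ ≡ 1
gossetAdj false false s t = ∣ proj₁ s ∩ proj₁ t ∣ ≡ 1
gossetAdj true  false s t = ∣ proj₁ s ∩ proj₁ t ∣ ≡ 0
gossetAdj false true  s t = ∣ proj₁ s ∩ proj₁ t ∣ ≡ 0

Gosset : Graph
Gosset = record
  { V   = Bool × KSubset 8 2
  ; adj = λ p q → gossetAdj (proj₁ p) (proj₁ q) (proj₂ p) (proj₂ q)
  }

gosset₀ : V Gosset
gosset₀ = true , (⁅ zero ⁆ ∪ ⁅ suc zero ⁆) , refl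

-- Schläfli graph (27 vertices): the local graph of the Gosset graph, i.e.
-- the subgraph induced on the neighbourhood of a vertex
Schlaefli : Graph
Schlaefli = record
  { V   = Σ (V Gosset) λ v → adj Gosset gosset₀ v
  ; adj = λ p q → adj Gosset (proj₁ p) (proj₁ q)
  }

Basic : Graph → Set
Basic G = (Σ ℕ λ m → G ≅ CocktailParty m)
        ⊎ (Σ ℕ λ n → Σ ℕ λ k → G ≅ Johnson n k)
        ⊎ (Σ ℕ λ n → G ≅ HalvedCube n)
        ⊎ (G ≅ Schlaefli)
        ⊎ (G ≅ Gosset)

data InList : Graph → Set₁ where
  basic : ∀ {G} → Basic G → InList G
  prod  : ∀ {G H₁ H₂} → InList H₁ → InList H₂ → G ≅ (H₁ □ H₂) → InList G

{-# OPTIONS --safe #-}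
module Submission where

-- The graph distance of a reflective graph satisfies d(φu,v) = d(u,v) + ε(u)ε(v), where
-- ε(u) = d(u,y) - d(u,x), because a reflection from x to y is also the reflection of every edge joining
-- the two sides of xy; thus a reflective graph behaves like the orbit of a minuscule weight.
-- Conversely this identity makes a geodesic metric space reflective, and it is checked directly for
-- each graph of the list: with d half the Hamming distance for Johnson graphs and halved cubes, and
-- with the Gosset graph as an antipodal double cover of J(8,2).
--
-- By the identity, a point is determined by its distances to x and to the neighbours of x, and the
-- reflections in the edges at x generate a transitive group acting on these distances by a rule that
-- depends only on the local graph at x.  So a reflective graph is determined by its local graph.  If
-- the local graph is disconnected, its pieces span factors of a product decomposition.  Otherwise
-- the local graph is itself reflective, and it contains no claw (a vertex joined to three vertices
-- at mutual distance 2), which by induction leaves only complete graphs, products of two complete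
-- graphs, J(n,2), cocktail party graphs, the halved 5-cube and the Schläfli graph.  These are the
-- local graphs of J(n,1), Johnson graphs, halved cubes, cocktail party graphs, the Schläfli graph
-- and the Gosset graph.
--
-- Adjacency is decidable although it is not assumed to be: the reflections are functions on a finite
-- set, and folding a walk by the reflection of its first edge shortens it.

open import Defs
open import Data.Bool using (Bool; T; _xor_; _∧_; _∨_; false; if_then_else_; not; true)
import Data.Bool.Properties as Boolₚ
open import Data.Empty using (⊥)
open import Data.Fin using (Fin; suc; zero)
import Data.Fin.Properties as Finₚ
open import Data.Fin.Subset using (_∩_; _∪_; _─_; ⁅_⁆; ∁; ∣_∣)
open import Data.Fin.Subset.Properties using (∣⁅x⁆∣≡1)
import Data.Integer.Properties as ℤₚ
open import Data.List.Membership.Propositional using (_∈_; lose)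
open import Data.List.Membership.Propositional.Properties using (∈-allFin; ∈-map⁺)
open import Data.List.Relation.Unary.All as All using (All; all?)
open import Data.List.Relation.Unary.Any using (any?; here; satisfied; there)
open import Data.Nat.Divisibility using (_∣_; divides; m%n≡0⇒n∣m; n∣m⇒m%n≡0; ∣-refl; ∣m+n∣m⇒∣n; ∣m∣n⇒∣m+n)
open import Data.Nat.Induction using (<-rec)
import Data.Nat.Properties as ℕₚ
open import Data.Product using (_,_; _×_; proj₁; proj₂; Σ; ∃)
open import Data.Sum using (_⊎_; inj₁; inj₂)
open import Data.Unit using (tt)
open import Data.Vec as Vec using (Vec; []; _++_; _∷_; replicate)
import Data.Vec.Properties as Vecₚ
open import Function.Base using (_∘_)
open import Function.Bundles using (Equivalence; Inverse; mk↔ₛ′; mk⇔)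
open import Relation.Binary.Definitions using (tri<; tri>; tri≈)
open import Relation.Binary.PropositionalEquality
open import Relation.Nullary using (Dec; contradiction; no; yes; ¬?; ¬_)
open import Relation.Nullary.Decidable using (T?; _×-dec_; _→-dec_; _⊎-dec_; does; fromWitness; isYes; map′; toWitness)

-- Local graphs and factors are subsets that keep the distance of the whole graph, so the argument
-- runs on integer-valued metrics with reflections (`ReflSpace`) and not on graphs: the axioms pass
-- to subsets closed under reflections and containing a geodesic between any two of their points,
-- and graph notions enter only at the two ends. What closes the list is the claw. J(n,k) with k and
-- n - k at least 3, the halved n-cube with n at least 6 and the Gosset graph contain one, so none
-- of them is the local graph of a reflective graph. In the chain J(5,2), halved 5-cube, Schläfli
-- graph, Gosset graph, attached to A4, D5, E6, E7, each graph is the local graph of the next; that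
-- the chain ends there accords with E8 having no minuscule weight.

-- Metric spaces with reflections, and their determination by a first neighbourhood

module ReflectionSpaces where
  open import Data.Nat as ℕ using (ℕ; zero; suc; _≤_; s≤s)
  open import Data.Integer using (ℤ; +_; -_; _+_; _-_; _*_; 0ℤ; 1ℤ; -1ℤ)
  open import Data.Integer.Tactic.RingSolver using (solve-∀)

  gap : {A : Set} → (A → A → ℕ) → A → A → A → ℤ
  gap d x y u = + d u y - + d u x

  -- With ε = gap d x y, the last axiom says that ρ acts as the orthogonal reflection in y - x would if
  -- d were half of a squared Euclidean distance; it makes ρ an isometric involution exchanging x and y.
  record ReflSpace : Set₁ where
    field
      Pt       : Set
      d        : Pt → Pt → ℕ
      d-refl   : ∀ x → d x x ≡ 0
      d-zero   : ∀ {x y} → d x y ≡ 0 → x ≡ y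
      d-sym    : ∀ x y → d x y ≡ d y x
      d-lip    : ∀ {x y} → d x y ≡ 1 → ∀ z → d x z ≤ suc (d y z)
      geodesic : ∀ {x z k} → d x z ≡ suc k → Σ Pt λ y → d x y ≡ 1 × d y z ≡ k
      ρ        : ∀ {x y} → d x y ≡ 1 → Pt → Pt
      ρ-d      : ∀ {x y} (e : d x y ≡ 1) u v →
                 + d (ρ e u) v ≡ + d u v + gap d x y u * gap d x y v

  open ReflSpace public

  module Space (S : ReflSpace) where
    open ReflSpace S public renaming
      (Pt to P; d to δ; d-refl to δ-refl; d-zero to δ-zero; d-sym to δ-sym; d-lip to δ-lip;
       geodesic to geo; ρ to r; ρ-d to r-δ)

    ε : P → P → P → ℤ
    ε = gap δ

    -- `δ-lip` bounds one step only; the general inequality follows along a geodesic from `x` to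
    -- `y`.
    δ-triangle : ∀ x y z → δ x z ≤ δ x y ℕ.+ δ y z
    δ-triangle x y z = go (δ x y) x refl
      where
      go : ∀ k x → δ x y ≡ k → δ x z ≤ k ℕ.+ δ y z
      go zero    x eq rewrite δ-zero eq = ℕₚ.≤-refl
      go (suc k) x eq with geo eq
      ... | w , xw , wy = ℕₚ.≤-trans (δ-lip xw z) (s≤s (go k w wy))

    infix 4 _≟_
    _≟_ : (x y : P) → Dec (x ≡ y)
    x ≟ y with δ x y in eq
    ... | zero  = yes (δ-zero eq)
    ... | suc _ = no λ { refl → contradiction (trans (sym eq) (δ-refl x)) λ () }

    module Edge {x y : P} (e : δ x y ≡ 1) where

      ε-source : ε x y x ≡ 1ℤ
      ε-source rewrite e | δ-refl x = refl

      ε-target : ε x y y ≡ -1ℤ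
      ε-target rewrite δ-sym y x | e | δ-refl y = refl

      -- The reflection formula is used with `v` equal to `y` and to `x`, where `ε` is -1 and 1.
      ε-r : ∀ u → ε x y (r e u) ≡ - ε x y u
      ε-r u rewrite r-δ e u y | r-δ e u x | ε-source | ε-target =
        lemma (+ δ u y) (+ δ u x)
        where
        lemma : ∀ p q → (p + (p - q) * -1ℤ) - (q + (p - q) * 1ℤ) ≡ - (p - q)
        lemma = solve-∀

      r-adjoint : ∀ u v → δ (r e u) v ≡ δ u (r e v)
      r-adjoint u v = ℤₚ.+-injective (trans (r-δ e u v) (sym (begin
        + δ u (r e v)                ≡⟨ cong +_ (δ-sym u (r e v)) ⟩
        + δ (r e v) u                ≡⟨ r-δ e v u ⟩
        + δ v u + ε x y v * ε x y u  ≡⟨ cong₂ _+_ (cong +_ (δ-sym v u)) (ℤₚ.*-comm (ε x y v) (ε x y u)) ⟩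
        + δ u v + ε x y u * ε x y v  ∎)))
        where open ≡-Reasoning

      -- The first reflection changes the sign of `ε`, so the two squares cancel and the distance
      -- back to `u` is 0.
      r-involutive : ∀ u → r e (r e u) ≡ u
      r-involutive u = δ-zero (ℤₚ.+-injective (begin
        + δ (r e (r e u)) u                              ≡⟨ r-δ e (r e u) u ⟩
        + δ (r e u) u + ε x y (r e u) * ε x y u          ≡⟨ cong₂ (λ p q → p + q * ε x y u) (r-δ e u u) (ε-r u) ⟩
        + δ u u + ε x y u * ε x y u + - ε x y u * ε x y u ≡⟨ lemma (+ δ u u) (ε x y u) ⟩
        + δ u u                                          ≡⟨ cong +_ (δ-refl u) ⟩
        0ℤ                                               ∎))
        where
        open ≡-Reasoning
        lemma : ∀ p q → p + q * q + - q * q ≡ p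
        lemma = solve-∀

      r-isometry : ∀ u v → δ (r e u) (r e v) ≡ δ u v
      r-isometry u v = trans (r-adjoint u (r e v)) (cong (δ u) (r-involutive v))

      r-source : r e x ≡ y
      r-source = δ-zero (ℤₚ.+-injective (trans (r-δ e x y)
        (cong₂ _+_ (cong +_ e) (cong₂ _*_ ε-source ε-target))))

      r-target : r e y ≡ x
      r-target = trans (cong (r e) (sym r-source)) (r-involutive x)

      -- Numerical form of the reflection formula: once the five distances are known numerals, the
      -- equation closes by `refl`.
      r-δ-at : ∀ u v {a b c b′ c′ m} → δ u v ≡ a → δ u y ≡ b → δ u x ≡ c → δ v y ≡ b′ → δ v x ≡ c′ →
               + a + (+ b - + c) * (+ b′ - + c′) ≡ + m → δ (r e u) v ≡ m
      r-δ-at u v refl refl refl refl refl eq = ℤₚ.+-injective (trans (r-δ e u v) eq)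

  infix 4 _≃_
  record _≃_ (S T : ReflSpace) : Set where
    field
      to        : Pt S → Pt T
      from      : Pt T → Pt S
      to-from   : ∀ v → to (from v) ≡ v
      to-d      : ∀ u v → d T (to u) (to v) ≡ d S u v

    -- Preserving distances makes `to` injective, so a one-sided inverse is two-sided.
    from-to : ∀ u → from (to u) ≡ u
    from-to u = d-zero S (trans (sym (to-d (from (to u)) u))
      (trans (cong (λ w → d T w (to u)) (to-from (to u))) (d-refl T (to u))))

    from-d : ∀ u v → d S (from u) (from v) ≡ d T u v
    from-d u v = trans (sym (to-d (from u) (from v))) (cong₂ (d T) (to-from u) (to-from v))

  ≃-trans : ∀ {S T U} → S ≃ T → T ≃ U → S ≃ U
  ≃-trans f g = record
    { to      = λ u → g.to (f.to u)
    ; from    = λ v → f.from (g.from v)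
    ; to-from = λ v → trans (cong g.to (f.to-from _)) (g.to-from v)
    ; to-d    = λ u v → trans (g.to-d _ _) (f.to-d u v)
    }
    where
    module f = _≃_ f
    module g = _≃_ g

  module Uniqueness (S T : ReflSpace) where
    open Space S
    module T = Space T

    module _ (x : P) (y : T.P) (σ : ∀ a → δ x a ≡ 1 → T.P)
             (σ-nbr  : ∀ a p → T.δ y (σ a p) ≡ 1)
             (σ-iso  : ∀ a p b q → T.δ (σ a p) (σ b q) ≡ δ a b)
             (σ-surj : ∀ c → T.δ y c ≡ 1 → Σ P λ a → Σ (δ x a ≡ 1) λ p → σ a p ≡ c) where

      -- Distances to `x` and to its neighbours serve as coordinates. A reflection in an edge `x a`
      -- transports the relation, because it changes these coordinates by a rule that involves only
      -- the coordinates themselves and the distances among `x` and its neighbours.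
      record Matched (v : P) (v′ : T.P) : Set where
        constructor matched
        field
          base : δ v x ≡ T.δ v′ y
          nbrs : ∀ a p → δ v a ≡ T.δ v′ (σ a p)
      open Matched

      module _ {v : P} {v′ : T.P} (a : P) (p : δ x a ≡ 1) (m : Matched v v′) where
        r-matches : ∀ u u′ → δ v u ≡ T.δ v′ u′ → δ u x ≡ T.δ u′ y → δ u a ≡ T.δ u′ (σ a p) →
                    δ (r p v) u ≡ T.δ (T.r (σ-nbr a p) v′) u′
        r-matches u u′ vu ux ua = sym (T.Edge.r-δ-at (σ-nbr a p) v′ u′
          (sym vu) (sym (nbrs m a p)) (sym (base m)) (sym ua) (sym ux) (sym (r-δ p v u)))

        matched-r : Matched (r p v) (T.r (σ-nbr a p) v′)
        matched-r = matched
          (r-matches x y (base m) (trans (δ-refl x) (sym (T.δ-refl y))) (trans p (sym (σ-nbr a p))))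
          (λ b q → r-matches b (σ b q) (nbrs m b q)
            (trans (δ-sym b x) (trans q (trans (sym (σ-nbr b q)) (T.δ-sym y (σ b q)))))
            (sym (σ-iso b q a p)))

      matched-base : Matched x y
      matched-base = matched (trans (δ-refl x) (sym (T.δ-refl y))) (λ a p → trans p (sym (σ-nbr a p)))

      -- Let `a` begin a geodesic from `x` to `v`. Reflecting both pairs in `x a` keeps them matched
      -- and keeps the distances, and brings `v` one step closer to `x`, since `x` goes to `a`. At
      -- `v = x` the claim is the coordinate `base` of the other pair.
      matched-iso : ∀ {v v′ w w′} → Matched v v′ → Matched w w′ → δ v w ≡ T.δ v′ w′
      matched-iso {v} m n = go (δ x v) v refl m n
        where
        go : ∀ k v {v′ w w′} → δ x v ≡ k → Matched v v′ → Matched w w′ → δ v w ≡ T.δ v′ w′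
        go zero v {v′} {w} {w′} eq m n with refl ← δ-zero eq
          with refl ← T.δ-zero (trans (sym (base m)) (δ-refl x)) =
          trans (δ-sym x w) (trans (base n) (T.δ-sym w′ y))
        go (suc k) v eq m n with geo eq
        ... | a , p , av = trans (sym (Edge.r-isometry p v _))
          (trans (go k (r p v)
              (trans (sym (Edge.r-adjoint p x v)) (trans (cong (λ z → δ z v) (Edge.r-source p)) av))
              (matched-r a p m) (matched-r a p n))
            (T.Edge.r-isometry (σ-nbr a p) _ _))

      -- The same descent: the partner of the reflected, closer point is reflected back.
      match : ∀ v → Σ T.P (Matched v)
      match v = go (δ x v) v refl
        where
        go : ∀ k v → δ x v ≡ k → Σ T.P (Matched v)
        go zero v eq with refl ← δ-zero eq = y , matched-base
        go (suc k) v eq with geo eq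
        ... | a , p , av with go k (r p v)
              (trans (sym (Edge.r-adjoint p x v)) (trans (cong (λ z → δ z v) (Edge.r-source p)) av))
        ...   | w , m = T.r (σ-nbr a p) w ,
                subst (λ u → Matched u _) (Edge.r-involutive p v) (matched-r a p m)

      comatch : ∀ v′ → Σ P λ v → Matched v v′
      comatch v′ = go (T.δ y v′) v′ refl
        where
        go : ∀ k v′ → T.δ y v′ ≡ k → Σ P λ v → Matched v v′
        go zero v′ eq with refl ← T.δ-zero eq = x , matched-base
        go (suc k) v′ eq with T.geo eq
        ... | c , q , cv with σ-surj c q
        ...   | a , p , refl with go k (T.r q′ v′)
                  (trans (sym (T.Edge.r-adjoint q′ y v′)) (trans (cong (λ z → T.δ z v′) (T.Edge.r-source q′)) cv))
          where q′ = σ-nbr a p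
        ...     | w , m = r p w , subst (Matched _) (T.Edge.r-involutive (σ-nbr a p) v′) (matched-r a p m)

      local-iso : S ≃ T
      local-iso = record
        { to      = λ v → proj₁ (match v)
        ; from    = λ v′ → proj₁ (comatch v′)
        ; to-from = λ v′ → T.δ-zero (trans
            (sym (matched-iso (proj₂ (match (proj₁ (comatch v′)))) (proj₂ (comatch v′))))
            (δ-refl _))
        ; to-d    = λ u v → sym (matched-iso (proj₂ (match u)) (proj₂ (match v)))
        }

-- Subspaces, local spaces and products

module Subspaces where
  open ReflectionSpaces
  open import Data.Nat as ℕ using (ℕ; zero; suc; _≤_; _<_; z≤n; s≤s; _≡ᵇ_)
  open import Data.Integer using (+_; -_; _+_; _-_; _*_; 1ℤ)
  open import Data.Integer.Tactic.RingSolver using (solve-∀)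
  open import Data.List using (List; []; _∷_; length)

  -- Membership is Boolean so that its proofs are equal, and points of a subset agree as soon as the
  -- underlying points do.
  Subset : {A : Set} → (A → Bool) → Set
  Subset {A} p = Σ A (T ∘ p)

  subset-≡ : ∀ {A : Set} (p : A → Bool) {u v : Subset p} → proj₁ u ≡ proj₁ v → u ≡ v
  subset-≡ p {u , pu} {v , pv} refl = cong (u ,_) (Boolₚ.T-irrelevant pu pv)

  module _ {A : Set} (p : A → Bool) where
    restrict : List A → List (Subset p)
    restrict [] = []
    restrict (v ∷ l) with T? (p v)
    ... | yes pv = (v , pv) ∷ restrict l
    ... | no _   = restrict l

    restrict-complete : ∀ {l} v → proj₁ v ∈ l → v ∈ restrict l
    restrict-complete {w ∷ l} v (here refl) with T? (p w)
    ... | yes _ = here (subset-≡ p refl)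
    ... | no ¬p = contradiction (proj₂ v) ¬p
    restrict-complete {w ∷ l} v (there i) with T? (p w)
    ... | yes _ = there (restrict-complete v i)
    ... | no _  = restrict-complete v i

    restrict-≤ : ∀ l → length (restrict l) ≤ length l
    restrict-≤ [] = z≤n
    restrict-≤ (w ∷ l) with T? (p w)
    ... | yes _ = s≤s (restrict-≤ l)
    ... | no _  = ℕₚ.m≤n⇒m≤1+n (restrict-≤ l)

    restrict-< : ∀ {l v} → v ∈ l → ¬ T (p v) → length (restrict l) < length l
    restrict-< {w ∷ l} (here refl) ¬p with T? (p w)
    ... | yes pw = contradiction pw ¬p
    ... | no _   = s≤s (restrict-≤ l)
    restrict-< {w ∷ l} (there i) ¬p with T? (p w)
    ... | yes _ = s≤s (restrict-< i ¬p)
    ... | no _  = ℕₚ.m≤n⇒m≤1+n (restrict-< i ¬p)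

  module _ (S : ReflSpace) (p : Pt S → Bool) where
    open Space S

    GeodesicallyClosed : Set
    GeodesicallyClosed = ∀ {u w k} → T (p u) → T (p w) → δ u w ≡ suc k →
                         Σ P λ v → T (p v) × δ u v ≡ 1 × δ v w ≡ k

    ReflectionClosed : Set
    ReflectionClosed = ∀ {u v} (e : δ u v ≡ 1) → T (p u) → T (p v) → ∀ w → T (p w) → T (p (r e w))

    -- With the ambient distance kept, only the two axioms that assert existence of points need
    -- hypotheses; the others are inherited.
    subspace : GeodesicallyClosed → ReflectionClosed → ReflSpace
    subspace gc rc = record
      { Pt       = Subset p
      ; d        = λ u v → δ (proj₁ u) (proj₁ v)
      ; d-refl   = λ u → δ-refl (proj₁ u)
      ; d-zero   = λ e → subset-≡ p (δ-zero e)
      ; d-sym    = λ u v → δ-sym (proj₁ u) (proj₁ v)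
      ; d-lip    = λ e w → δ-lip e (proj₁ w)
      ; geodesic = λ { {u , pu} {w , pw} e → let v , pv , uv , vw = gc pu pw e in (v , pv) , uv , vw }
      ; ρ        = λ { {u , pu} {v , pv} e (w , pw) → r e w , rc e pu pv w pw }
      ; ρ-d      = λ e u v → r-δ e (proj₁ u) (proj₁ v)
      }

  module Local (S : ReflSpace) (x : Pt S) where
    open Space S

    isNbr : P → Bool
    isNbr v = δ x v ≡ᵇ 1

    nbr⇒ : ∀ {v} → T (isNbr v) → δ x v ≡ 1
    nbr⇒ {v} = ℕₚ.≡ᵇ⇒≡ (δ x v) 1

    nbr⇐ : ∀ {v} → δ x v ≡ 1 → T (isNbr v)
    nbr⇐ {v} = ℕₚ.≡⇒≡ᵇ (δ x v) 1

    nbr-δ≤2 : ∀ {a b} → δ x a ≡ 1 → δ x b ≡ 1 → δ a b ≤ 2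
    nbr-δ≤2 {a} {b} p q = subst₂ (λ i j → δ a b ≤ i ℕ.+ j) (trans (δ-sym a x) p) q (δ-triangle a x b)

    Path₂ : P → P → Set
    Path₂ a b = Σ P λ c → δ x c ≡ 1 × δ a c ≡ 1 × δ c b ≡ 1

    -- This is what makes the distance restricted to the neighbours of `x` geodesic. It amounts to
    -- connectedness of the local graph, since `shorten` contracts longer paths to length two.
    LocallyConnected : Set
    LocallyConnected = ∀ a b → δ x a ≡ 1 → δ x b ≡ 1 → δ a b ≡ 2 → Path₂ a b

    local : LocallyConnected → ReflSpace
    local lc = subspace S isNbr gc rc
      where
      gc : GeodesicallyClosed S isNbr
      gc {u} {w} {zero} pu pw e = w , pw , e , δ-refl w
      gc {u} {w} {suc zero} pu pw e with lc u w (nbr⇒ pu) (nbr⇒ pw) e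
      ... | c , xc , uc , cw = c , nbr⇐ xc , uc , cw
      gc {u} {w} {suc (suc k)} pu pw e = contradiction (subst (_≤ 2) e (nbr-δ≤2 (nbr⇒ pu) (nbr⇒ pw)))
        λ { (s≤s (s≤s ())) }
      rc : ReflectionClosed S isNbr
      -- `x` is equidistant from `u` and `v`, so `ε u v x` is 0 and the reflection keeps the
      -- distance to `x`.
      rc {u} {v} e pu pv w pw = nbr⇐ (trans (δ-sym x _) (Edge.r-δ-at e w x
        (trans (δ-sym w x) (nbr⇒ pw)) refl refl (nbr⇒ pv) (nbr⇒ pu)
        (cong (λ z → 1ℤ + z) (ℤₚ.*-zeroʳ (ε u v w)))))

    -- Reflecting c in xa and xb yields a point at distance 3 from x and 1 from e.
    no-claw : ∀ {e a b c} → δ x e ≡ 1 → δ x a ≡ 1 → δ x b ≡ 1 → δ x c ≡ 1 →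
              δ e a ≡ 1 → δ e b ≡ 1 → δ e c ≡ 1 → δ a b ≡ 2 → δ a c ≡ 2 → δ b c ≡ 2 → ⊥
    no-claw {e} {a} {b} {c} xe xa xb xc ea eb ec ab ac bc =
      contradiction (subst₂ _≤_ (trans (δ-sym x w) wx) (cong suc (trans (δ-sym e w) we)) (δ-lip xe w))
        λ { (s≤s (s≤s ())) }
      where
      ex = trans (δ-sym e x) xe
      cb = trans (δ-sym c b) bc
      cx = trans (δ-sym c x) xc
      ax = trans (δ-sym a x) xa
      z w : P
      z  = r xb c
      w  = r xa z
      zx : δ z x ≡ 2
      zx = Edge.r-δ-at xb c x cx cb cx xb (δ-refl x) refl
      ze : δ z e ≡ 1
      ze = Edge.r-δ-at xb c e (trans (δ-sym c e) ec) cb cx eb ex refl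
      za : δ z a ≡ 3
      za = Edge.r-δ-at xb c a (trans (δ-sym c a) ac) cb cx ab ax refl
      wx : δ w x ≡ 3
      wx = Edge.r-δ-at xa z x zx za zx xa (δ-refl x) refl
      we : δ w e ≡ 1
      we = Edge.r-δ-at xa z e ze za zx ea ex refl

    -- Reflecting a in the middle edge of a path a, e, c, f of neighbours of x.
    shorten : ∀ {a e c f} → δ x a ≡ 1 → δ x e ≡ 1 → δ x c ≡ 1 → δ x f ≡ 1 →
              δ a e ≡ 1 → δ e c ≡ 1 → δ c f ≡ 1 → δ a c ≡ 2 → δ a f ≡ 2 → δ e f ≡ 2 → Path₂ a f
    shorten {a} {e} {c} {f} xa xe xc xf ae ec cf ac af ef =
      w , trans (δ-sym x w) (Edge.r-δ-at ec a x ax ac ae xc xe refl)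
        , trans (δ-sym a w) (Edge.r-δ-at ec a a (δ-refl a) ac ae ac ae refl)
        , Edge.r-δ-at ec a f af ac ae (trans (δ-sym f c) cf) (trans (δ-sym f e) ef) refl
      where
      w : P
      w = r ec a
      ax = trans (δ-sym a x) xa

  module _ (S T : ReflSpace) where
    private
      module S = Space S
      module T = Space T

    product : ReflSpace
    product = record
      { Pt       = S.P × T.P
      ; d        = dist
      ; d-refl   = λ { (u , v) → cong₂ ℕ._+_ (S.δ-refl u) (T.δ-refl v) }
      ; d-zero   = λ { {u , v} {u′ , v′} e → cong₂ _,_ (S.δ-zero (ℕₚ.m+n≡0⇒m≡0 _ e)) (T.δ-zero (ℕₚ.m+n≡0⇒n≡0 (S.δ u u′) e)) }
      ; d-sym    = λ { (u , v) (u′ , v′) → cong₂ ℕ._+_ (S.δ-sym u u′) (T.δ-sym v v′) }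
      ; d-lip    = lip
      ; geodesic = geo
      ; ρ        = λ { {p} {q} e → proj₁ (reflection p q e) }
      ; ρ-d      = λ { {p} {q} e → proj₂ (reflection p q e) }
      }
      where
      dist : S.P × T.P → S.P × T.P → ℕ
      dist (u , v) (u′ , v′) = S.δ u u′ ℕ.+ T.δ v v′

      edge : ∀ u v u′ v′ → dist (u , v) (u′ , v′) ≡ 1 → (S.δ u u′ ≡ 1 × v ≡ v′) ⊎ (u ≡ u′ × T.δ v v′ ≡ 1)
      edge u v u′ v′ e with S.δ u u′ in eq
      ... | zero        = inj₂ (S.δ-zero eq , e)
      ... | suc zero    = inj₁ (refl , T.δ-zero (ℕₚ.suc-injective e))
      ... | suc (suc _) = contradiction e λ ()

      lip : ∀ {p q} → dist p q ≡ 1 → ∀ z → dist p z ≤ suc (dist q z)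
      lip {u , v} {u′ , v′} e (z , w) with edge u v u′ v′ e
      ... | inj₁ (uu , refl) = ℕₚ.+-monoˡ-≤ (T.δ v w) (S.δ-lip uu z)
      ... | inj₂ (refl , vv) = subst (dist (u , v) (z , w) ≤_) (ℕₚ.+-suc (S.δ u z) _)
                                 (ℕₚ.+-monoʳ-≤ (S.δ u z) (T.δ-lip vv w))

      geo : ∀ {p q k} → dist p q ≡ suc k → Σ (S.P × T.P) λ z → dist p z ≡ 1 × dist z q ≡ k
      geo {u , v} {u′ , v′} e with S.δ u u′ in eq
      ... | zero with T.geo e
      ...   | z , vz , zv = (u , z) , cong₂ ℕ._+_ (S.δ-refl u) vz , cong₂ ℕ._+_ eq zv
      geo {u , v} {u′ , v′} e | suc k with S.geo eq
      ...   | z , uz , zu = (z , v) , cong₂ ℕ._+_ uz (T.δ-refl v) ,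
                            trans (cong (ℕ._+ T.δ v v′) zu) (ℕₚ.suc-injective e)

      -- An edge of the product moves one coordinate; the distance in the other coordinate enters
      -- both terms of `gap` and cancels.
      reflection : ∀ p q → dist p q ≡ 1 → Σ (S.P × T.P → S.P × T.P) λ φ → ∀ y z →
                   + dist (φ y) z ≡ + dist y z + gap dist p q y * gap dist p q z
      reflection (u , v) (u′ , v′) e with edge u v u′ v′ e
      ... | inj₁ (uu , refl) = (λ { (y , z) → S.r uu y , z }) ,
        λ { (y , z) (y′ , z′) → begin
          + (S.δ (S.r uu y) y′ ℕ.+ T.δ z z′)  ≡⟨ cong (_+ + T.δ z z′) (S.r-δ uu y y′) ⟩
          _                                    ≡⟨ lemma (+ S.δ y y′) (+ T.δ z z′)
                                                    (+ S.δ y u′) (+ S.δ y u) (+ T.δ z v) (+ S.δ y′ u′) (+ S.δ y′ u) (+ T.δ z′ v) ⟩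
          _ ∎ }
        where
        open ≡-Reasoning
        lemma : ∀ a b p q m p′ q′ m′ → (a + (p - q) * (p′ - q′)) + b ≡
                a + b + ((p + m) - (q + m)) * ((p′ + m′) - (q′ + m′))
        lemma = solve-∀
      ... | inj₂ (refl , vv) = (λ { (y , z) → y , T.r vv z }) ,
        λ { (y , z) (y′ , z′) → begin
          + (S.δ y y′ ℕ.+ T.δ (T.r vv z) z′)  ≡⟨ cong (λ t → + S.δ y y′ + t) (T.r-δ vv z z′) ⟩
          _                                    ≡⟨ lemma (+ S.δ y y′) (+ T.δ z z′)
                                                    (+ T.δ z v′) (+ T.δ z v) (+ S.δ y u) (+ T.δ z′ v′) (+ T.δ z′ v) (+ S.δ y′ u) ⟩
          _ ∎ }
        where
        open ≡-Reasoning
        lemma : ∀ a b p q m p′ q′ m′ → a + (b + (p - q) * (p′ - q′)) ≡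
                a + b + ((m + p) - (m + q)) * ((m′ + p′) - (m′ + q′))
        lemma = solve-∀

-- Product decomposition along a disconnected local graph

module Decomposition where
  open ReflectionSpaces
  open Subspaces
  open import Data.Nat as ℕ using (ℕ; zero; suc)
  open import Data.Integer using (+_; -_; _+_; _-_; _*_; 1ℤ)
  open import Data.Integer.Tactic.RingSolver using (solve-∀)
  open import Data.List using (List)

  -- q colours the neighbours of x so that different colours are at distance 2.  Part c is spanned
  -- by the edges at x of colour c: its points are those lying on the side of x of every edge of
  -- the other colour.
  module Splitting (S : ReflSpace) (l : List (Pt S)) (l-complete : ∀ v → v ∈ l) (x : Pt S)
               (q : Pt S → Bool)
               (apart : ∀ a b → d S x a ≡ 1 → d S x b ≡ 1 → q a ≡ true → q b ≡ false → d S a b ≡ 2) where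
    open Space S
    open Local S x

    Near : Bool → P → P → Set
    Near c v b = δ x b ≡ 1 → q b ≡ not c → δ v b ≡ suc (δ v x)

    near? : ∀ c v b → Dec (Near c v b)
    near? c v b = (δ x b ℕ.≟ 1) →-dec (q b Boolₚ.≟ not c) →-dec (δ v b ℕ.≟ suc (δ v x))

    part : Bool → P → Bool
    part c v = isYes (all? (near? c v) l)

    part⇒ : ∀ {c v} → T (part c v) → ∀ b → Near c v b
    part⇒ {c} {v} t b = All.lookup (toWitness {a? = all? (near? c v) l} t) (l-complete b)

    part⇐ : ∀ {c v} → (∀ b → Near c v b) → T (part c v)
    part⇐ {c} {v} h = fromWitness {a? = all? (near? c v) l} (All.universal h l)

    apart′ : ∀ c {a b} → δ x a ≡ 1 → δ x b ≡ 1 → q a ≡ c → q b ≡ not c → δ a b ≡ 2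
    apart′ true  p p′ qa qb = apart _ _ p p′ qa qb
    apart′ false p p′ qa qb = trans (δ-sym _ _) (apart _ _ p′ p qb qa)

    base∈ : ∀ c → T (part c x)
    base∈ c = part⇐ λ b p _ → trans p (cong suc (sym (δ-refl x)))

    nbr∈ : ∀ {c a} → δ x a ≡ 1 → q a ≡ c → T (part c a)
    nbr∈ {c} {a} p qa = part⇐ λ b p′ qb →
      trans (apart′ c p p′ qa qb) (cong suc (sym (trans (δ-sym a x) p)))

    nbr∉ : ∀ {c a} → δ x a ≡ 1 → q a ≡ not c → ¬ T (part c a)
    nbr∉ {c} {a} p qa t = contradiction (trans (sym (part⇒ t a p qa)) (δ-refl a)) λ ()

    -- Passing from `x` to `b` raises the distances to `u` and `v` by one each, so `ε u v b` equals
    -- `ε u v x`; hence the reflection changes the distances from `w` to `b` and to `x` by the same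
    -- amount.
    part-reflection-closed : ∀ c → ReflectionClosed S (part c)
    part-reflection-closed c {u} {v} e pu pv w pw = part⇐ λ b p qb → ℤₚ.+-injective (begin
      + δ (r e w) b                             ≡⟨ r-δ e w b ⟩
      + δ w b + ε u v w * (+ δ b v - + δ b u)
        ≡⟨ cong₂ (λ m n → + m + ε u v w * n) (part⇒ pw b p qb)
             (cong₂ (λ m n → + m - + n) (flip-near pv b p qb) (flip-near pu b p qb)) ⟩
      + suc (δ w x) + ε u v w * (+ suc (δ x v) - + suc (δ x u)) ≡⟨ lemma (+ δ w x) (ε u v w) (+ δ x v) (+ δ x u) ⟩
      1ℤ + (+ δ w x + ε u v w * (+ δ x v - + δ x u)) ≡⟨ cong (λ t → 1ℤ + t) (sym (r-δ e w x)) ⟩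
      + suc (δ (r e w) x)                       ∎)
      where
      open ≡-Reasoning
      flip-near : ∀ {u} → T (part c u) → ∀ b → δ x b ≡ 1 → q b ≡ not c → δ b u ≡ suc (δ x u)
      flip-near {u} t b p qb = trans (δ-sym b u) (trans (part⇒ t b p qb) (cong suc (δ-sym u x)))
      lemma : ∀ m e n k → (1ℤ + m) + e * ((1ℤ + n) - (1ℤ + k)) ≡ 1ℤ + (m + e * (n - k))
      lemma = solve-∀

    -- A neighbour of the other colour is farther from `v` than `x` is, so no geodesic from `x` to
    -- `v` begins with it.
    first-step-colour : ∀ {c v a k} → T (part c v) → δ x v ≡ suc k → δ x a ≡ 1 → δ a v ≡ k → q a ≡ c
    first-step-colour {c} {v} {a} {k} t xv xa av with q a Boolₚ.≟ c
    ... | yes qa = qa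
    ... | no ¬qa = contradiction
      (trans (sym (trans (δ-sym v a) av))
        (trans (part⇒ t a xa (Boolₚ.¬-not ¬qa)) (cong suc (trans (δ-sym v x) xv))))
      λ ()

    -- Reflections in edges of colour `c` at `x` preserve the part and bring `u` down to `x`; from
    -- `x` every geodesic to a point of the part begins with the right colour.
    part-geodesically-closed : ∀ c → GeodesicallyClosed S (part c)
    part-geodesically-closed c {u} {w} pu pw e = go (δ x u) u w refl pu pw e
      where
      go : ∀ m u w {k} → δ x u ≡ m → T (part c u) → T (part c w) → δ u w ≡ suc k →
           Σ P λ v → T (part c v) × δ u v ≡ 1 × δ v w ≡ k
      go zero u w xu pu pw e with refl ← δ-zero xu with geo e
      ... | a , xa , aw = a , nbr∈ xa (first-step-colour pw e xa aw) , xa , aw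
      go (suc m) u w xu pu pw e with geo xu
      ... | a , xa , au
        with go m (r xa u) (r xa w)
               (trans (sym (Edge.r-adjoint xa x u)) (trans (cong (λ z → δ z u) (Edge.r-source xa)) au))
               (closed u pu) (closed w pw) (trans (Edge.r-isometry xa u w) e)
        where closed = part-reflection-closed c xa (base∈ c) (nbr∈ xa (first-step-colour pu xu xa au))
      ...   | v , pv , uv , vw =
        r xa v , part-reflection-closed c xa (base∈ c) (nbr∈ xa (first-step-colour pu xu xa au)) v pv
               , trans (sym (Edge.r-adjoint xa u v)) uv , trans (Edge.r-adjoint xa v w) vw

    Part : Bool → ReflSpace
    Part c = subspace S (part c) (part-geodesically-closed c) (part-reflection-closed c)

    -- Only neighbours have to be compared. Those of the base point of the product move one
    -- coordinate, and two that move different coordinates are at distance 2, just like neighbours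
    -- of `x` of different colours.
    split : S ≃ product (Part true) (Part false)
    split = Uniqueness.local-iso S (product (Part true) (Part false)) x o σ σ-nbr σ-iso σ-surj
      where
      open Space (product (Part true) (Part false)) using () renaming (P to Q; δ to δ′)
      o : Q
      o = (x , base∈ true) , (x , base∈ false)

      place : ∀ a c → δ x a ≡ 1 → q a ≡ c → Q
      place a true  p qa = (a , nbr∈ p qa) , proj₂ o
      place a false p qa = proj₁ o , (a , nbr∈ p qa)

      σ : ∀ a → δ x a ≡ 1 → Q
      σ a p = place a (q a) p refl

      σ-nbr : ∀ a p → δ′ o (σ a p) ≡ 1
      σ-nbr a p = go (q a) refl
        where
        go : ∀ c qa → δ′ o (place a c p qa) ≡ 1
        go true  qa = cong₂ ℕ._+_ p (δ-refl x)
        go false qa = cong₂ ℕ._+_ (δ-refl x) p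

      σ-iso : ∀ a p b p′ → δ′ (σ a p) (σ b p′) ≡ δ a b
      σ-iso a p b p′ = go (q a) (q b) refl refl
        where
        go : ∀ c c′ qa qb → δ′ (place a c p qa) (place b c′ p′ qb) ≡ δ a b
        go true true qa qb = trans (cong (δ a b ℕ.+_) (δ-refl x)) (ℕₚ.+-identityʳ _)
        go false false qa qb = cong (ℕ._+ δ a b) (δ-refl x)
        go true false qa qb = trans (cong₂ ℕ._+_ (trans (δ-sym a x) p) p′) (sym (apart′ true p p′ qa qb))
        go false true qa qb = trans (cong₂ ℕ._+_ p′ (trans (δ-sym a x) p)) (sym (apart′ false p p′ qa qb))

      colour : ∀ {c a} → δ x a ≡ 1 → T (part c a) → q a ≡ c
      colour {c} {a} p t = first-step-colour t p p (δ-refl a)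

      place-≡ : ∀ a c p (qa : q a ≡ c) → σ a p ≡ place a c p qa
      place-≡ a c p refl = refl

      σ-surj : ∀ z → δ′ o z ≡ 1 → Σ P λ a → Σ (δ x a ≡ 1) λ p → σ a p ≡ z
      σ-surj ((a , ta) , (b , tb)) e with δ x a in xa | δ x b in xb
      ... | zero | suc zero = b , xb , trans (place-≡ b false xb (colour xb tb))
        (cong₂ _,_ (subset-≡ (part true) (δ-zero xa)) (subset-≡ (part false) refl))
      ... | suc zero | zero = a , xa , trans (place-≡ a true xa (colour xa ta))
        (cong₂ _,_ (subset-≡ (part true) refl) (subset-≡ (part false) (δ-zero xb)))
      ... | zero | zero = contradiction e λ ()
      ... | zero | suc (suc _) = contradiction e λ ()
      ... | suc zero | suc _ = contradiction e λ ()
      ... | suc (suc _) | _ = contradiction e λ ()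

-- From reflective graphs to reflection spaces

module ReflectiveGraphs where
  open ReflectionSpaces
  open import Data.Nat as ℕ using (ℕ; zero; suc; _≤_; _<_; z≤n; s≤s)
  open import Data.Integer using (ℤ; +_; -_; _+_; _-_; _*_; 0ℤ; 1ℤ; -1ℤ)
  open import Data.Integer.Tactic.RingSolver using (solve-∀)

  module _ {G : Graph} where
    reach-suc : ∀ {k x y} → Reach G k x y → Reach G (suc k) x y
    reach-suc here       = here
    reach-suc (step e w) = step e (reach-suc w)

    reach-zero : ∀ {x y} → Reach G 0 x y → x ≡ y
    reach-zero here = refl

    reach-snoc : ∀ {k x y z} → Reach G k x y → adj G y z → Reach G (suc k) x z
    reach-snoc here        e = step e here
    reach-snoc (step e′ w) e = step e′ (reach-snoc w e)

    reach-reverse : (∀ x y → adj G x y → adj G y x) → ∀ {k x y} → Reach G k x y → Reach G k y x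
    reach-reverse s here       = here
    reach-reverse s (step e w) = reach-snoc (reach-reverse s w) (s _ _ e)

    -- As long as adjacency is not known to be decidable, a least walk length is available only
    -- under double negation.
    ¬¬dist : ∀ {k x y} → Reach G k x y → ¬ ¬ (∃ λ a → Dist G x y a)
    ¬¬dist {x = x} {y} w none = <-rec (λ k → ¬ Reach G k x y)
      (λ k below w → none (k , w , λ j w′ → ℕₚ.≮⇒≥ λ j<k → below j<k w′)) _ w

  reach-map : ∀ {G H} (f : V G → V H) → (∀ {x y} → adj G x y → adj H (f x) (f y)) →
              ∀ {k x y} → Reach G k x y → Reach H k (f x) (f y)
  reach-map f p here       = here
  reach-map f p (step e w) = step (p e) (reach-map f p w)

  module Reflections (G : Graph) (simple : Simple G) (finite : Finite G) (connected : Connected G)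
                     (reflective : Reflective G) where
    irrefl : ∀ {x} → ¬ adj G x x
    irrefl = proj₁ simple _

    symm : ∀ {x y} → adj G x y → adj G y x
    symm = proj₂ simple _ _

    module F = Inverse (proj₂ finite)

    infix 4 _≟ᵥ_
    _≟ᵥ_ : (x y : V G) → Dec (x ≡ y)
    x ≟ᵥ y = map′ (λ e → trans (sym (F.strictlyInverseʳ x)) (trans (cong F.from e) (F.strictlyInverseʳ y)))
      (cong F.to) (F.to x Finₚ.≟ F.to y)

    module Refl {x y} (e : adj G x y) where
      φ : V G → V G
      φ = proj₁ (reflective x y e)
      open IsReflection (proj₂ (reflective x y e)) public

      adj-φ : ∀ {u v} → adj G u v → adj G (φ u) (φ v)
      adj-φ {u} {v} = Equivalence.to (automorphism u v)

      maps-y-to-x : φ y ≡ x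
      maps-y-to-x = trans (cong φ (sym maps-x-to-y)) (involution x)

    -- The next point of a walk on the side of z, unless fixed by the reflection or across from w.
    ¬¬same-side : ∀ {x z} (e : adj G x z) {w w′} → let open Refl e in
                  ¬ ¬ InV G z x w → adj G w w′ → φ w′ ≢ w′ → w′ ≢ φ w → ¬ ¬ InV G z x w′
    ¬¬same-side {x} {z} e {w} {w′} side ww′ moved uncrossed none =
      side λ inw → ¬¬dist (proj₂ (proj₂ connected w′ x)) λ { (a , da) →
      ¬¬dist (proj₂ (proj₂ connected w′ z)) λ { (b , db) → cmp inw da db } }
      where
      open Refl e
      cmp : ∀ {a b} → InV G z x w → Dist G w′ x a → Dist G w′ z b → ⊥
      cmp {a} {b} inw da db with ℕₚ.<-cmp a b
      ... | tri< a<b _ _ = uncrossed (trans (sym (involution w′))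
        (cong φ (sym (edges-⊆ w′ w (a , b , da , db , a<b) inw (symm ww′)))))
      ... | tri≈ _ refl _ = moved (fixes-mid w′ (a , da , db))
      ... | tri> _ _ b<a = none (b , a , db , da , b<a)

    -- Fold a walk from z to y by the reflection in xz: either the folded walk gets from x to y
    -- without losing a step, or the whole walk stays on the side of z.
    fold : ∀ {x z y} (e : adj G x z) → let open Refl e in ∀ k w → Reach G k w y →
           ¬ ¬ InV G z x w → Reach G k (φ w) y ⊎ ¬ ¬ InV G z x y
    fold e k w here side = inj₂ side
    fold e (suc k) w (step {z = w′} ww′ walk) side with Refl.φ e w′ ≟ᵥ w′ | w′ ≟ᵥ Refl.φ e w
    ... | yes fixed | _        = inj₁ (step (subst (adj G _) fixed (Refl.adj-φ e ww′)) walk)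
    ... | no _      | yes refl = inj₁ (reach-suc walk)
    ... | no moved  | no uncrossed with fold e k w′ walk (¬¬same-side e side ww′ moved uncrossed)
    ...   | inj₁ walk′ = inj₁ (step (Refl.adj-φ e ww′) walk′)
    ...   | inj₂ side′ = inj₂ side′

    -- Let `z` be the second vertex of the walk. Either folding gives a walk from `x` to `y` that is
    -- one step shorter, or `y` is nearer to `z` than to `x`. In the latter case an edge `x y` would
    -- force distance 0 from `y` to `z`, so the question is whether `y` equals `z`.
    adj?-walk : ∀ k {x y} → Reach G k x y → Dec (adj G x y)
    adj?-walk k here = no irrefl
    adj?-walk (suc k) {x} {y} (step {z = z} e walk)
      with fold e k z walk (λ none → none (0 , 1 , (here , λ _ _ → z≤n) ,
             (step (symm e) here , λ { zero w → contradiction (subst (adj G x) (reach-zero w) e) irrefl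
                                     ; (suc j) _ → s≤s z≤n }) , s≤s z≤n))
    ... | inj₁ walk′ = adj?-walk k (subst (λ u → Reach G k u y) (Refl.maps-y-to-x e) walk′)
    ... | inj₂ side with y ≟ᵥ z
    ...   | yes refl = yes e
    ...   | no y≢z   = no λ xy → side λ { (zero , b , (w , _) , _) → y≢z (reach-zero w)
                                        ; (suc a , b , _ , (_ , least) , a<b) →
                                            contradiction (ℕₚ.≤-trans a<b (least 1 (step (symm xy) here))) λ { (s≤s ()) } }

    adj? : ∀ x y → Dec (adj G x y)
    adj? x y = adj?-walk _ (proj₂ (proj₂ connected x y))

    reach? : ∀ k x y → Dec (Reach G k x y)
    reach? zero x y = map′ (λ { refl → here }) reach-zero (x ≟ᵥ y)
    reach? (suc k) x y = map′
      (λ { (inj₁ refl) → here ; (inj₂ (i , e , w)) → step e w })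
      (λ { here → inj₁ refl
         ; (step {z = z} e w) → inj₂ (F.to z , subst (λ v → adj G x v × Reach G k v y)
                                  (sym (F.strictlyInverseʳ z)) (e , w)) })
      ((x ≟ᵥ y) ⊎-dec Finₚ.any? λ i → adj? x (F.from i) ×-dec reach? k (F.from i) y)

    dist : ∀ x y → ∃ (Dist G x y)
    dist x y = search (proj₁ walk) 0 (λ j _ → z≤n) (subst (λ k → Reach G k x y) (sym (ℕₚ.+-identityʳ _)) (proj₂ walk))
      where
      walk = proj₂ connected x y
      -- `f` is fuel: a walk of length `f + k` is always at hand, so `k` is the distance when the
      -- fuel runs out.
      search : ∀ f k → (∀ j → Reach G j x y → k ≤ j) → Reach G (f ℕ.+ k) x y → ∃ (Dist G x y)
      search zero k least w = k , w , least
      search (suc f) k least w with reach? k x y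
      ... | yes w′ = k , w′ , least
      ... | no ¬w = search f (suc k)
        (λ j w′ → ℕₚ.≤∧≢⇒< (least j w′) λ { refl → ¬w w′ })
        (subst (λ m → Reach G m x y) (sym (ℕₚ.+-suc f k)) w)

    δ : V G → V G → ℕ
    δ x y = proj₁ (dist x y)

    δ-walk : ∀ x y → Reach G (δ x y) x y
    δ-walk x y = proj₁ (proj₂ (dist x y))

    δ-least : ∀ {k x y} → Reach G k x y → δ x y ≤ k
    δ-least {k} {x} {y} = proj₂ (proj₂ (dist x y)) k

    δ-refl : ∀ x → δ x x ≡ 0
    δ-refl x = ℕₚ.n≤0⇒n≡0 (δ-least {0} {x} here)

    δ-zero : ∀ {x y} → δ x y ≡ 0 → x ≡ y
    δ-zero {x} {y} e = reach-zero (subst (λ k → Reach G k x y) e (δ-walk x y))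

    δ-sym : ∀ x y → δ x y ≡ δ y x
    δ-sym x y = ℕₚ.≤-antisym (δ-least (reach-reverse (proj₂ simple) (δ-walk y x)))
                              (δ-least (reach-reverse (proj₂ simple) (δ-walk x y)))

    adj⇒δ : ∀ {x y} → adj G x y → δ x y ≡ 1
    adj⇒δ {x} {y} e with δ x y in eq | δ-least {1} (step e here)
    ... | zero     | _       = contradiction (subst (adj G x) (sym (δ-zero eq)) e) irrefl
    ... | suc zero | _       = refl
    ... | suc (suc _) | s≤s ()

    geo : ∀ {x z k} → δ x z ≡ suc k → Σ (V G) λ y → δ x y ≡ 1 × δ y z ≡ k
    geo {x} {z} {k} e = go (subst (λ j → Reach G j x z) e (δ-walk x z))
      where
      go : Reach G (suc k) x z → Σ (V G) λ y → δ x y ≡ 1 × δ y z ≡ k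
      go here = contradiction (trans (sym (δ-refl x)) e) λ ()
      go (step {z = y} xy w) = y , adj⇒δ xy , ℕₚ.≤-antisym (δ-least w)
        (ℕₚ.≤-pred (subst (_≤ suc (δ y z)) e (δ-least (step xy (δ-walk y z)))))

    δ⇒adj : ∀ {x y} → δ x y ≡ 1 → adj G x y
    δ⇒adj {x} {y} e = go (subst (λ j → Reach G j x y) e (δ-walk x y))
      where
      go : Reach G 1 x y → adj G x y
      go here = contradiction (trans (sym (δ-refl x)) e) λ ()
      go (step e here) = e

    δ-lip : ∀ {x y} → δ x y ≡ 1 → ∀ z → δ x z ≤ suc (δ y z)
    δ-lip e z = δ-least (step (δ⇒adj e) (δ-walk _ z))

    inV : ∀ {x y u} → δ u x < δ u y → InV G x y u
    inV {x} {y} {u} lt = δ u x , δ u y , proj₂ (dist u x) , proj₂ (dist u y) , lt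

    module Sides {x y} (e : adj G x y) where
      open Refl e

      isometry : ∀ u v → δ (φ u) (φ v) ≡ δ u v
      isometry u v = ℕₚ.≤-antisym (half u v)
        (subst₂ (λ a b → δ a b ≤ δ (φ u) (φ v)) (involution u) (involution v) (half (φ u) (φ v)))
        where
        half : ∀ u v → δ (φ u) (φ v) ≤ δ u v
        half u v = δ-least (reach-map {G} {G} φ adj-φ (δ-walk u v))

      adjoint : ∀ u v → δ (φ u) v ≡ δ u (φ v)
      adjoint u v = trans (cong (δ (φ u)) (sym (involution v))) (isometry u (φ v))

      Here There : V G → Set
      Here  u = δ u x < δ u y
      There u = δ u y < δ u x

      φ-there : ∀ {u} → Here u → There (φ u)
      φ-there {u} = subst₂ _<_
        (trans (cong (δ u) (sym maps-y-to-x)) (sym (adjoint u y)))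
        (trans (cong (δ u) (sym maps-x-to-y)) (sym (adjoint u x)))

      φ-here : ∀ {u} → There u → Here (φ u)
      φ-here {u} = subst₂ _<_
        (trans (cong (δ u) (sym maps-x-to-y)) (sym (adjoint u x)))
        (trans (cong (δ u) (sym maps-y-to-x)) (sym (adjoint u y)))

      crossing : ∀ {u v} → Here u → There v → adj G u v → v ≡ φ u
      crossing hu tv = edges-⊆ _ _ (inV hu) (inV tv)

      rung : ∀ {u} → Here u → adj G u (φ u)
      rung hu = proj₂ (edges-⊇ _ (inV hu))

      middle : ∀ {u} → δ u x ≡ δ u y → φ u ≡ u
      middle {u} e = fixes-mid u (δ u x , proj₂ (dist u x) , subst (Dist G u y) (sym e) (proj₂ (dist u y)))

      -- Here is connected, being star-shaped about x.
      here-connected : (Q : V G → Set) → (∀ {w w′} → Here w → Here w′ → adj G w w′ → Q w → Q w′) →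
                       ∀ {u w} → Here u → Here w → Q u → Q w
      here-connected Q propagate hu hw q =
        from-x _ _ refl hw (to-x _ _ refl hu q)
        where
        -- A step towards `x` lowers the distance to `x` by one and the distance to `y` by at most
        -- one.
        next : ∀ {k u z} → Here u → δ u x ≡ suc k → δ u z ≡ 1 → δ z x ≡ k → Here z
        next {k} {u} {z} hu ux uz zx = ℕₚ.≤-pred (ℕₚ.≤-trans
          (subst (λ m → m < δ u y) (trans ux (cong suc (sym zx))) hu) (δ-lip uz y))
        to-x : ∀ k u → δ u x ≡ k → Here u → Q u → Q x
        to-x zero u ux hu qu = subst Q (δ-zero ux) qu
        to-x (suc k) u ux hu qu with geo ux
        ... | z , uz , zx = to-x k z zx hz (propagate hu hz (δ⇒adj uz) qu)
          where hz = next hu ux uz zx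
        from-x : ∀ k u → δ u x ≡ k → Here u → Q x → Q u
        from-x zero u ux hu qx = subst Q (sym (δ-zero ux)) qx
        from-x (suc k) u ux hu qx with geo ux
        ... | z , uz , zx = propagate hz hu (symm (δ⇒adj uz)) (from-x k z zx hz qx)
          where hz = next hu ux uz zx

    -- The reflection in xy is also the reflection in every edge joining the two sides of xy.
    module _ {x y} (e : adj G x y) where
      open Refl e
      open Sides e

      -- Let ψ be the reflection in the edge from `u` to `φ u`. If `w` is nearer to `u`, its
      -- neighbour `φ w` is nearer to `φ u`, so ψ sends `w` to `φ w`. An edge from `w` to `w′`
      -- within `Here` therefore stays nearer to `u`: if it crossed, `w′` would be `φ w`, which lies
      -- in `There`; if `w′` were equidistant, it would be fixed by ψ, hence adjacent to `φ w`,
      -- hence equal to `w`.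
      closer-than-image : ∀ {u w} → Here u → Here w → δ w u < δ w (φ u)
      closer-than-image {u} {w} hu hw = here-connected (λ w → δ w u < δ w (φ u)) propagate hu hw
        (subst₂ _<_ (sym (δ-refl u)) (sym (adj⇒δ (rung hu))) (s≤s z≤n))
        where
        module ψ = Refl (rung hu)
        module Ψ = Sides (rung hu)
        φw≡ψw : ∀ {w} → Here w → Ψ.Here w → φ w ≡ ψ.φ w
        φw≡ψw {w} hw pw = Ψ.crossing pw (subst₂ _<_ (sym (isometry w u)) (sym (adjoint w u)) pw) (rung hw)
        propagate : ∀ {w w′} → Here w → Here w′ → adj G w w′ → Ψ.Here w → Ψ.Here w′
        propagate {w} {w′} hw hw′ ww′ pw with ℕₚ.<-cmp (δ w′ u) (δ w′ (φ u))
        ... | tri< lt _ _ = lt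
        ... | tri≈ _ eq _ = contradiction (subst (adj G w) (sym w≡w′) ww′) irrefl
          where
          w≡w′ : w ≡ w′
          w≡w′ = trans (sym (involution w)) (trans (cong φ (crossing hw′ (φ-there hw)
            (subst₂ (adj G) (Ψ.middle eq) (sym (φw≡ψw hw pw)) (ψ.adj-φ (symm ww′))))) (involution w′))
        ... | tri> _ _ gt = contradiction hw′ (ℕₚ.<-asym (subst There (sym w′≡φw) (φ-there hw)))
          where
          w′≡φw : w′ ≡ φ w
          w′≡φw = trans (Ψ.crossing pw gt ww′) (sym (φw≡ψw hw pw))

      far-side : ∀ {u w} → Here u → Here w → δ (φ u) w ≡ suc (δ u w)
      far-side {u} {w} hu hw = trans (δ-sym (φ u) w) (trans (ℕₚ.≤-antisym
        (subst₂ _≤_ (δ-sym (φ u) w) (cong suc (δ-sym u w)) (δ-lip (trans (δ-sym (φ u) u) (adj⇒δ (rung hu))) w))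
        (closer-than-image hu hw)) (cong suc (δ-sym w u)))

      suc-here : ∀ {u} → Here u → δ u y ≡ suc (δ u x)
      suc-here {u} hu = ℕₚ.≤-antisym
        (subst₂ _≤_ (δ-sym y u) (cong suc (δ-sym x u)) (δ-lip (adj⇒δ (symm e)) u)) hu

      suc-there : ∀ {u} → There u → δ u x ≡ suc (δ u y)
      suc-there {u} tu = ℕₚ.≤-antisym
        (subst₂ _≤_ (δ-sym x u) (cong suc (δ-sym y u)) (δ-lip (adj⇒δ e) u)) tu

      -- Indexed by the value of `gap`, so that matching on the sides of two points turns the
      -- product in the formula into a numeral.
      data Side (u : V G) : ℤ → Set where
        near   : Here u → Side u 1ℤ
        far    : There u → Side u -1ℤ
        equal  : δ u x ≡ δ u y → Side u 0ℤ

      side : ∀ u → Side u (gap δ x y u)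
      side u with ℕₚ.<-cmp (δ u x) (δ u y)
      ... | tri< lt _ _ = subst (Side u) (sym (trans (cong (λ m → + m - + δ u x) (suc-here lt)) (lemma (+ δ u x)))) (near lt)
        where
        lemma : ∀ m → (1ℤ + m) - m ≡ 1ℤ
        lemma = solve-∀
      ... | tri≈ _ eq _ = subst (Side u) (sym (trans (cong (λ m → + δ u y - + m) eq) (ℤₚ.+-inverseʳ (+ δ u y)))) (equal eq)
      ... | tri> _ _ gt = subst (Side u) (sym (trans (cong (λ m → + δ u y - + m) (suc-there gt)) (lemma (+ δ u y)))) (far gt)
        where
        lemma : ∀ m → m - (1ℤ + m) ≡ -1ℤ
        lemma = solve-∀

      -- On a common side `far-side` applies; on opposite sides it applies after `φ` has moved one
      -- point across; a point in the middle is fixed.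
      reflection-formula : ∀ u v → + δ (φ u) v ≡ + δ u v + gap δ x y u * gap δ x y v
      reflection-formula u v = go (side u) (side v)
        where
        suc-1 : ∀ {m n} → n ≡ suc m → + m ≡ + n + -1ℤ
        suc-1 {m} refl = lemma (+ m)
          where
          lemma : ∀ m → m ≡ 1ℤ + m + -1ℤ
          lemma = solve-∀
        suc+1 : ∀ {m n} → n ≡ suc m → + n ≡ + m + 1ℤ
        suc+1 {m} refl = ℤₚ.+-comm 1ℤ (+ m)
        same : ∀ {m n} → m ≡ n → + m ≡ + n + 0ℤ
        same {m} refl = sym (ℤₚ.+-identityʳ (+ m))
        go : ∀ {s t} → Side u s → Side v t → + δ (φ u) v ≡ + δ u v + s * t
        go (near hu)   (near hv)   = suc+1 (far-side hu hv)
        go (near hu)   (far tv)    = suc-1 (trans (sym (isometry u v))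
          (trans (far-side hu (φ-here tv)) (cong suc (sym (adjoint u v)))))
        go (near hu)   (equal mv)  = same (trans (cong (δ (φ u)) (sym (middle mv))) (isometry u v))
        go (far tu)    (near hv)   = suc-1 (trans (cong (λ w → δ w v) (sym (involution u))) (far-side (φ-here tu) hv))
        go (far tu)    (far tv)    = suc+1 (begin
          δ (φ u) v              ≡⟨ δ-sym (φ u) v ⟩
          δ v (φ u)              ≡⟨ cong (λ w → δ w (φ u)) (sym (involution v)) ⟩
          δ (φ (φ v)) (φ u)      ≡⟨ far-side (φ-here tv) (φ-here tu) ⟩
          suc (δ (φ v) (φ u))    ≡⟨ cong suc (trans (isometry v u) (δ-sym v u)) ⟩
          suc (δ u v)            ∎)
          where open ≡-Reasoning
        go (far tu)    (equal mv)  = same (trans (cong (δ (φ u)) (sym (middle mv))) (isometry u v))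
        go (equal mu)  tv          = same′ tv (cong (λ w → δ w v) (middle mu))
          where
          same′ : ∀ {t m n} → Side v t → m ≡ n → + m ≡ + n + 0ℤ * t
          same′ _ = same

    space : ReflSpace
    space = record
      { Pt = V G ; d = δ ; d-refl = δ-refl ; d-zero = δ-zero ; d-sym = δ-sym ; d-lip = δ-lip
      ; geodesic = geo ; ρ = λ e → Refl.φ (δ⇒adj e) ; ρ-d = λ e → reflection-formula (δ⇒adj e) }

-- From reflection spaces to reflective graphs

module GraphsOfSpaces where
  open ReflectionSpaces
  open ReflectiveGraphs
  open import Data.Nat using (zero; suc; _≤_; _<_; z≤n; s≤s)
  open import Data.Integer using (+_; -_; _+_; _-_; _*_; 0ℤ; 1ℤ)
  open import Data.Integer.Tactic.RingSolver using (solve-∀)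

  graph : ReflSpace → Graph
  graph S = record { V = Pt S ; adj = λ x y → d S x y ≡ 1 }

  module _ {G H : Graph} where
    iso : (f : V G → V H) (g : V H → V G) → (∀ v → f (g v) ≡ v) → (∀ u → g (f u) ≡ u) →
          (∀ {u v} → adj G u v → adj H (f u) (f v)) → (∀ {u v} → adj H (f u) (f v) → adj G u v) → G ≅ H
    iso f g fg gf p q = mk↔ₛ′ f g fg gf , λ u v → mk⇔ p q

    module Iso (i : G ≅ H) where
      open Inverse (proj₁ i) public using () renaming
        (to to f; from to g; strictlyInverseˡ to fg; strictlyInverseʳ to gf)

      adj-f : ∀ {u v} → adj G u v → adj H (f u) (f v)
      adj-f = Equivalence.to (proj₂ i _ _)

      f-adj : ∀ {u v} → adj H (f u) (f v) → adj G u v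
      f-adj = Equivalence.from (proj₂ i _ _)

      adj-g : ∀ {u v} → adj H u v → adj G (g u) (g v)
      adj-g a = f-adj (subst₂ (adj H) (sym (fg _)) (sym (fg _)) a)

      g-adj : ∀ {u v} → adj G (g u) (g v) → adj H u v
      g-adj a = subst₂ (adj H) (fg _) (fg _) (adj-f a)

  ≅-sym : ∀ {G H} → G ≅ H → H ≅ G
  ≅-sym {G} {H} i = iso {H} {G} g f gf fg adj-g g-adj
    where open Iso {G} {H} i

  ≅-trans : ∀ {G H K} → G ≅ H → H ≅ K → G ≅ K
  ≅-trans {G} {H} {K} i j = iso {G} {K} (λ u → J.f (I.f u)) (λ v → I.g (J.g v))
    (λ v → trans (cong J.f (I.fg _)) (J.fg v)) (λ u → trans (cong I.g (J.gf _)) (I.gf u))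
    (λ a → J.adj-f (I.adj-f a)) (λ a → I.f-adj (J.f-adj a))
    where
    module I = Iso {G} {H} i
    module J = Iso {H} {K} j

  ≃⇒≅ : ∀ {S T} → S ≃ T → graph S ≅ graph T
  ≃⇒≅ {S} {T} e = iso {graph S} {graph T} to from to-from from-to (λ {u} {v} a → trans (to-d u v) a) (λ {u} {v} a → trans (sym (to-d u v)) a)
    where open _≃_ e

  InList-≅ : ∀ {G H} → G ≅ H → InList H → InList G
  InList-≅ {G} {H} i (basic (inj₁ (m , j)))                      = basic (inj₁ (m , ≅-trans {G} {H} {CocktailParty m} i j))
  InList-≅ {G} {H} i (basic (inj₂ (inj₁ (n , k , j))))           = basic (inj₂ (inj₁ (n , k , ≅-trans {G} {H} {Johnson n k} i j)))
  InList-≅ {G} {H} i (basic (inj₂ (inj₂ (inj₁ (n , j)))))        = basic (inj₂ (inj₂ (inj₁ (n , ≅-trans {G} {H} {HalvedCube n} i j))))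
  InList-≅ {G} {H} i (basic (inj₂ (inj₂ (inj₂ (inj₁ j)))))       = basic (inj₂ (inj₂ (inj₂ (inj₁ (≅-trans {G} {H} {Schlaefli} i j)))))
  InList-≅ {G} {H} i (basic (inj₂ (inj₂ (inj₂ (inj₂ j)))))       = basic (inj₂ (inj₂ (inj₂ (inj₂ (≅-trans {G} {H} {Gosset} i j)))))
  InList-≅ {G} {H} i (prod {H₁ = K} {L} a b j) = prod a b (≅-trans {G} {H} {K □ L} i j)

  module _ (S : ReflSpace) {G : Graph} (i : G ≅ graph S) where
    open Iso {G} {graph S} i
    open Space S

    walk-bound : ∀ {k u v} → Reach G k u v → δ (f u) (f v) ≤ k
    walk-bound {u = u} here rewrite δ-refl (f u) = z≤n
    walk-bound (step e w) = ℕₚ.≤-trans (δ-lip (adj-f e) _) (s≤s (walk-bound w))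

    walk : ∀ k u v → δ (f u) (f v) ≡ k → Reach G k u v
    walk zero u v e = subst (Reach G 0 u) (trans (sym (gf u)) (trans (cong g (δ-zero e)) (gf v))) here
    walk (suc k) u v e with geo e
    ... | w , uw , wv = step (subst₂ (adj G) (gf u) refl (adj-g uw))
                             (walk k (g w) v (trans (cong (λ z → δ z (f v)) (fg w)) wv))

    -- The Lipschitz axiom bounds the length of every walk from below, and geodesics supply a walk
    -- attaining the bound.
    dist-δ : ∀ u v → Dist G u v (δ (f u) (f v))
    dist-δ u v = walk _ u v refl , λ j → walk-bound

    dist⇒δ : ∀ {u v k} → Dist G u v k → k ≡ δ (f u) (f v)
    dist⇒δ {u} {v} (w , least) = ℕₚ.≤-antisym (least _ (walk _ u v refl)) (walk-bound w)

    InV⇒< : ∀ {x y u} → InV G x y u → δ (f u) (f x) < δ (f u) (f y)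
    InV⇒< (a , b , da , db , lt) = subst₂ _<_ (dist⇒δ da) (dist⇒δ db) lt

    -- With δ(u,v) = 1, the formula reads δ(ρu,v) = 1 + ε(u)ε(v) for ε(u) > 0 > ε(v).
    opposite : ∀ {a b a′ b′ m} → a < b → b′ < a′ → b ≤ suc a → a′ ≤ suc b′ →
               + m ≡ + 1 + (+ b - + a) * (+ b′ - + a′) → m ≡ 0
    opposite {a} {b} {a′} {b′} lt lt′ le le′ e
      with refl ← ℕₚ.≤-antisym lt le with refl ← ℕₚ.≤-antisym lt′ le′ =
      ℤₚ.+-injective (trans e (lemma (+ a) (+ b′)))
      where
      lemma : ∀ a b → 1ℤ + ((1ℤ + a) - a) * (b - (1ℤ + b)) ≡ 0ℤ
      lemma = solve-∀

    -- Each clause is the reflection formula at a suitable pair. From `u` to its own image the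
    -- distance is the square of `ε`: 1 on the side of `x`, 0 in the middle. From the image of `u`
    -- to a neighbour of `u` across the edge it is 1 - 1 = 0.
    toReflective : Reflective G
    toReflective x y e = φ , record
      { automorphism = λ u v → mk⇔
          (λ a → adj-g (trans (r-isometry (f u) (f v)) (adj-f a)))
          (λ a → f-adj (trans (sym (r-isometry (f u) (f v))) (g-adj a)))
      ; involution   = λ u → trans (cong g (trans (cong (r e′) (fg _)) (r-involutive (f u)))) (gf u)
      ; maps-x-to-y  = trans (cong g r-source) (gf y)
      ; edges-⊇      = λ u iu → let lt = InV⇒< iu in
          (_ , _ , dist-δ _ y , dist-δ _ x ,
             subst₂ _<_ (sym (φ-δ u x y r-target)) (sym (φ-δ u y x r-source)) lt) ,
          subst (λ z → adj G z (φ u)) (gf u) (adj-g (trans (δ-sym (f u) (r e′ (f u)))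
            (ℤₚ.+-injective (trans (r-δ e′ (f u) (f u)) (trans (cong (λ z → z + ε (f x) (f y) (f u) * ε (f x) (f y) (f u)) (cong +_ (δ-refl (f u))))
               (square lt (lip≤ u)))))))
      ; edges-⊆      = λ u v iu iv a → trans (sym (gf v)) (cong g (sym (δ-zero {r e′ (f u)} {f v}
          (opposite (InV⇒< iu) (InV⇒< iv) (lip≤ u) (lip≥ v)
            (trans (r-δ e′ (f u) (f v)) (cong (λ z → + z + ε (f x) (f y) (f u) * ε (f x) (f y) (f v)) (adj-f a)))))))
      ; fixes-mid    = λ { z (a , da , db) → trans (cong g (δ-zero (ℤₚ.+-injective (trans (r-δ e′ (f z) (f z))
          (cong₂ _+_ (cong +_ (δ-refl (f z))) (zero-gap (dist⇒δ da) (dist⇒δ db))))))) (gf z) }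
      }
      where
      e′ : δ (f x) (f y) ≡ 1
      e′ = adj-f e
      open Edge e′
      φ : V G → V G
      φ u = g (r e′ (f u))
      φ-δ : ∀ u z z′ → r e′ (f z′) ≡ f z → δ (f (φ u)) (f z′) ≡ δ (f u) (f z)
      φ-δ u z z′ eq = trans (cong (λ w → δ w (f z′)) (fg _)) (trans (r-adjoint (f u) (f z′)) (cong (δ (f u)) eq))
      lip≤ : ∀ u → δ (f u) (f y) ≤ suc (δ (f u) (f x))
      lip≤ u = subst₂ _≤_ (δ-sym (f y) (f u)) (cong suc (δ-sym (f x) (f u))) (δ-lip (trans (δ-sym (f y) (f x)) e′) (f u))
      lip≥ : ∀ u → δ (f u) (f x) ≤ suc (δ (f u) (f y))
      lip≥ u = subst₂ _≤_ (δ-sym (f x) (f u)) (cong suc (δ-sym (f y) (f u))) (δ-lip e′ (f u))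
      square : ∀ {a b} → a < b → b ≤ suc a → + 0 + (+ b - + a) * (+ b - + a) ≡ + 1
      square {a} lt le with refl ← ℕₚ.≤-antisym lt le = lemma (+ a)
        where
        lemma : ∀ a → + 0 + ((1ℤ + a) - a) * ((1ℤ + a) - a) ≡ 1ℤ
        lemma = solve-∀
      zero-gap : ∀ {k u v t} → k ≡ u → k ≡ v → (+ v - + u) * t ≡ 0ℤ
      zero-gap {k} {t = t} refl refl = trans (cong (_* t) (ℤₚ.+-inverseʳ (+ k))) (ℤₚ.*-zeroˡ t)

-- Hamming distance on binary words

module Hamming where
  open ReflectionSpaces
  open import Data.Nat using (ℕ; suc; _+_; _≤_; _<_; z≤n; s≤s)
  open import Data.Nat.Tactic.RingSolver using (solve-∀)
  open import Data.Integer using (+_) renaming (_+_ to _+ℤ_; _-_ to _-ℤ_; _*_ to _*ℤ_)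

  Bits : ℕ → Set
  Bits = Vec Bool

  h₁ : Bool → Bool → ℕ
  h₁ a b = if a xor b then 1 else 0

  h : ∀ {n} → Bits n → Bits n → ℕ
  h []      []      = 0
  h (a ∷ s) (b ∷ t) = h₁ a b + h s t

  h-refl : ∀ {n} (s : Bits n) → h s s ≡ 0
  h-refl []          = refl
  h-refl (true ∷ s)  = h-refl s
  h-refl (false ∷ s) = h-refl s

  h-zero : ∀ {n} {s t : Bits n} → h s t ≡ 0 → s ≡ t
  h-zero {s = []} {[]} e = refl
  h-zero {s = true ∷ s} {true ∷ t} e = cong (true ∷_) (h-zero e)
  h-zero {s = false ∷ s} {false ∷ t} e = cong (false ∷_) (h-zero e)

  h-sym : ∀ {n} (s t : Bits n) → h s t ≡ h t s
  h-sym [] [] = refl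
  h-sym (true ∷ s) (true ∷ t) = h-sym s t
  h-sym (true ∷ s) (false ∷ t) = cong suc (h-sym s t)
  h-sym (false ∷ s) (true ∷ t) = cong suc (h-sym s t)
  h-sym (false ∷ s) (false ∷ t) = h-sym s t

  interchange : ∀ a b c d → (a + b) + (c + d) ≡ (a + c) + (b + d)
  interchange = solve-∀

  h₁-triangle : ∀ a b c → h₁ a c ≤ h₁ a b + h₁ b c
  h₁-triangle true  true  c     = ℕₚ.≤-refl
  h₁-triangle true  false true  = z≤n
  h₁-triangle true  false false = ℕₚ.≤-refl
  h₁-triangle false false c     = ℕₚ.≤-refl
  h₁-triangle false true  true  = ℕₚ.≤-refl
  h₁-triangle false true  false = z≤n

  h-triangle : ∀ {n} (s t u : Bits n) → h s u ≤ h s t + h t u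
  h-triangle [] [] [] = z≤n
  h-triangle (a ∷ s) (b ∷ t) (c ∷ u) = subst (h₁ a c + h s u ≤_)
    (interchange (h₁ a b) (h₁ b c) (h s t) (h t u))
    (ℕₚ.+-mono-≤ (h₁-triangle a b c) (h-triangle s t u))

  ∅ : ∀ n → Bits n
  ∅ n = replicate n false

  h-∅ : ∀ {n} (s : Bits n) → h s (∅ n) ≡ ∣ s ∣
  h-∅ [] = refl
  h-∅ (true ∷ s) = cong suc (h-∅ s)
  h-∅ (false ∷ s) = h-∅ s

  h-∩ : ∀ {n} (s t : Bits n) → h s t + (∣ s ∩ t ∣ + ∣ s ∩ t ∣) ≡ ∣ s ∣ + ∣ t ∣
  h-∩ [] [] = refl
  h-∩ (true ∷ s) (true ∷ t) = trans (lemma (h s t) ∣ s ∩ t ∣) (trans (cong (λ m → 2 + m) (h-∩ s t)) (lemma′ ∣ s ∣ ∣ t ∣))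
    where
    lemma : ∀ a b → a + (suc b + suc b) ≡ 2 + (a + (b + b))
    lemma = solve-∀
    lemma′ : ∀ a b → 2 + (a + b) ≡ suc a + suc b
    lemma′ = solve-∀
  h-∩ (true ∷ s) (false ∷ t) = cong suc (h-∩ s t)
  h-∩ (false ∷ s) (true ∷ t) = trans (cong suc (h-∩ s t)) (sym (ℕₚ.+-suc ∣ s ∣ ∣ t ∣))
  h-∩ (false ∷ s) (false ∷ t) = h-∩ s t

  h-∁ : ∀ {n} (s t : Bits n) → h (∁ s) t + h s t ≡ n
  h-∁ [] [] = refl
  h-∁ (true ∷ s) (true ∷ t) = cong suc (h-∁ s t)
  h-∁ (true ∷ s) (false ∷ t) = trans (ℕₚ.+-suc (h (∁ s) t) (h s t)) (cong suc (h-∁ s t))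
  h-∁ (false ∷ s) (true ∷ t) = trans (ℕₚ.+-suc (h (∁ s) t) (h s t)) (cong suc (h-∁ s t))
  h-∁ (false ∷ s) (false ∷ t) = cong suc (h-∁ s t)

  h-∁-∁ : ∀ {n} (s t : Bits n) → h (∁ s) (∁ t) ≡ h s t
  h-∁-∁ [] [] = refl
  h-∁-∁ (true ∷ s) (true ∷ t) = h-∁-∁ s t
  h-∁-∁ (true ∷ s) (false ∷ t) = cong suc (h-∁-∁ s t)
  h-∁-∁ (false ∷ s) (true ∷ t) = cong suc (h-∁-∁ s t)
  h-∁-∁ (false ∷ s) (false ∷ t) = h-∁-∁ s t

  ∁-card : ∀ {n} (s : Bits n) → ∣ ∁ s ∣ + ∣ s ∣ ≡ n
  ∁-card {n} s = trans (sym (cong₂ _+_ (h-∅ (∁ s)) (h-∅ s))) (h-∁ s (∅ n))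

  -- The sum modulo two of three words. For `u` between `s` and `t` it is the vector `s + t - u`,
  -- the fourth corner of a parallelogram; for pairwise disjoint words it is their union.
  sum3 : ∀ {n} → Bits n → Bits n → Bits n → Bits n
  sum3 [] [] [] = []
  sum3 (a ∷ u) (b ∷ s) (c ∷ t) = (a xor b xor c) ∷ sum3 u s t

  Between : ∀ {n} → Bits n → Bits n → Bits n → Set
  Between s u t = h s u + h u t ≡ h s t

  summands-≡ : ∀ {a b c d} → a ≤ c → b ≤ d → c + d ≡ a + b → c ≡ a × d ≡ b
  summands-≡ {a} {b} {c} {d} p q e =
    ℕₚ.≤-antisym (ℕₚ.+-cancelʳ-≤ b c a (ℕₚ.≤-trans (ℕₚ.+-monoʳ-≤ c q) (ℕₚ.≤-reflexive e))) p ,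
    ℕₚ.≤-antisym (ℕₚ.+-cancelˡ-≤ a d b (ℕₚ.≤-trans (ℕₚ.+-monoˡ-≤ d p) (ℕₚ.≤-reflexive e))) q

  -- Betweenness is equality in a triangle inequality that is summed over the coordinates, so
  -- equality holds in each of them.
  between-∷ : ∀ {n} a b c {s u t : Bits n} → Between (a ∷ s) (b ∷ u) (c ∷ t) →
              h₁ a b + h₁ b c ≡ h₁ a c × Between s u t
  between-∷ a b c {s} {u} {t} e = summands-≡ (h₁-triangle a b c) (h-triangle s u t)
    (trans (interchange (h₁ a b) (h₁ b c) (h s u) (h u t)) e)

  -- Coordinatewise, u lies between s and t when {u, s + u + t} = {s, t}.
  h-sum3 : ∀ {n} (s u t v : Bits n) → Between s u t → h (sum3 s u t) v + h u v ≡ h s v + h t v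
  h-sum3 [] [] [] [] e = refl
  h-sum3 (a ∷ s) (b ∷ u) (c ∷ t) (x ∷ v) e = trans
    (interchange (h₁ (a xor b xor c) x) (h (sum3 s u t) v) (h₁ b x) (h u v))
    (trans (cong₂ _+_ (head a b c x (proj₁ (between-∷ a b c {s} {u} {t} e))) (h-sum3 s u t v (proj₂ (between-∷ a b c {s} {u} {t} e))))
           (interchange (h₁ a x) (h₁ c x) (h s v) (h t v)))
    where
    head : ∀ a b c x → h₁ a b + h₁ b c ≡ h₁ a c → h₁ (a xor b xor c) x + h₁ b x ≡ h₁ a x + h₁ c x
    head true  true  true  x     _ = refl
    head true  true  false true  _ = refl
    head true  true  false false _ = refl
    head true  false false true  _ = refl
    head true  false false false _ = refl
    head false true  true  true  _ = refl
    head false true  true  false _ = refl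
    head false false true  true  _ = refl
    head false false true  false _ = refl
    head false false false x     _ = refl

  Step : ∀ {n} → Bits n → Bits n → Bits n → Set
  Step s r t = h s r ≡ 1 × suc (h r t) ≡ h s t

  towards : ∀ {n} (s t : Bits n) {k} → h s t ≡ suc k → Σ (Bits n) λ r → Step s r t
  towards [] [] ()
  towards (true ∷ s) (false ∷ t) e = (false ∷ s) , cong suc (h-refl s) , refl
  towards (false ∷ s) (true ∷ t) e = (true ∷ s) , cong suc (h-refl s) , refl
  towards (true ∷ s) (true ∷ t) e with towards s t e
  ... | r , p , q = (true ∷ r) , p , q
  towards (false ∷ s) (false ∷ t) e with towards s t e
  ... | r , p , q = (false ∷ r) , p , q

  -- Deletes the first element of `s` outside `t`. Since the intersection is kept, `step-up` can
  -- afterwards restore the weight with an element of `t`.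
  step-down : ∀ {n} (s t : Bits n) → ∣ s ∩ t ∣ < ∣ s ∣ →
              Σ (Bits n) λ r → Step s r t × suc ∣ r ∣ ≡ ∣ s ∣ × ∣ r ∩ t ∣ ≡ ∣ s ∩ t ∣
  step-down [] [] ()
  step-down (true ∷ s) (false ∷ t) lt = (false ∷ s) , (cong suc (h-refl s) , refl) , refl , refl
  step-down (true ∷ s) (true ∷ t) (s≤s lt) with step-down s t lt
  ... | r , (p , q) , m , i = (true ∷ r) , (p , q) , cong suc m , cong suc i
  step-down (false ∷ s) (false ∷ t) lt with step-down s t lt
  ... | r , (p , q) , m , i = (false ∷ r) , (p , q) , m , i
  step-down (false ∷ s) (true ∷ t) lt with step-down s t lt
  ... | r , (p , q) , m , i = (false ∷ r) , (p , cong suc q) , m , i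

  step-up : ∀ {n} (s t : Bits n) → ∣ s ∩ t ∣ < ∣ t ∣ →
            Σ (Bits n) λ r → Step s r t × ∣ r ∣ ≡ suc ∣ s ∣
  step-up [] [] ()
  step-up (false ∷ s) (true ∷ t) lt = (true ∷ s) , (cong suc (h-refl s) , refl) , refl
  step-up (true ∷ s) (true ∷ t) (s≤s lt) with step-up s t lt
  ... | r , (p , q) , m = (true ∷ r) , (p , q) , cong suc m
  step-up (false ∷ s) (false ∷ t) lt with step-up s t lt
  ... | r , (p , q) , m = (false ∷ r) , (p , q) , m
  step-up (true ∷ s) (false ∷ t) lt with step-up s t lt
  ... | r , (p , q) , m = (true ∷ r) , (p , cong suc q) , cong suc m

  step² : ∀ {n} {s r q t : Bits n} → Step s r t → Step r q t → h s q ≡ 2 × 2 + h q t ≡ h s t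
  step² {s = s} {r} {q} {t} (a , b) (c , d) = ℕₚ.≤-antisym
    (subst (h s q ≤_) (cong₂ _+_ a c) (h-triangle s r q))
    (ℕₚ.+-cancelʳ-≤ (h q t) 2 (h s q) (subst (_≤ h s q + h q t) (sym e) (h-triangle s q t))) , e
    where
    e : 2 + h q t ≡ h s t
    e = trans (cong suc d) b

-- Half Hamming distance: Johnson graphs and halved cubes

module Codes where
  open ReflectionSpaces
  open Hamming
  open GraphsOfSpaces
  open import Data.Nat using (ℕ; zero; suc; _+_; _≤_; _<_; s≤s; ⌊_/2⌋; _%_)
  open import Data.Nat.Tactic.RingSolver using (solve-∀)
  open import Data.Integer using (+_; 1ℤ) renaming (_+_ to _+ℤ_; _-_ to _-ℤ_; _*_ to _*ℤ_)
  import Data.Integer.Tactic.RingSolver as ℤ-Solver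

  ⌊double/2⌋ : ∀ {m n} → m ≡ n + n → ⌊ m /2⌋ ≡ n
  ⌊double/2⌋ {n = n} refl = sym (ℕₚ.n≡⌊n+n/2⌋ n)

  even-half : ∀ {n} → 2 ∣ n → n ≡ ⌊ n /2⌋ + ⌊ n /2⌋
  even-half {n} (divides q e) = trans e′ (cong₂ _+_ (sym (⌊double/2⌋ {n = q} e′)) (sym (⌊double/2⌋ {n = q} e′)))
    where
    e′ : n ≡ q + q
    e′ = trans e (trans (ℕₚ.*-comm q 2) (cong (λ t → q + t) (ℕₚ.+-identityʳ q)))

  2∣double : ∀ n → 2 ∣ n + n
  2∣double n = divides n (trans (sym (cong (λ t → n + t) (ℕₚ.+-identityʳ n))) (ℕₚ.*-comm 2 n))

  halve-sums : ∀ a b c d → (a + a) + (b + b) ≡ (c + c) + (d + d) → a + b ≡ c + d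
  halve-sums a b c d e = trans (ℕₚ.n≡⌊n+n/2⌋ (a + b)) (⌊double/2⌋ {n = c + d}
    (trans (interchange a b a b) (trans e (interchange c c d d))))

  -- Brings the identity for a fourth corner into the form of `ρ-d`; the first factor, `b - a`, is
  -- 1.
  shift : ∀ {w u x y x′ y′ a b} → w + x ≡ u + y → b ≡ suc a → x ≡ x′ → y ≡ y′ →
          + w ≡ + u +ℤ (+ b -ℤ + a) *ℤ (+ y′ -ℤ + x′)
  shift {w} {u} {x} {y} {a = a} e refl refl refl = begin
    + w                                            ≡⟨ lemma (+ w) (+ x) ⟩
    (+ w +ℤ + x) -ℤ + x                            ≡⟨ cong (λ m → + m -ℤ + x) e ⟩
    (+ u +ℤ + y) -ℤ + x                            ≡⟨ lemma′ (+ u) (+ y) (+ x) (+ a) ⟩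
    + u +ℤ (+ suc a -ℤ + a) *ℤ (+ y -ℤ + x)        ∎
    where
    open ≡-Reasoning
    lemma : ∀ w x → w ≡ (w +ℤ x) -ℤ x
    lemma = ℤ-Solver.solve-∀
    lemma′ : ∀ u y x a → (u +ℤ y) -ℤ x ≡ u +ℤ ((1ℤ +ℤ a) -ℤ a) *ℤ (y -ℤ x)
    lemma′ = ℤ-Solver.solve-∀

  shift′ : ∀ {w u x y x′ y′ a b} → w + y ≡ u + x → b ≡ suc a → x ≡ x′ → y ≡ y′ →
           + w ≡ + u +ℤ (+ a -ℤ + b) *ℤ (+ y′ -ℤ + x′)
  shift′ {u = u} {x′ = x} {y′ = y} {a = a} {b} e p q r = trans (shift e p r q) (lemma (+ u) (+ b) (+ a) (+ x) (+ y))
    where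
    lemma : ∀ u b a x y → u +ℤ (b -ℤ a) *ℤ (x -ℤ y) ≡ u +ℤ (a -ℤ b) *ℤ (y -ℤ x)
    lemma = ℤ-Solver.solve-∀

  -- What half the Hamming distance needs to form a reflection space: `sum3-closed` supplies the
  -- reflected points and `step-closed` the geodesics.
  record Code (n : ℕ) : Set₁ where
    field
      Word        : Bits n → Set
      irrelevant  : ∀ {s} (p q : Word s) → p ≡ q
      even        : ∀ {s t} → Word s → Word t → 2 ∣ h s t
      sum3-closed : ∀ {s u t} → Word s → Word u → Word t → Between s u t → Word (sum3 s u t)
      step-closed : ∀ {s t k} → Word s → Word t → h s t ≡ suc k →
                    Σ (Bits n) λ r → Word r × h s r ≡ 2 × 2 + h r t ≡ h s t

    Point : Set
    Point = Σ (Bits n) Word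

    point-≡ : ∀ {x y : Point} → proj₁ x ≡ proj₁ y → x ≡ y
    point-≡ {s , p} {s , q} refl = cong (s ,_) (irrelevant p q)

    half : Point → Point → ℕ
    half (s , _) (t , _) = ⌊ h s t /2⌋

    h-half : ∀ x y → h (proj₁ x) (proj₁ y) ≡ half x y + half x y
    h-half (s , p) (t , q) = even-half (even p q)

    half-sym : ∀ x y → half x y ≡ half y x
    half-sym (s , _) (t , _) = cong ⌊_/2⌋ (h-sym s t)

    half-refl : ∀ x → half x x ≡ 0
    half-refl (s , _) = cong ⌊_/2⌋ (h-refl s)

    half-triangle : ∀ x y z → half x z ≤ half x y + half y z
    half-triangle x y z = subst (half x z ≤_) (sym (ℕₚ.n≡⌊n+n/2⌋ (half x y + half y z)))
      (ℕₚ.⌊n/2⌋-mono (subst (h (proj₁ x) (proj₁ z) ≤_)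
        (trans (cong₂ _+_ (h-half x y) (h-half y z)) (sym (interchange (half x y) (half y z) (half x y) (half y z))))
        (h-triangle (proj₁ x) (proj₁ y) (proj₁ z))))

    between : ∀ {x y z} → half x y + half y z ≡ half x z → Between (proj₁ x) (proj₁ y) (proj₁ z)
    between {x} {y} {z} e = begin
      h (proj₁ x) (proj₁ y) + h (proj₁ y) (proj₁ z)          ≡⟨ cong₂ _+_ (h-half x y) (h-half y z) ⟩
      (half x y + half x y) + (half y z + half y z)          ≡⟨ interchange (half x y) (half x y) (half y z) (half y z) ⟩
      (half x y + half y z) + (half x y + half y z)          ≡⟨ cong₂ _+_ e e ⟩
      half x z + half x z                                    ≡⟨ sym (h-half x z) ⟩
      h (proj₁ x) (proj₁ z)                                  ∎
      where open ≡-Reasoning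

    third : ∀ x y z → half x y + half y z ≡ half x z → Σ Point λ w →
            ∀ v → half w v + half y v ≡ half x v + half z v
    third x y z e = w , λ v → halve-sums (half w v) (half y v) (half x v) (half z v) (trans
      (cong₂ _+_ (sym (h-half w v)) (sym (h-half y v)))
      (trans (h-sum3 (proj₁ x) (proj₁ y) (proj₁ z) (proj₁ v) (between {x} {y} {z} e))
        (cong₂ _+_ (h-half x v) (h-half z v))))
      where
      w : Point
      w = sum3 (proj₁ x) (proj₁ y) (proj₁ z) , sum3-closed (proj₂ x) (proj₂ y) (proj₂ z) (between {x} {y} {z} e)

    module _ {x y : Point} (e : half x y ≡ 1) where
      half-lip : ∀ z → half x z ≤ suc (half y z)
      half-lip z = subst (λ m → half x z ≤ m + half y z) e (half-triangle x y z)

      lip′ : ∀ z → half z y ≤ suc (half z x)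
      lip′ z = subst (half z y ≤_) (trans (cong (λ m → half z x + m) e) (ℕₚ.+-comm _ 1)) (half-triangle z x y)

      lip″ : ∀ z → half z x ≤ suc (half z y)
      lip″ z = subst (half z x ≤_) (trans (cong (λ m → half z y + m) (trans (half-sym y x) e)) (ℕₚ.+-comm _ 1)) (half-triangle z y x)

      Image : Point → Set
      Image u = Σ Point λ w → ∀ v → + half w v ≡ + half u v +ℤ gap half x y u *ℤ gap half x y v

      -- If `u` is nearer to `x`, then `x` lies between `u` and `y`, and the image is the fourth
      -- corner `u + y - x`; the other side is symmetric, and equidistant points are fixed.
      image : ∀ u → Image u
      image u with ℕₚ.<-cmp (half u x) (half u y)
      ... | tri≈ _ eq _ = u , λ v → sym (trans
        (cong (λ m → + half u v +ℤ m *ℤ gap half x y v) (trans (cong (λ m → + half u y -ℤ + m) eq) (ℤₚ.+-inverseʳ (+ half u y))))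
        (ℤₚ.+-identityʳ (+ half u v)))
      ... | tri< lt _ _ = proj₁ w , λ v → shift (proj₂ w v) uy (half-sym x v) (half-sym y v)
        where
        uy : half u y ≡ suc (half u x)
        uy = ℕₚ.≤-antisym (lip′ u) lt
        w = third u x y (trans (cong (λ m → half u x + m) e) (trans (ℕₚ.+-comm _ 1) (sym uy)))
      ... | tri> _ _ gt = proj₁ w , λ v → shift′ (proj₂ w v) ux (half-sym x v) (half-sym y v)
        where
        ux : half u x ≡ suc (half u y)
        ux = ℕₚ.≤-antisym (lip″ u) gt
        w = third u y x (trans (cong (λ m → half u y + m) (trans (half-sym y x) e)) (trans (ℕₚ.+-comm _ 1) (sym ux)))

    space : ReflSpace
    space = record
      { Pt       = Point
      ; d        = half
      ; d-refl   = half-refl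
      ; d-zero   = λ {x} {y} e → point-≡ (h-zero (trans (h-half x y) (cong₂ _+_ e e)))
      ; d-sym    = half-sym
      ; d-lip    = λ {x} {y} → half-lip {x} {y}
      ; geodesic = λ {x} {z} e → geodesic′ x z e
      ; ρ        = λ {x} {y} e u → proj₁ (image {x} {y} e u)
      ; ρ-d      = λ {x} {y} e u → proj₂ (image {x} {y} e u)
      }
      where
      geodesic′ : ∀ x z {k} → half x z ≡ suc k → Σ Point λ y → half x y ≡ 1 × half y z ≡ k
      geodesic′ x z {k} e with step-closed (proj₂ x) (proj₂ z) (trans (h-half x z) (cong₂ _+_ e e))
      ... | r , p , a , b = (r , p) , cong ⌊_/2⌋ a , ℕₚ.suc-injective (trans (cong ⌊_/2⌋ b) e)

  module _ (n k : ℕ) where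
    johnsonCode : Code n
    johnsonCode = record
      { Word        = λ s → ∣ s ∣ ≡ k
      ; irrelevant  = ℕₚ.≡-irrelevant
      ; even        = λ {s} {t} p q → ∣m+n∣m⇒∣n (subst (2 ∣_)
          (trans (sym (cong₂ _+_ p q)) (trans (sym (h-∩ s t)) (ℕₚ.+-comm (h s t) _))) (2∣double k)) (2∣double ∣ s ∩ t ∣)
      -- The distance to the empty word is the weight, so `h-sum3` at `∅ n` computes the weight of
      -- the fourth corner.
      ; sum3-closed = λ {s} {u} {t} p q r b → ℕₚ.+-cancelʳ-≡ k ∣ sum3 s u t ∣ k (begin
          ∣ sum3 s u t ∣ + k                     ≡⟨ cong₂ _+_ (h-∅ (sum3 s u t)) (trans (h-∅ u) q) ⟨
          h (sum3 s u t) (∅ n) + h u (∅ n)       ≡⟨ h-sum3 s u t (∅ n) b ⟩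
          h s (∅ n) + h t (∅ n)                  ≡⟨ cong₂ _+_ (trans (h-∅ s) p) (trans (h-∅ t) r) ⟩
          k + k                                  ∎)
      ; step-closed = λ {s} {t} → stp {s} {t}
      }
      where
      open ≡-Reasoning
      meet< : ∀ {s t m} → ∣ s ∣ ≡ k → ∣ t ∣ ≡ k → h s t ≡ suc m → ∣ s ∩ t ∣ < k
      meet< {s} {t} {m} p q e = ℕₚ.≰⇒> λ k≤i → ℕₚ.<⇒≱
        (subst (∣ s ∩ t ∣ + ∣ s ∩ t ∣ <_) (trans (cong (λ j → j + (∣ s ∩ t ∣ + ∣ s ∩ t ∣)) (sym e))
          (trans (h-∩ s t) (cong₂ _+_ p q))) (s≤s (ℕₚ.m≤n+m _ m)))
        (ℕₚ.+-mono-≤ k≤i k≤i)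
      stp : ∀ {s t m} → ∣ s ∣ ≡ k → ∣ t ∣ ≡ k → h s t ≡ suc m →
            Σ (Bits n) λ r → ∣ r ∣ ≡ k × h s r ≡ 2 × 2 + h r t ≡ h s t
      stp {s} {t} {m} p q e with step-down s t (subst (∣ s ∩ t ∣ <_) (sym p) (meet< {s} {t} p q e))
      ... | r , a , c , i with step-up r t (subst₂ _<_ (sym i) (sym q) (meet< {s} {t} p q e))
      ...   | r′ , a′ , c′ = r′ , trans c′ (trans c p) , step² {s = s} {r} {r′} {t} a a′

    johnson : ReflSpace
    johnson = Code.space johnsonCode

    johnson≅ : graph johnson ≅ Johnson n k
    johnson≅ = iso {graph johnson} {Johnson n k} (λ s → s) (λ s → s) (λ _ → refl) (λ _ → refl)
      (λ {s} {t} e → trans (ℕₚ.+-comm ∣ proj₁ s ∩ proj₁ t ∣ 1) (trans (cong (λ m → m + ∣ proj₁ s ∩ proj₁ t ∣) (sym e)) (half-meet s t)))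
      (λ {s} {t} e → ℕₚ.+-cancelʳ-≡ ∣ proj₁ s ∩ proj₁ t ∣ (half s t) 1 (trans (half-meet s t) (trans (sym e) (ℕₚ.+-comm _ 1))))
      where
      open Code johnsonCode
      half-meet : ∀ s t → half s t + ∣ proj₁ s ∩ proj₁ t ∣ ≡ k
      half-meet s t = trans (halve-sums (half s t) ∣ proj₁ s ∩ proj₁ t ∣ k 0 (trans (cong₂ _+_ (sym (h-half s t)) refl)
        (trans (h-∩ (proj₁ s) (proj₁ t)) (trans (cong₂ _+_ (proj₂ s) (proj₂ t)) (sym (ℕₚ.+-identityʳ (k + k)))))))
        (ℕₚ.+-identityʳ k)

  module _ (n : ℕ) where
    halvedCubeCode : Code n
    halvedCubeCode = record
      { Word        = λ s → ∣ s ∣ % 2 ≡ 0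
      ; irrelevant  = ℕₚ.≡-irrelevant
      ; even        = λ {s} {t} → ev {s} {t}
      ; sum3-closed = λ {s} {u} {t} p q r b → n∣m⇒m%n≡0 ∣ sum3 s u t ∣ 2 (∣m+n∣m⇒∣n
          (subst (2 ∣_) (trans (sym (cong₂ _+_ (h-∅ s) (h-∅ t))) (trans (sym (h-sum3 s u t (∅ n) b))
            (trans (ℕₚ.+-comm (h (sum3 s u t) (∅ n)) _) (cong₂ _+_ (h-∅ u) (h-∅ (sum3 s u t))))))
            (∣m∣n⇒∣m+n (wt s p) (wt t r)))
          (wt u q))
      ; step-closed = λ {s} {t} → stp {s} {t}
      }
      where
      wt : ∀ (s : Bits n) → ∣ s ∣ % 2 ≡ 0 → 2 ∣ ∣ s ∣
      wt s = m%n≡0⇒n∣m ∣ s ∣ 2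
      parity : ∀ s t → ∣ s ∣ % 2 ≡ 0 → 2 ∣ h s t → 2 ∣ ∣ t ∣
      parity s t p e = ∣m+n∣m⇒∣n (subst (2 ∣_) (h-∩ s t) (∣m∣n⇒∣m+n e (2∣double ∣ s ∩ t ∣))) (wt s p)
      ev : ∀ {s t} → ∣ s ∣ % 2 ≡ 0 → ∣ t ∣ % 2 ≡ 0 → 2 ∣ h s t
      ev {s} {t} p q = ∣m+n∣m⇒∣n (subst (2 ∣_) (trans (sym (h-∩ s t)) (ℕₚ.+-comm (h s t) _))
        (∣m∣n⇒∣m+n (wt s p) (wt t q))) (2∣double ∣ s ∩ t ∣)
      stp : ∀ {s t m} → ∣ s ∣ % 2 ≡ 0 → ∣ t ∣ % 2 ≡ 0 → h s t ≡ suc m →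
            Σ (Bits n) λ r → ∣ r ∣ % 2 ≡ 0 × h s r ≡ 2 × 2 + h r t ≡ h s t
      stp {s} {t} {zero} p q e = contradiction (subst (2 ∣_) e (ev {s} {t} p q)) λ { (divides zero ()) ; (divides (suc _) ()) }
      stp {s} {t} {suc m} p q e with towards s t e
      ... | r , a , b with towards r t (ℕₚ.suc-injective (trans b e))
      ...   | r′ , c with step² {s = s} {r} {r′} {t} (a , b) c
      ...     | f , g = r′ , n∣m⇒m%n≡0 ∣ r′ ∣ 2 (parity s r′ p (subst (2 ∣_) (sym f) ∣-refl)) , f , g

    halvedCube : ReflSpace
    halvedCube = Code.space halvedCubeCode

    halvedCube≅ : graph halvedCube ≅ HalvedCube n
    halvedCube≅ = iso {graph halvedCube} {HalvedCube n} (λ s → s) (λ s → s) (λ _ → refl) (λ _ → refl)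
      (λ {s} {t} e → trans (symmetric-difference (proj₁ s) (proj₁ t)) (trans (h-half s t) (cong₂ _+_ e e)))
      (λ {s} {t} e → cong ⌊_/2⌋ (trans (sym (symmetric-difference (proj₁ s) (proj₁ t))) e))
      where
      open Code halvedCubeCode
      symmetric-difference : ∀ {n} (s t : Bits n) → ∣ (s ─ t) ∪ (t ─ s) ∣ ≡ h s t
      symmetric-difference [] [] = refl
      symmetric-difference (true ∷ s) (true ∷ t) = symmetric-difference s t
      symmetric-difference (true ∷ s) (false ∷ t) = cong suc (symmetric-difference s t)
      symmetric-difference (false ∷ s) (true ∷ t) = cong suc (symmetric-difference s t)
      symmetric-difference (false ∷ s) (false ∷ t) = symmetric-difference s t

-- Cocktail party graphs

module CocktailParties where
  open ReflectionSpaces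
  open GraphsOfSpaces
  open import Data.Nat using (ℕ; zero; suc; _≤_; z≤n; s≤s)
  open import Data.Integer using (+_; -_; _+_; _-_; _*_; 1ℤ)

  all-Bool? : ∀ {P : Bool → Set} → (∀ b → Dec (P b)) → Dec (∀ b → P b)
  all-Bool? P? = map′ (λ { (t , f) true → t ; (t , f) false → f }) (λ p → p true , p false)
                   (P? true ×-dec P? false)

  -- `other` excludes `n = 1`, where the two antipodes have no common neighbour and the distance 2
  -- is not realised by a path.
  module CP (n : ℕ) (other : ∀ (i : Fin n) → Σ (Fin n) λ j → i ≢ j) where
    Point : Set
    Point = Fin n × Bool

    pair : Bool → Bool → ℕ
    pair b c = if b xor c then 2 else 0

    dist : Point → Point → ℕ
    dist (i , b) (j , c) with i Finₚ.≟ j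
    ... | yes _ = pair b c
    ... | no  _ = 1

    dist-= : ∀ i b c → dist (i , b) (i , c) ≡ pair b c
    dist-= i b c with i Finₚ.≟ i
    ... | yes _ = refl
    ... | no i≢i = contradiction refl i≢i

    dist-≢ : ∀ {i j} b c → i ≢ j → dist (i , b) (j , c) ≡ 1
    dist-≢ {i} {j} b c i≢j with i Finₚ.≟ j
    ... | yes i≡j = contradiction i≡j i≢j
    ... | no  _   = refl

    pair-sym : ∀ b c → pair b c ≡ pair c b
    pair-sym true true = refl
    pair-sym true false = refl
    pair-sym false true = refl
    pair-sym false false = refl

    pair-≡ : ∀ b c → pair b c ≡ 0 → b ≡ c
    pair-≡ true true _ = refl
    pair-≡ false false _ = refl

    dist-refl : ∀ x → dist x x ≡ 0
    dist-refl (i , true)  = dist-= i true true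
    dist-refl (i , false) = dist-= i false false

    dist-zero : ∀ {x y} → dist x y ≡ 0 → x ≡ y
    dist-zero {i , b} {j , c} e with i Finₚ.≟ j
    ... | yes refl = cong (i ,_) (pair-≡ b c e)
    ... | no _     = contradiction e λ ()

    dist-sym : ∀ x y → dist x y ≡ dist y x
    dist-sym (i , b) (j , c) with i Finₚ.≟ j
    ... | yes refl = trans (pair-sym b c) (sym (dist-= i c b))
    ... | no i≢j   = sym (dist-≢ c b (≢-sym i≢j))

    dist-edge : ∀ {x y} → dist x y ≡ 1 → proj₁ x ≢ proj₁ y
    dist-edge {i , b} {.i , c} e refl = parity b c (trans (sym (dist-= i b c)) e)
      where
      parity : ∀ b c → pair b c ≢ 1
      parity true true ()
      parity true false ()
      parity false true ()
      parity false false ()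

    dist≤2 : ∀ x y → dist x y ≤ 2
    dist≤2 (i , b) (j , c) with i Finₚ.≟ j
    ... | no _ = s≤s z≤n
    ... | yes _ with b xor c
    ...   | true  = s≤s (s≤s z≤n)
    ...   | false = z≤n

    dist-lip : ∀ {x y} → dist x y ≡ 1 → ∀ z → dist x z ≤ suc (dist y z)
    dist-lip {x} {y} e z with dist y z in eq
    ... | zero with refl ← dist-zero {y} {z} eq = ℕₚ.≤-reflexive e
    ... | suc _ = ℕₚ.≤-trans (dist≤2 x z) (s≤s (s≤s z≤n))

    dist-geo : ∀ {x z k} → dist x z ≡ suc k → Σ Point λ y → dist x y ≡ 1 × dist y z ≡ k
    dist-geo {x} {z} {zero} e = z , e , dist-refl z
    dist-geo {i , b} {j , c} {suc zero} e with i Finₚ.≟ j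
    ... | no _ = contradiction e λ ()
    ... | yes refl with other i
    ...   | k , i≢k = (k , b) , dist-≢ b b i≢k , dist-≢ b c (≢-sym i≢k)
    dist-geo {x} {z} {suc (suc k)} e = contradiction (subst (_≤ 2) e (dist≤2 x z)) λ { (s≤s (s≤s ())) }

    module _ {i j : Fin n} {b c : Bool} (i≢j : i ≢ j) where
      -- The pairs `i` and `j` are exchanged; `e xor b xor c` sends `b` to `c`, hence antipode to
      -- antipode. The decisions are arguments so that `cases` can match on them.
      image : ∀ {k} → Dec (k ≡ i) → Dec (k ≡ j) → Bool → Point
      image     (yes _) _       e = j , e xor b xor c
      image     (no _)  (yes _) e = i , e xor b xor c
      image {k} (no _)  (no _)  e = k , e

      φ : Point → Point
      φ (k , e) = image (k Finₚ.≟ i) (k Finₚ.≟ j) e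

      formula : ∀ u v w {a p q p′ q′ m} → dist u v ≡ a → dist u (j , c) ≡ p → dist u (i , b) ≡ q →
                dist v (j , c) ≡ p′ → dist v (i , b) ≡ q′ → dist w v ≡ m →
                + m ≡ + a + (+ p - + q) * (+ p′ - + q′) →
                + dist w v ≡ + dist u v + gap dist (i , b) (j , c) u * gap dist (i , b) (j , c) v
      formula u v w refl refl refl refl refl refl e = e

      j≢i : j ≢ i
      j≢i = ≢-sym i≢j

      -- A point of neither pair is at distance 1 from both ends of the edge, so its `gap` is 0.
      -- When both points belong to the two pairs, the formula is checked over the Booleans.
      φ-formula : ∀ u v → + dist (φ u) v ≡
                  + dist u v + gap dist (i , b) (j , c) u * gap dist (i , b) (j , c) v
      φ-formula (k , e) (l , f) = cases k e l f (k Finₚ.≟ i) (k Finₚ.≟ j) (l Finₚ.≟ i) (l Finₚ.≟ j)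
        where
        cases : ∀ k e l f (ki : Dec (k ≡ i)) (kj : Dec (k ≡ j)) → Dec (l ≡ i) → Dec (l ≡ j) →
                + dist (image ki kj e) (l , f) ≡
                + dist (k , e) (l , f) + gap dist (i , b) (j , c) (k , e) * gap dist (i , b) (j , c) (l , f)
        cases k e l f (no k≢i) (no k≢j) _ _ = formula (k , e) (l , f) (k , e) refl (dist-≢ e c k≢j) (dist-≢ e b k≢i) refl refl refl
          (sym (ℤₚ.+-identityʳ _))
        cases k e l f (yes refl) _ (no l≢i) (no l≢j) = formula (i , e) (l , f) (j , e xor b xor c) (dist-≢ e f (≢-sym l≢i)) (dist-≢ e c i≢j) (dist-= i e b)
          (dist-≢ f c l≢j) (dist-≢ f b l≢i) (dist-≢ (e xor b xor c) f (≢-sym l≢j)) (cong (λ t → 1ℤ + t) (sym (ℤₚ.*-zeroʳ (1ℤ - + pair e b))))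
        cases k e l f (no _) (yes refl) (no l≢i) (no l≢j) = formula (j , e) (l , f) (i , e xor b xor c) (dist-≢ e f (≢-sym l≢j)) (dist-= j e c) (dist-≢ e b j≢i)
          (dist-≢ f c l≢j) (dist-≢ f b l≢i) (dist-≢ (e xor b xor c) f (≢-sym l≢i)) (cong (λ t → 1ℤ + t) (sym (ℤₚ.*-zeroʳ (+ pair e c - 1ℤ))))
        cases k e l f (yes refl) _ (yes refl) _ = formula (i , e) (i , f) (j , e xor b xor c) (dist-= i e f) (dist-≢ e c i≢j) (dist-= i e b)
          (dist-≢ f c i≢j) (dist-= i f b) (dist-≢ (e xor b xor c) f j≢i) (check e f b)
          where
          check : ∀ e f b → 1ℤ ≡ + pair e f + (1ℤ - + pair e b) * (1ℤ - + pair f b)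
          check = toWitness {a? = all-Bool? λ e → all-Bool? λ f → all-Bool? λ b → _ ℤₚ.≟ _} _
        cases k e l f (yes refl) _ (no _) (yes refl) = formula (i , e) (j , f) (j , e xor b xor c) (dist-≢ e f i≢j) (dist-≢ e c i≢j) (dist-= i e b)
          (dist-= j f c) (dist-≢ f b j≢i) (dist-= j (e xor b xor c) f) (check e f b c)
          where
          check : ∀ e f b c → + pair (e xor b xor c) f ≡ 1ℤ + (1ℤ - + pair e b) * (+ pair f c - 1ℤ)
          check = toWitness {a? = all-Bool? λ e → all-Bool? λ f → all-Bool? λ b → all-Bool? λ c → _ ℤₚ.≟ _} _
        cases k e l f (no _) (yes refl) (yes refl) _ = formula (j , e) (i , f) (i , e xor b xor c) (dist-≢ e f j≢i) (dist-= j e c) (dist-≢ e b j≢i)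
          (dist-≢ f c i≢j) (dist-= i f b) (dist-= i (e xor b xor c) f) (check e f b c)
          where
          check : ∀ e f b c → + pair (e xor b xor c) f ≡ 1ℤ + (+ pair e c - 1ℤ) * (1ℤ - + pair f b)
          check = toWitness {a? = all-Bool? λ e → all-Bool? λ f → all-Bool? λ b → all-Bool? λ c → _ ℤₚ.≟ _} _
        cases k e l f (no _) (yes refl) (no _) (yes refl) = formula (j , e) (j , f) (i , e xor b xor c) (dist-= j e f) (dist-= j e c) (dist-≢ e b j≢i)
          (dist-= j f c) (dist-≢ f b j≢i) (dist-≢ (e xor b xor c) f i≢j) (check e f c)
          where
          check : ∀ e f c → 1ℤ ≡ + pair e f + (+ pair e c - 1ℤ) * (+ pair f c - 1ℤ)
          check = toWitness {a? = all-Bool? λ e → all-Bool? λ f → all-Bool? λ c → _ ℤₚ.≟ _} _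

    cocktailParty : ReflSpace
    cocktailParty = record
      { Pt = Point ; d = dist ; d-refl = dist-refl ; d-zero = λ {x} {y} → dist-zero {x} {y} ; d-sym = dist-sym
      ; d-lip = λ {x} {y} → dist-lip {x} {y} ; geodesic = λ {x} {z} → dist-geo {x} {z}
      ; ρ = λ {x} {y} e → φ {b = proj₂ x} {c = proj₂ y} (dist-edge {x} {y} e)
      ; ρ-d = λ {x} {y} e → φ-formula {b = proj₂ x} {c = proj₂ y} (dist-edge {x} {y} e) }

    cocktailParty≅ : graph cocktailParty ≅ CocktailParty n
    cocktailParty≅ = iso {graph cocktailParty} {CocktailParty n} (λ s → s) (λ s → s) (λ _ → refl) (λ _ → refl)
      (λ {x} {y} → dist-edge {x} {y}) (λ {x} {y} → dist-≢ (proj₂ x) (proj₂ y))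

-- The Gosset graph as a double cover of J(8,2)

module GossetSpace where
  open ReflectionSpaces
  open Hamming
  open Codes
  open GraphsOfSpaces
  open import Data.Nat as ℕ using (ℕ; zero; suc; _≤_; _<_; z≤n; s≤s; ⌊_/2⌋)
  import Data.Nat.Tactic.RingSolver as ℕ-Solver
  open import Data.Integer using (ℤ; +_; -_; _+_; _-_; _*_; 0ℤ; 1ℤ; -1ℤ)
  open import Data.Integer.Tactic.RingSolver using (solve-∀)

  private
    at-most-one : ∀ {n} a b c (s u t : Bits n) → ∣ (a ∷ s) ∩ (b ∷ u) ∣ ≡ 0 → ∣ (b ∷ u) ∩ (c ∷ t) ∣ ≡ 0 →
                  ∣ (a ∷ s) ∩ (c ∷ t) ∣ ≡ 0 → ∣ s ∩ u ∣ ≡ 0 × ∣ u ∩ t ∣ ≡ 0 × ∣ s ∩ t ∣ ≡ 0 ×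
                  (∀ x → h₁ (a xor b xor c) x ℕ.+ (h₁ x false ℕ.+ h₁ x false) ≡ h₁ a x ℕ.+ h₁ b x ℕ.+ h₁ c x)
    at-most-one true  true  c s u t () q r
    at-most-one true  false true  s u t p q ()
    at-most-one false true  true  s u t p () r
    at-most-one true  false false s u t p q r = p , q , r , λ { true → refl ; false → refl }
    at-most-one false true  false s u t p q r = p , q , r , λ { true → refl ; false → refl }
    at-most-one false false true  s u t p q r = p , q , r , λ { true → refl ; false → refl }
    at-most-one false false false s u t p q r = p , q , r , λ { true → refl ; false → refl }

  -- Each element of `v` is missed by the three words two times more often than by their union; this
  -- accounts for twice the weight of `v` on the left.
  h-sum3-disjoint : ∀ {n} (s u t v : Bits n) → ∣ s ∩ u ∣ ≡ 0 → ∣ u ∩ t ∣ ≡ 0 → ∣ s ∩ t ∣ ≡ 0 →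
                    h (sum3 s u t) v ℕ.+ (h v (∅ n) ℕ.+ h v (∅ n)) ≡ h s v ℕ.+ h u v ℕ.+ h t v
  h-sum3-disjoint [] [] [] [] p q r = refl
  h-sum3-disjoint (a ∷ s) (b ∷ u) (c ∷ t) (x ∷ v) p q r with at-most-one a b c s u t p q r
  ... | p′ , q′ , r′ , head = trans
    (l₁ (h₁ (a xor b xor c) x) (h (sum3 s u t) v) (h₁ x false) (h v (∅ _)))
    (trans (cong₂ ℕ._+_ (head x) (h-sum3-disjoint s u t v p′ q′ r′))
      (l₂ (h₁ a x) (h₁ b x) (h₁ c x) (h s v) (h u v) (h t v)))
    where
    l₁ : ∀ a b c d → (a ℕ.+ b) ℕ.+ ((c ℕ.+ d) ℕ.+ (c ℕ.+ d)) ≡ (a ℕ.+ (c ℕ.+ c)) ℕ.+ (b ℕ.+ (d ℕ.+ d))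
    l₁ = ℕ-Solver.solve-∀
    l₂ : ∀ a b c a′ b′ c′ → (a ℕ.+ b ℕ.+ c) ℕ.+ (a′ ℕ.+ b′ ℕ.+ c′) ≡ (a ℕ.+ a′) ℕ.+ (b ℕ.+ b′) ℕ.+ (c ℕ.+ c′)
    l₂ = ℕ-Solver.solve-∀

  ∩-∁ : ∀ {n} (s t : Bits n) → ∣ s ∩ ∁ t ∣ ℕ.+ ∣ s ∩ t ∣ ≡ ∣ s ∣
  ∩-∁ [] [] = refl
  ∩-∁ (true ∷ s) (true ∷ t) = trans (ℕₚ.+-suc _ _) (cong suc (∩-∁ s t))
  ∩-∁ (true ∷ s) (false ∷ t) = cong suc (∩-∁ s t)
  ∩-∁ (false ∷ s) (b ∷ t) = ∩-∁ s t

  -- The double cover of J(8,2) in which the fibre over s is at distance 3 and distances across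
  -- the two sheets are 3 - d.
  open Code (johnsonCode 8 2)
  private module J = Space (johnson 8 2)

  meet : Point → Point → ℕ
  meet s t = ∣ proj₁ s ∩ proj₁ t ∣

  half-meet : ∀ s t → half s t ℕ.+ meet s t ≡ 2
  half-meet s t = trans (halve-sums (half s t) (meet s t) 2 0 (trans (cong₂ ℕ._+_ (sym (h-half s t)) refl)
    (trans (h-∩ (proj₁ s) (proj₁ t)) (cong₂ ℕ._+_ (proj₂ s) (proj₂ t))))) refl

  half≤2 : ∀ s t → half s t ≤ 2
  half≤2 s t = subst (half s t ≤_) (half-meet s t) (ℕₚ.m≤m+n _ _)

  Vertex : Set
  Vertex = Bool × Point

  dist : Vertex → Vertex → ℕ
  dist (b , s) (c , t) = if b xor c then suc (meet s t) else half s t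

  -- Since `half s t` and `meet s t` add up to 2, `suc (meet s t)` is 3 minus the distance in
  -- J(8,2).
  across : Bool → ℤ → ℤ
  across true  m = + 3 - m
  across false m = m

  dist-ℤ : ∀ b s c t → + dist (b , s) (c , t) ≡ across (b xor c) (+ half s t)
  dist-ℤ b s c t with b xor c
  ... | false = refl
  ... | true  = trans (lemma (+ half s t) (+ meet s t)) (cong (λ m → (1ℤ + + m) - + half s t) (half-meet s t))
    where
    lemma : ∀ h m → 1ℤ + m ≡ (1ℤ + (h + m)) - h
    lemma = solve-∀

  gap-ℤ : ∀ b s c t u v → gap dist (b , s) (c , t) (u , v) ≡ across (u xor c) (+ half v t) - across (u xor b) (+ half v s)
  gap-ℤ b s c t u v = cong₂ _-_ (dist-ℤ u v c t) (dist-ℤ u v b s)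

  Reflects : Vertex → Vertex → Vertex → Set
  Reflects x y u = Σ Vertex λ w → ∀ v → + dist w v ≡ + dist u v + gap dist x y u * gap dist x y v

  -- The reflection of J(8,2) acts on both sheets. Replacing distances by 3 minus themselves changes
  -- the sign of `gap`, as the formula across the sheets requires.
  same-sheet : ∀ b s t → half s t ≡ 1 → ∀ c u → Reflects (b , s) (b , t) (c , u)
  same-sheet b s t e c u = (c , J.r {s} {t} e u) , λ { (c′ , v) → begin
    + dist (c , J.r {s} {t} e u) (c′ , v)                       ≡⟨ dist-ℤ c (J.r {s} {t} e u) c′ v ⟩
    across (c xor c′) (+ half (J.r {s} {t} e u) v)              ≡⟨ cong (across (c xor c′)) (J.r-δ {s} {t} e u v) ⟩
    across (c xor c′) (+ half u v + (+ half u t - + half u s) * (+ half v t - + half v s))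
      ≡⟨ lemma b c c′ (+ half u v) (+ half u t) (+ half u s) (+ half v t) (+ half v s) ⟩
    across (c xor c′) (+ half u v) + (across (c xor b) (+ half u t) - across (c xor b) (+ half u s)) *
      (across (c′ xor b) (+ half v t) - across (c′ xor b) (+ half v s))
      ≡⟨ cong₂ _+_ (dist-ℤ c u c′ v) (cong₂ _*_ (gap-ℤ b s b t c u) (gap-ℤ b s b t c′ v)) ⟨
    + dist (c , u) (c′ , v) + gap dist (b , s) (b , t) (c , u) * gap dist (b , s) (b , t) (c′ , v) ∎ }
    where
    open ≡-Reasoning
    l₁ : ∀ m p q p′ q′ → m + (p - q) * (p′ - q′) ≡ m + ((+ 3 - p) - (+ 3 - q)) * ((+ 3 - p′) - (+ 3 - q′))
    l₁ = solve-∀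
    l₂ : ∀ m p q p′ q′ → + 3 - (m + (p - q) * (p′ - q′)) ≡ (+ 3 - m) + ((+ 3 - p) - (+ 3 - q)) * (p′ - q′)
    l₂ = solve-∀
    l₃ : ∀ m p q p′ q′ → + 3 - (m + (p - q) * (p′ - q′)) ≡ (+ 3 - m) + (p - q) * ((+ 3 - p′) - (+ 3 - q′))
    l₃ = solve-∀
    lemma : ∀ b c c′ m p q p′ q′ → across (c xor c′) (m + (p - q) * (p′ - q′)) ≡ across (c xor c′) m +
            (across (c xor b) p - across (c xor b) q) * (across (c′ xor b) p′ - across (c′ xor b) q′)
    lemma true  true  true  _ _ _ _ _ = refl
    lemma false false false _ _ _ _ _ = refl
    lemma true  false false = l₁
    lemma false true  true  = l₁
    lemma true  true  false = l₃
    lemma true  false true  = l₂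
    lemma false true  false = l₂
    lemma false false true  = l₃

  -- Across the sheets, put e(u) = 3 - d(u,s) - d(u,t), the gap of (b,u).  Points with e(u) = ±1
  -- move to the other sheet.
  module _ (b : Bool) (s t : Point) where
    excess : Point → ℤ
    excess u = + 3 - + half u t - + half u s

    gap-excess : ∀ c u → gap dist (b , s) (not b , t) (c , u) ≡ (if c xor b then - excess u else excess u)
    gap-excess c u = trans (gap-ℤ b s (not b) t c u) (lemma b c (+ half u t) (+ half u s))
      where
      lemma : ∀ b c p q → across (c xor not b) p - across (c xor b) q ≡ (if c xor b then - (+ 3 - p - q) else (+ 3 - p - q))
      lemma true true p q = refl
      lemma false false p q = refl
      lemma true false = l
        where
        l : ∀ p q → p - (+ 3 - q) ≡ - (+ 3 - p - q)
        l = solve-∀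
      lemma false true = l
        where
        l : ∀ p q → p - (+ 3 - q) ≡ - (+ 3 - p - q)
        l = solve-∀

    -- For an image on the other sheet, over `w`, the reflection formula becomes an identity within
    -- J(8,2), because changing the sheet replaces each distance by 3 minus it.
    swap-sheet : ∀ c u w → (∀ v → + half w v ≡ + 3 - (+ half u v + excess u * excess v)) → Reflects (b , s) (not b , t) (c , u)
    swap-sheet c u w f = (not c , w) , λ { (c′ , v) → begin
      + dist (not c , w) (c′ , v)                 ≡⟨ dist-ℤ (not c) w c′ v ⟩
      across (not c xor c′) (+ half w v)          ≡⟨ cong (across (not c xor c′)) (f v) ⟩
      across (not c xor c′) (+ 3 - (+ half u v + excess u * excess v))
        ≡⟨ lemma b c c′ (+ half u v) (excess u) (excess v) ⟩
      across (c xor c′) (+ half u v) + (if c xor b then - excess u else excess u) * (if c′ xor b then - excess v else excess v)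
        ≡⟨ cong₂ _+_ (dist-ℤ c u c′ v) (cong₂ _*_ (gap-excess c u) (gap-excess c′ v)) ⟨
      + dist (c , u) (c′ , v) + gap dist (b , s) (not b , t) (c , u) * gap dist (b , s) (not b , t) (c′ , v) ∎ }
      where
      open ≡-Reasoning
      l₁ : ∀ m p q → + 3 - (+ 3 - (m + p * q)) ≡ m + p * q
      l₁ = solve-∀
      l₂ : ∀ m p q → + 3 - (+ 3 - (m + p * q)) ≡ m + - p * - q
      l₂ = solve-∀
      l₃ : ∀ m p q → + 3 - (m + p * q) ≡ + 3 - m + p * - q
      l₃ = solve-∀
      l₄ : ∀ m p q → + 3 - (m + p * q) ≡ + 3 - m + - p * q
      l₄ = solve-∀
      lemma : ∀ b c c′ m p q → across (not c xor c′) (+ 3 - (m + p * q)) ≡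
              across (c xor c′) m + (if c xor b then - p else p) * (if c′ xor b then - q else q)
      lemma true  true  true  = l₁
      lemma false false false = l₁
      lemma true  false false = l₂
      lemma false true  true  = l₂
      lemma true  true  false = l₃
      lemma true  false true  = l₄
      lemma false true  false = l₄
      lemma false false true  = l₃

    excess-at : ∀ {u m} → half u s ℕ.+ half u t ≡ m → excess u ≡ + 3 - + m
    excess-at {u} e = trans (l (+ half u s) (+ half u t)) (cong (λ m → + 3 - + m) e)
      where
      l : ∀ p q → + 3 - q - p ≡ + 3 - (p + q)
      l = solve-∀

    fixed : ∀ c u → half u s ℕ.+ half u t ≡ 3 → Reflects (b , s) (not b , t) (c , u)
    fixed c u e = (c , u) , λ v → sym (trans
        (cong (λ m → + dist (c , u) v + m * gap dist (b , s) (not b , t) v) (trans (gap-excess c u) (vanishes (c xor b))))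
        (ℤₚ.+-identityʳ (+ dist (c , u) v)))
      where
      vanishes : ∀ x → (if x then - excess u else excess u) ≡ 0ℤ
      vanishes true  = cong -_ (excess-at {u} e)
      vanishes false = excess-at {u} e

    across-pair : ∀ c u w → half u s ℕ.+ half u t ≡ 2 →
                  (∀ v → half w v ℕ.+ half u v ≡ half s v ℕ.+ half t v) → Reflects (b , s) (not b , t) (c , u)
    across-pair c u w e f = swap-sheet c u w λ v → begin
      + half w v                                               ≡⟨ l₁ (+ half w v) (+ half u v) ⟩
      (+ half w v + + half u v) - + half u v                   ≡⟨ cong (λ m → + m - + half u v) (trans (f v) (cong₂ ℕ._+_ (half-sym s v) (half-sym t v))) ⟩
      (+ half v s + + half v t) - + half u v                   ≡⟨ l₂ (+ half v s) (+ half v t) (+ half u v) ⟩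
      + 3 - (+ half u v + 1ℤ * (+ 3 - + half v t - + half v s)) ≡⟨ cong (λ m → + 3 - (+ half u v + m * excess v)) (excess-at {u} e) ⟨
      + 3 - (+ half u v + excess u * excess v)                 ∎
      where
      open ≡-Reasoning
      l₁ : ∀ w u → w ≡ (w + u) - u
      l₁ = solve-∀
      l₂ : ∀ s t u → (s + t) - u ≡ + 3 - (u + 1ℤ * (+ 3 - t - s))
      l₂ = solve-∀

    -- Here `u` is between `s` and `t`, that is, a pair inside their union; the image lies over the
    -- complementary pair `s + t - u` of the union.
    inside : half s t ≡ 2 → ∀ c u → half u s ℕ.+ half u t ≡ 2 → Reflects (b , s) (not b , t) (c , u)
    inside st c u e = across-pair c u (proj₁ w) e (proj₂ w)
      where
      w = third s u t (trans (cong (ℕ._+ half u t) (half-sym s u)) (trans e (sym st)))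

    module _ {u : Point} (us : half u s ≡ 2) (ut : half u t ≡ 2) (st : half s t ≡ 2) where
      private
        S : Bits 8
        S = sum3 (proj₁ s) (proj₁ u) (proj₁ t)

        disjoint : ∀ x y → half x y ≡ 2 → meet x y ≡ 0
        disjoint x y e = ℕₚ.+-cancelˡ-≡ 2 (meet x y) 0 (trans (cong (ℕ._+ meet x y) (sym e)) (half-meet x y))

        h-S : ∀ v → h S v ℕ.+ (h v (∅ 8) ℕ.+ h v (∅ 8)) ≡ h (proj₁ s) v ℕ.+ h (proj₁ u) v ℕ.+ h (proj₁ t) v
        h-S v = h-sum3-disjoint (proj₁ s) (proj₁ u) (proj₁ t) v (disjoint s u (trans (half-sym s u) us)) (disjoint u t ut) (disjoint s t st)

        weight : ∀ x → h (proj₁ x) (∅ 8) ≡ 2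
        weight x = trans (h-∅ (proj₁ x)) (proj₂ x)

        S-weight : ∣ S ∣ ≡ 6
        S-weight = trans (sym (h-∅ S)) (trans (sym (ℕₚ.+-identityʳ (h S (∅ 8)))) (trans (h-S (∅ 8))
          (cong₂ ℕ._+_ (cong₂ ℕ._+_ (weight s) (weight u)) (weight t))))

      -- Three disjoint pairs cover six of the eight points, and the two points left form the image.
      remaining : Point
      remaining = ∁ S , ℕₚ.+-cancelʳ-≡ 6 ∣ ∁ S ∣ 2 (trans (cong (λ m → ∣ ∁ S ∣ ℕ.+ m) (sym S-weight)) (∁-card S))

      -- The four pairs partition the eight points, so they meet `v` in two elements altogether, and
      -- the four distances add up to 4 · 2 - 2.
      half-remaining : ∀ v → half remaining v ℕ.+ (half u v ℕ.+ half s v ℕ.+ half t v) ≡ 6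
      half-remaining v = halve-sums (half remaining v) (half u v ℕ.+ half s v ℕ.+ half t v) 6 0
        (ℕₚ.+-cancelʳ-≡ (h S (proj₁ v)) _ 12 (begin
          (half remaining v ℕ.+ half remaining v) ℕ.+ (a ℕ.+ a) ℕ.+ h S (proj₁ v)
            ≡⟨ l₁ (half remaining v ℕ.+ half remaining v) (a ℕ.+ a) (h S (proj₁ v)) ⟩
          (half remaining v ℕ.+ half remaining v ℕ.+ h S (proj₁ v)) ℕ.+ (a ℕ.+ a)
            ≡⟨ cong (λ m → m ℕ.+ h S (proj₁ v) ℕ.+ (a ℕ.+ a)) (h-half remaining v) ⟨
          (h (∁ S) (proj₁ v) ℕ.+ h S (proj₁ v)) ℕ.+ (a ℕ.+ a)
            ≡⟨ cong (ℕ._+ (a ℕ.+ a)) (h-∁ S (proj₁ v)) ⟩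
          8 ℕ.+ (a ℕ.+ a)
            ≡⟨ cong (8 ℕ.+_) (trans (l₂ (half u v) (half s v) (half t v))
                 (cong₂ ℕ._+_ (cong₂ ℕ._+_ (sym (h-half s v)) (sym (h-half u v))) (sym (h-half t v)))) ⟩
          8 ℕ.+ (h (proj₁ s) (proj₁ v) ℕ.+ h (proj₁ u) (proj₁ v) ℕ.+ h (proj₁ t) (proj₁ v))
            ≡⟨ cong (8 ℕ.+_) (trans (sym (h-S (proj₁ v))) (cong (h S (proj₁ v) ℕ.+_) (cong₂ ℕ._+_ (weight v) (weight v)))) ⟩
          8 ℕ.+ (h S (proj₁ v) ℕ.+ 4)
            ≡⟨ cong (8 ℕ.+_) (ℕₚ.+-comm (h S (proj₁ v)) 4) ⟩
          12 ℕ.+ h S (proj₁ v) ∎))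
        where
        open ≡-Reasoning
        a = half u v ℕ.+ half s v ℕ.+ half t v
        l₁ : ∀ x y z → x ℕ.+ y ℕ.+ z ≡ (x ℕ.+ z) ℕ.+ y
        l₁ = ℕ-Solver.solve-∀
        l₂ : ∀ u s t → (u ℕ.+ s ℕ.+ t) ℕ.+ (u ℕ.+ s ℕ.+ t) ≡ ((s ℕ.+ s) ℕ.+ (u ℕ.+ u)) ℕ.+ (t ℕ.+ t)
        l₂ = ℕ-Solver.solve-∀

    outside : half s t ≡ 2 → ∀ c u → half u s ℕ.+ half u t ≡ 4 → Reflects (b , s) (not b , t) (c , u)
    outside st c u e = swap-sheet c u w λ v → begin
      + half w v                                                ≡⟨ l₁ (+ half w v) (+ half u v + + half s v + + half t v) ⟩
      (+ half w v + (+ half u v + + half s v + + half t v)) - (+ half u v + + half s v + + half t v)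
        ≡⟨ cong (λ m → + m - (+ half u v + + half s v + + half t v)) (half-remaining {u} us ut st v) ⟩
      + 6 - (+ half u v + + half s v + + half t v)              ≡⟨ l₂ (+ half u v) (+ half s v) (+ half t v) ⟩
      + 3 - (+ half u v + -1ℤ * (+ 3 - + half t v - + half s v))
        ≡⟨ cong₂ (λ m n → + 3 - (+ half u v + m * n)) (sym (excess-at {u} e))
             (cong₂ (λ m n → + 3 - + m - + n) (half-sym t v) (half-sym s v)) ⟩
      + 3 - (+ half u v + excess u * excess v)                  ∎
      where
      open ≡-Reasoning
      two-two : 2 ≡ half u s × 2 ≡ half u t
      two-two = summands-≡ (half≤2 u s) (half≤2 u t) (sym e)
      us = sym (proj₁ two-two)
      ut = sym (proj₂ two-two)
      w : Point
      w = remaining {u} us ut st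
      l₁ : ∀ w x → w ≡ (w + x) - x
      l₁ = solve-∀
      l₂ : ∀ u s t → + 6 - (u + s + t) ≡ + 3 - (u + -1ℤ * (+ 3 - t - s))
      l₂ = solve-∀

    -- The sum of the distances from `u` to `s` and `t` is 4 minus the number of elements of `u` in
    -- the union of the disjoint pairs `s` and `t`, hence 2, 3 or 4.
    other-sheet : half s t ≡ 2 → ∀ c u → Reflects (b , s) (not b , t) (c , u)
    other-sheet st c u = cases (half u s ℕ.+ half u t) refl
      (subst₂ _≤_ st (cong (ℕ._+ half u t) (half-sym s u)) (half-triangle s u t))
      (ℕₚ.+-mono-≤ (half≤2 u s) (half≤2 u t))
      where
      cases : ∀ m → half u s ℕ.+ half u t ≡ m → 2 ≤ half u s ℕ.+ half u t → half u s ℕ.+ half u t ≤ 4 →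
              Reflects (b , s) (not b , t) (c , u)
      cases 0 e lo hi = contradiction (subst (2 ≤_) e lo) λ ()
      cases 1 e lo hi = contradiction (subst (2 ≤_) e lo) λ { (s≤s ()) }
      cases 2 e lo hi = inside st c u e
      cases 3 e lo hi = fixed c u e
      cases 4 e lo hi = outside st c u e
      cases (suc (suc (suc (suc (suc _))))) e lo hi = contradiction (subst (_≤ 4) e hi) λ { (s≤s (s≤s (s≤s (s≤s ())))) }

  data Edge : Vertex → Vertex → Set where
    along  : ∀ {b s t} → half s t ≡ 1 → Edge (b , s) (b , t)
    crossing : ∀ {b s t} → half s t ≡ 2 → Edge (b , s) (not b , t)

  half-of-meet : ∀ {s t m} → suc (meet s t) ≡ suc m → half s t ℕ.+ m ≡ 2
  half-of-meet {s} {t} refl = half-meet s t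

  edge : ∀ x y → dist x y ≡ 1 → Edge x y
  edge (true  , s) (true  , t) e = along e
  edge (false , s) (false , t) e = along e
  edge (true  , s) (false , t) e = crossing (trans (sym (ℕₚ.+-identityʳ (half s t))) (half-of-meet {s} {t} e))
  edge (false , s) (true  , t) e = crossing (trans (sym (ℕₚ.+-identityʳ (half s t))) (half-of-meet {s} {t} e))

  reflects : ∀ {x y} → Edge x y → ∀ u → Reflects x y u
  reflects (along {b} {s} {t} e)  (c , u) = same-sheet b s t e c u
  reflects (crossing {b} {s} {t} e) (c , u) = other-sheet b s t e c u

  meet-suc : ∀ s t u → half s t ≡ 1 → meet s u ≤ suc (meet t u)
  meet-suc s t u e = ℕₚ.+-cancelˡ-≤ (half s u) _ _ (ℕₚ.≤-trans (ℕₚ.≤-reflexive (trans (half-meet s u) (sym (half-meet t u))))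
    (ℕₚ.≤-trans (ℕₚ.+-monoˡ-≤ (meet t u) (half-lip {t} {s} (trans (half-sym t s) e) u))
      (ℕₚ.≤-reflexive (sym (ℕₚ.+-suc (half s u) (meet t u))))))

  meet≤half : ∀ s t u → half s t ≡ 2 → meet s u ≤ half t u
  meet≤half s t u e = ℕₚ.+-cancelˡ-≤ (half s u) _ _ (subst₂ _≤_ (trans e (sym (half-meet s u)))
    (cong (half s u ℕ.+_) (half-sym u t)) (half-triangle s u t))

  edge-lip : ∀ {x y} → Edge x y → ∀ z → dist x z ≤ suc (dist y z)
  edge-lip (along {true}  {s} {t} e) (true  , u) = half-lip {s} {t} e u
  edge-lip (along {false} {s} {t} e) (false , u) = half-lip {s} {t} e u
  edge-lip (along {true}  {s} {t} e) (false , u) = s≤s (meet-suc s t u e)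
  edge-lip (along {false} {s} {t} e) (true  , u) = s≤s (meet-suc s t u e)
  edge-lip (crossing {true}  {s} {t} e) (true  , u) = ℕₚ.≤-trans (half≤2 s u) (s≤s (s≤s z≤n))
  edge-lip (crossing {false} {s} {t} e) (false , u) = ℕₚ.≤-trans (half≤2 s u) (s≤s (s≤s z≤n))
  edge-lip (crossing {true}  {s} {t} e) (false , u) = s≤s (meet≤half s t u e)
  edge-lip (crossing {false} {s} {t} e) (true  , u) = s≤s (meet≤half s t u e)

  -- The neighbour r of s lies on a shortest path towards the complement of t.
  recede : ∀ s t {k} → meet s t ≡ suc k → Σ Point λ r → half s r ≡ 1 × meet r t ≡ k
  recede (s , p) (t , q) {k} e = w , cong ⌊_/2⌋ (proj₁ moved) , ℕₚ.+-cancelˡ-≡ (half w (t , q)) (meet w (t , q)) k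
      (trans (half-meet w (t , q)) (trans (sym (half-meet (s , p) (t , q))) (trans (cong (half (s , p) (t , q) ℕ.+_) e)
        (trans (ℕₚ.+-suc _ k) (cong (ℕ._+ k) (sym (cong ⌊_/2⌋ further)))))))
    where
    open ≡-Reasoning
    ∁-t : ∣ ∁ t ∣ ≡ 6
    ∁-t = ℕₚ.+-cancelʳ-≡ 2 ∣ ∁ t ∣ 6 (trans (cong (∣ ∁ t ∣ ℕ.+_) (sym q)) (∁-card t))
    down : Σ (Bits 8) λ r → Step s r (∁ t) × suc ∣ r ∣ ≡ ∣ s ∣ × ∣ r ∩ ∁ t ∣ ≡ ∣ s ∩ ∁ t ∣
    down = step-down s (∁ t) (subst (∣ s ∩ ∁ t ∣ <_)
      (trans (cong (∣ s ∩ ∁ t ∣ ℕ.+_) (sym e)) (∩-∁ s t)) (ℕₚ.m<m+n _ (s≤s z≤n)))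
    r : Bits 8
    r = proj₁ down
    r-weight : ∣ r ∣ ≡ 1
    r-weight = ℕₚ.suc-injective (trans (proj₁ (proj₂ (proj₂ down))) p)
    up : Σ (Bits 8) λ r′ → Step r r′ (∁ t) × ∣ r′ ∣ ≡ suc ∣ r ∣
    up = step-up r (∁ t) (subst (∣ r ∩ ∁ t ∣ <_) (sym ∁-t)
      (ℕₚ.≤-trans (s≤s (subst (∣ r ∩ ∁ t ∣ ≤_) (trans (∩-∁ r t) r-weight) (ℕₚ.m≤m+n _ _))) (s≤s (s≤s z≤n))))
    r′ : Bits 8
    r′ = proj₁ up
    w : Point
    w = r′ , trans (proj₂ (proj₂ up)) (cong suc r-weight)
    moved : h s r′ ≡ 2 × 2 ℕ.+ h r′ (∁ t) ≡ h s (∁ t)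
    moved = step² {s = s} {r} {r′} {∁ t} (proj₁ (proj₂ down)) (proj₁ (proj₂ up))
    complementary : ∀ x → h x (∁ t) ℕ.+ h x t ≡ 8
    complementary x = trans (cong₂ ℕ._+_ (h-sym x (∁ t)) (h-sym x t)) (h-∁ t x)
    -- Distances to `t` and to `∁ t` add up to 8, so approaching `∁ t` by two means receding from
    -- `t` by two.
    further : h r′ t ≡ 2 ℕ.+ h s t
    further = ℕₚ.+-cancelˡ-≡ (h r′ (∁ t)) _ _ (begin
      h r′ (∁ t) ℕ.+ h r′ t               ≡⟨ trans (complementary r′) (sym (complementary s)) ⟩
      h s (∁ t) ℕ.+ h s t                 ≡⟨ cong (ℕ._+ h s t) (proj₂ moved) ⟨
      2 ℕ.+ h r′ (∁ t) ℕ.+ h s t          ≡⟨ l (h r′ (∁ t)) (h s t) ⟩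
      h r′ (∁ t) ℕ.+ (2 ℕ.+ h s t)        ∎)
      where
      l : ∀ a b → 2 ℕ.+ a ℕ.+ b ≡ a ℕ.+ (2 ℕ.+ b)
      l = ℕ-Solver.solve-∀

  dist-same : ∀ b s t → dist (b , s) (b , t) ≡ half s t
  dist-same true  s t = refl
  dist-same false s t = refl

  dist-refl : ∀ x → dist x x ≡ 0
  dist-refl (b , s) = trans (dist-same b s s) (half-refl s)

  meet-sym : ∀ s t → meet s t ≡ meet t s
  meet-sym s t = ℕₚ.+-cancelˡ-≡ (half s t) _ _ (trans (half-meet s t) (trans (sym (half-meet t s)) (cong (ℕ._+ meet t s) (half-sym t s))))

  gossetGeodesic : ∀ x z {k} → dist x z ≡ suc k → Σ Vertex λ y → dist x y ≡ 1 × dist y z ≡ k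
  gossetGeodesic (true , s) (true , t) e = (true , proj₁ r) , proj₂ r
    where r = J.geo {s} {t} e
  gossetGeodesic (false , s) (false , t) e = (false , proj₁ r) , proj₂ r
    where r = J.geo {s} {t} e
  gossetGeodesic (true , s) (false , t) {zero}  e = (false , t) , e , dist-refl (false , t)
  gossetGeodesic (false , s) (true , t) {zero}  e = (true , t) , e , dist-refl (true , t)
  gossetGeodesic (true , s) (false , t) {suc k} e = (true , proj₁ r) , proj₁ (proj₂ r) , cong suc (proj₂ (proj₂ r))
    where r = recede s t (ℕₚ.suc-injective e)
  gossetGeodesic (false , s) (true , t) {suc k} e = (false , proj₁ r) , proj₁ (proj₂ r) , cong suc (proj₂ (proj₂ r))
    where r = recede s t (ℕₚ.suc-injective e)

  gosset : ReflSpace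
  gosset = record
    { Pt       = Vertex
    ; d        = dist
    ; d-refl   = dist-refl
    ; d-zero   = λ { {true , s} {true , t} e → cong (true ,_) (J.δ-zero {s} {t} e)
                   ; {false , s} {false , t} e → cong (false ,_) (J.δ-zero {s} {t} e)
                   ; {true , s} {false , t} () ; {false , s} {true , t} () }
    ; d-sym    = λ { (true , s) (true , t) → half-sym s t ; (false , s) (false , t) → half-sym s t
                   ; (true , s) (false , t) → cong suc (meet-sym s t) ; (false , s) (true , t) → cong suc (meet-sym s t) }
    ; d-lip    = λ {x} {y} e → edge-lip (edge x y e)
    ; geodesic = λ {x} {z} → gossetGeodesic x z
    ; ρ        = λ {x} {y} e u → proj₁ (reflects (edge x y e) u)
    ; ρ-d      = λ {x} {y} e u → proj₂ (reflects (edge x y e) u)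
    }

  gosset≅ : graph gosset ≅ Gosset
  gosset≅ = iso {graph gosset} {Gosset} (λ x → x) (λ x → x) (λ _ → refl) (λ _ → refl)
    (λ {x} {y} → to x y) (λ {x} {y} → from x y)
    where
    meet-1 : ∀ s t → half s t ≡ 1 → meet s t ≡ 1
    meet-1 s t e = ℕₚ.+-cancelˡ-≡ 1 (meet s t) 1 (trans (cong (ℕ._+ meet s t) (sym e)) (half-meet s t))
    half-1 : ∀ s t → meet s t ≡ 1 → half s t ≡ 1
    half-1 s t e = ℕₚ.+-cancelʳ-≡ 1 (half s t) 1 (trans (cong (half s t ℕ.+_) (sym e)) (half-meet s t))
    to : ∀ x y → dist x y ≡ 1 → adj Gosset x y
    to (true , s) (true , t) = meet-1 s t
    to (false , s) (false , t) = meet-1 s t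
    to (true , s) (false , t) = ℕₚ.suc-injective
    to (false , s) (true , t) = ℕₚ.suc-injective
    from : ∀ x y → adj Gosset x y → dist x y ≡ 1
    from (true , s) (true , t) = half-1 s t
    from (false , s) (false , t) = half-1 s t
    from (true , s) (false , t) = cong suc
    from (false , s) (true , t) = cong suc

-- Recognising a space by its local space

module LocalGraphs where
  open ReflectionSpaces
  open Subspaces
  open Hamming
  open Codes
  open CocktailParties
  open GossetSpace using (gosset; Vertex)
  open import Data.Nat using (ℕ; zero; suc; _+_; _≤_; ⌊_/2⌋; _%_)

  module _ {S T M : ReflSpace} {x : Pt S} {lc : Local.LocallyConnected S x}
           (f : Local.local S x lc ≃ M) (y : Pt T) (τ : Pt M → Pt T)
           (τ-nbr : ∀ m → d T y (τ m) ≡ 1)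
           (τ-iso : ∀ m m′ → d T (τ m) (τ m′) ≡ d M m m′)
           (τ-surj : ∀ c → d T y c ≡ 1 → Σ (Pt M) λ m → τ m ≡ c) where
    private
      module f = _≃_ f
      open Local S x

      point : ∀ a → d S x a ≡ 1 → Pt (local lc)
      point a p = a , nbr⇐ p

    -- `τ` identifies the model `M` with the neighbours of `y`, so composing it with `f` matches the
    -- first neighbourhoods of `x` and `y`, which is all that uniqueness asks for.
    extend : S ≃ T
    extend = Uniqueness.local-iso S T x y
      (λ a p → τ (f.to (point a p)))
      (λ a p → τ-nbr (f.to (point a p)))
      (λ a p b q → trans (τ-iso (f.to (point a p)) (f.to (point b q))) (f.to-d (point a p) (point b q)))
      λ c p → let m , e = τ-surj c p in
        proj₁ (f.from m) , nbr⇒ (proj₂ (f.from m)) ,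
        trans (cong (τ ∘ f.to) (subset-≡ isNbr refl)) (trans (cong τ (f.to-from m)) e)

  -- The distance of a complete graph; sums of two such terms are the distance of a grid.
  equal : ∀ {n} → Fin n → Fin n → ℕ
  equal i j = if does (i Finₚ.≟ j) then 0 else 1

  h-++ : ∀ {m n} (s t : Bits m) (s′ t′ : Bits n) → h (s ++ s′) (t ++ t′) ≡ h s t + h s′ t′
  h-++ [] [] s′ t′ = refl
  h-++ (a ∷ s) (b ∷ t) s′ t′ = trans (cong (h₁ a b +_) (h-++ s t s′ t′)) (sym (ℕₚ.+-assoc (h₁ a b) _ _))

  card-++ : ∀ {m n} (s : Bits m) (t : Bits n) → ∣ s ++ t ∣ ≡ ∣ s ∣ + ∣ t ∣
  card-++ [] t = refl
  card-++ (true ∷ s) t = cong suc (card-++ s t)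
  card-++ (false ∷ s) t = card-++ s t

  ∅-h : ∀ {n} (s : Bits n) → h (∅ n) s ≡ ∣ s ∣
  ∅-h s = trans (h-sym (∅ _) s) (h-∅ s)

  ∣∅∣ : ∀ n → ∣ ∅ n ∣ ≡ 0
  ∣∅∣ n = trans (sym (h-∅ (∅ n))) (h-refl (∅ n))

  ∁-∁ : ∀ {n} (s : Bits n) → ∁ (∁ s) ≡ s
  ∁-∁ [] = refl
  ∁-∁ (b ∷ s) = cong₂ _∷_ (Boolₚ.not-involutive b) (∁-∁ s)

  singleton : ∀ {n} (s : Bits n) → ∣ s ∣ ≡ 1 → Σ (Fin n) λ i → ⁅ i ⁆ ≡ s
  singleton (true ∷ s) e = zero , cong (true ∷_) (h-zero (trans (∅-h s) (ℕₚ.suc-injective e)))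
  singleton (false ∷ s) e with singleton s e
  ... | i , refl = suc i , refl

  h-⁅⁆ : ∀ {n} (i j : Fin n) → h ⁅ i ⁆ ⁅ j ⁆ ≡ equal i j + equal i j
  h-⁅⁆ {suc n} zero zero = h-refl (∅ n)
  h-⁅⁆ {suc n} zero (suc j) = cong suc (trans (∅-h ⁅ j ⁆) (∣⁅x⁆∣≡1 j))
  h-⁅⁆ (suc i) zero = cong suc (trans (h-∅ ⁅ i ⁆) (∣⁅x⁆∣≡1 i))
  h-⁅⁆ (suc i) (suc j) = h-⁅⁆ i j

  -- The neighbours of the a-set {1,…,a} arise by exchanging some i ≤ a for some j > a.
  module Grid (a b : ℕ) where
    private
      open Code (johnsonCode (a + b) a)
      -- `s` is what is removed from the first `a` points and `t` what is added among the last `b`.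
      word : Bits a → Bits b → Bits (a + b)
      word s t = ∁ s ++ t

      weight : ∀ s t → ∣ s ∣ ≡ ∣ t ∣ → ∣ word s t ∣ ≡ a
      weight s t e = trans (card-++ (∁ s) t) (trans (cong (∣ ∁ s ∣ +_) (sym e)) (∁-card s))

      h-word : ∀ s s′ t t′ → h (word s t) (word s′ t′) ≡ h s s′ + h t t′
      h-word s s′ t t′ = trans (h-++ (∁ s) (∁ s′) t t′) (cong (_+ h t t′) (h-∁-∁ s s′))

    base : Pt (johnson (a + b) a)
    base = word (∅ a) (∅ b) , weight (∅ a) (∅ b) (trans (∣∅∣ a) (sym (∣∅∣ b)))

    exchange : Fin a × Fin b → Pt (johnson (a + b) a)
    exchange (i , j) = word ⁅ i ⁆ ⁅ j ⁆ , weight ⁅ i ⁆ ⁅ j ⁆ (trans (∣⁅x⁆∣≡1 i) (sym (∣⁅x⁆∣≡1 j)))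

    exchange-nbr : ∀ p → half base (exchange p) ≡ 1
    exchange-nbr (i , j) = cong ⌊_/2⌋ (trans (h-word (∅ a) ⁅ i ⁆ (∅ b) ⁅ j ⁆)
      (cong₂ _+_ (trans (∅-h ⁅ i ⁆) (∣⁅x⁆∣≡1 i)) (trans (∅-h ⁅ j ⁆) (∣⁅x⁆∣≡1 j))))

    exchange-iso : ∀ p q → half (exchange p) (exchange q) ≡ equal (proj₁ p) (proj₁ q) + equal (proj₂ p) (proj₂ q)
    exchange-iso (i , j) (i′ , j′) = ⌊double/2⌋ (trans (h-word ⁅ i ⁆ ⁅ i′ ⁆ ⁅ j ⁆ ⁅ j′ ⁆)
      (trans (cong₂ _+_ (h-⁅⁆ i i′) (h-⁅⁆ j j′)) (interchange (equal i i′) (equal i i′) (equal j j′) (equal j j′))))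

    exchange-surj : ∀ c → half base c ≡ 1 → Σ (Fin a × Fin b) λ p → exchange p ≡ c
    exchange-surj (z , w) e = ((proj₁ i) , (proj₁ j)) , point-≡ (trans (cong₂ word (proj₂ i) (proj₂ j)) z≡)
      where
      s : Bits a
      s = ∁ (Vec.take a z)
      t : Bits b
      t = Vec.drop a z
      z≡ : word s t ≡ z
      z≡ = trans (cong (_++ t) (∁-∁ (Vec.take a z))) (Vecₚ.take++drop≡id a z)
      sum : ∣ s ∣ + ∣ t ∣ ≡ 2
      sum = trans (sym (cong₂ _+_ (∅-h s) (∅-h t))) (trans (sym (h-word (∅ a) s (∅ b) t))
        (trans (cong (h (proj₁ base)) z≡) (trans (h-half base (z , w)) (cong₂ _+_ e e))))
      -- The word has the weight `a` of the base, so as many elements are added as removed.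
      s≡t : ∣ s ∣ ≡ ∣ t ∣
      s≡t = ℕₚ.+-cancelˡ-≡ ∣ ∁ s ∣ _ _ (trans (∁-card s) (trans (sym w) (trans (cong ∣_∣ (sym z≡)) (card-++ (∁ s) t))))
      one : ∣ t ∣ ≡ 1
      one = trans (ℕₚ.n≡⌊n+n/2⌋ ∣ t ∣) (cong ⌊_/2⌋ (trans (cong (_+ ∣ t ∣) (sym s≡t)) sum))
      i : Σ (Fin a) λ i → ⁅ i ⁆ ≡ s
      i = singleton s (trans s≡t one)
      j : Σ (Fin b) λ j → ⁅ j ⁆ ≡ t
      j = singleton t one

  other-suc : ∀ {n} → Fin n → ∀ (i : Fin (suc n)) → Σ (Fin (suc n)) λ j → i ≢ j
  other-suc k zero    = suc k , λ ()
  other-suc k (suc i) = zero , λ ()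

  module _ {S : ReflSpace} {x : Pt S} {lc : Local.LocallyConnected S x} where
    local-grid : ∀ {a b M} → Local.local S x lc ≃ M → (f : Pt M → Fin a × Fin b) → (∀ p → Σ (Pt M) λ m → f m ≡ p) →
                 (∀ m m′ → d M m m′ ≡ equal (proj₁ (f m)) (proj₁ (f m′)) + equal (proj₂ (f m)) (proj₂ (f m′))) →
                 S ≃ johnson (a + b) a
    local-grid {a} {b} g f f-surj f-iso = extend g base (exchange ∘ f) (exchange-nbr ∘ f)
      (λ m m′ → trans (exchange-iso (f m) (f m′)) (sym (f-iso m m′)))
      λ c e → let p , q = exchange-surj c e ; m , r = f-surj p in m , trans (cong exchange r) q
      where open Grid a b

    local-pairs : ∀ {n} → Local.local S x lc ≃ johnson n 2 → S ≃ halvedCube n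
    local-pairs {n} g = extend g (∅ n , cong (_% 2) (∣∅∣ n)) (λ { (s , p) → s , cong (_% 2) p })
      (λ { (s , p) → cong ⌊_/2⌋ (trans (∅-h s) p) })
      (λ _ _ → refl)
      λ { (s , p) e → (s , trans (sym (∅-h s)) (trans (H.h-half (∅ n , cong (_% 2) (∣∅∣ n)) (s , p)) (cong₂ _+_ e e))) , H.point-≡ refl }
      where module H = Code (halvedCubeCode n)

    -- Complementation identifies J(n,n-2) with J(n,2), whose points are the neighbours of the empty
    -- word.
    local-copairs : ∀ {n k} → k + 2 ≡ n → Local.local S x lc ≃ johnson n k → S ≃ halvedCube n
    local-copairs {n} {k} k+2≡n g = extend g o (λ { (s , p) → ∁ s , cong (_% 2) (co s p) })
      (λ { (s , p) → cong ⌊_/2⌋ (trans (∅-h (∁ s)) (co s p)) })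
      (λ { (s , _) (t , _) → cong ⌊_/2⌋ (h-∁-∁ s t) })
      λ { (s , p) e → (∁ s , ℕₚ.+-cancelʳ-≡ 2 ∣ ∁ s ∣ k (trans (cong (∣ ∁ s ∣ +_)
            (sym (trans (sym (∅-h s)) (trans (H.h-half o (s , p)) (cong₂ _+_ e e)))))
            (trans (∁-card s) (sym k+2≡n)))) , H.point-≡ (∁-∁ s) }
      where
      module H = Code (halvedCubeCode n)
      o : Pt (halvedCube n)
      o = ∅ n , cong (_% 2) (∣∅∣ n)
      co : ∀ s → ∣ s ∣ ≡ k → ∣ ∁ s ∣ ≡ 2
      co s p = ℕₚ.+-cancelʳ-≡ k ∣ ∁ s ∣ 2 (trans (cong (∣ ∁ s ∣ +_) (sym p)) (trans (∁-card s) (trans (sym k+2≡n) (ℕₚ.+-comm k 2))))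

    local-cocktail : ∀ {n o} → Local.local S x lc ≃ CP.cocktailParty n o → (o′ : ∀ i → Σ (Fin (suc n)) λ j → i ≢ j) →
                     S ≃ CP.cocktailParty (suc n) o′
    local-cocktail {n} {o} g o′ = extend g (zero , true) (λ { (i , b) → suc i , b })
      (λ { (i , b) → C′.dist-≢ {zero} {suc i} true b λ () })
      (λ { (i , b) (j , c) → iso i b j c (i Finₚ.≟ j) })
      λ { (zero , b) e → contradiction refl (C′.dist-edge {zero , true} {zero , b} e)
        ; (suc i , b) e → (i , b) , refl }
      where
      module C = CP n o
      module C′ = CP (suc n) o′
      iso : ∀ i b j c → Dec (i ≡ j) → C′.dist (suc i , b) (suc j , c) ≡ C.dist (i , b) (j , c)
      iso i b .i c (yes refl) = trans (C′.dist-= (suc i) b c) (sym (C.dist-= i b c))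
      iso i b j  c (no i≢j)   = trans (C′.dist-≢ b c (i≢j ∘ Finₚ.suc-injective)) (sym (C.dist-≢ b c i≢j))

  all-Bits? : ∀ {n} {P : Bits n → Set} → (∀ s → Dec (P s)) → Dec (∀ s → P s)
  all-Bits? {zero}  P? = map′ (λ { p [] → p }) (λ f → f []) (P? [])
  all-Bits? {suc n} P? = map′ (λ { f (b ∷ s) → f b s }) (λ f b s → f (b ∷ s)) (all-Bool? λ b → all-Bits? λ s → P? (b ∷ s))

  -- Enumerates only words of weight `k`, so that checks on the Gosset graph run through 28 pairs
  -- and not through 256 subsets.
  all-words? : ∀ {n} k {P : Bits n → Set} → (∀ s → Dec (P s)) → Dec (∀ s → ∣ s ∣ ≡ k → P s)
  all-words? {zero}  zero    P? = map′ (λ { p [] _ → p }) (λ f → f [] refl) (P? [])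
  all-words? {zero}  (suc k) P? = yes λ { [] () }
  all-words? {suc n} zero    P? = map′ (λ { f (false ∷ s) → f s ; f (true ∷ s) () }) (λ f s → f (false ∷ s))
    (all-words? 0 λ s → P? (false ∷ s))
  all-words? {suc n} (suc k) P? = map′
    (λ { (f , g) (true ∷ s) e → f s (ℕₚ.suc-injective e) ; (f , g) (false ∷ s) → g s })
    (λ f → (λ s e → f (true ∷ s) (cong suc e)) , λ s → f (false ∷ s))
    (all-words? k (λ s → P? (true ∷ s)) ×-dec all-words? (suc k) (λ s → P? (false ∷ s)))

  any-word? : ∀ {n} k {P : Bits n → Set} → (∀ s → Dec (P s)) → Dec (Σ (Bits n) λ s → ∣ s ∣ ≡ k × P s)
  any-word? {zero}  zero    P? = map′ (λ p → [] , refl , p) (λ { ([] , _ , p) → p }) (P? [])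
  any-word? {zero}  (suc k) P? = no λ { ([] , () , _) }
  any-word? {suc n} zero    P? = map′ (λ { (s , e , p) → false ∷ s , e , p })
    (λ { (false ∷ s , e , p) → s , e , p ; (true ∷ s , () , _) }) (any-word? 0 λ s → P? (false ∷ s))
  any-word? {suc n} (suc k) P? = map′
    (λ { (inj₁ (s , e , p)) → true ∷ s , cong suc e , p ; (inj₂ (s , e , p)) → false ∷ s , e , p })
    (λ { (true ∷ s , e , p) → inj₁ (s , ℕₚ.suc-injective e , p) ; (false ∷ s , e , p) → inj₂ (s , e , p) })
    (any-word? k (λ s → P? (true ∷ s)) ⊎-dec any-word? (suc k) (λ s → P? (false ∷ s)))

-- The Schläfli and Gosset graphs and the halved 4-cube

module Exceptional where
  open ReflectionSpaces
  open Subspaces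
  open GraphsOfSpaces
  open Hamming
  open Codes
  open CocktailParties
  open GossetSpace
  open LocalGraphs
  open import Data.Nat as ℕ using (ℕ; zero; suc; _≤_; ⌊_/2⌋; _%_)

  -- Vertices without the proof of their weight, so that the finite checks evaluate plain bits.
  Raw : Set
  Raw = Bool × Bits 8

  rawDist : Raw → Raw → ℕ
  rawDist (b , s) (c , t) = if b xor c then suc ∣ s ∩ t ∣ else ⌊ h s t /2⌋

  raw : Vertex → Raw
  raw (b , s , _) = b , s

  raw₀ : Raw
  raw₀ = raw gosset₀

  all-vertices? : ∀ {P : Raw → Set} → (∀ r → Dec (P r)) → Dec (∀ v → P (raw v))
  all-vertices? P? = map′ (λ { f (b , s , e) → f b s e }) (λ f b s e → f (b , s , e))
    (all-Bool? λ b → all-words? 2 λ s → P? (b , s))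

  any-vertex? : ∀ {P : Raw → Set} → (∀ r → Dec (P r)) → Dec (Σ Vertex λ v → P (raw v))
  any-vertex? P? = map′
    (λ { (inj₁ (s , e , p)) → (true , s , e) , p ; (inj₂ (s , e , p)) → (false , s , e) , p })
    (λ { ((true , s , e) , p) → inj₁ (s , e , p) ; ((false , s , e) , p) → inj₂ (s , e , p) })
    (any-word? 2 (λ s → P? (true , s)) ⊎-dec any-word? 2 (λ s → P? (false , s)))

  gosset-locally-connected : Local.LocallyConnected gosset gosset₀
  gosset-locally-connected a b xa xb = check a xa b xb
    where
    check : ∀ a → dist gosset₀ a ≡ 1 → ∀ b → dist gosset₀ b ≡ 1 → dist a b ≡ 2 → Local.Path₂ gosset gosset₀ a b
    check = toWitness {a? = all-vertices? λ a → (rawDist raw₀ a ℕ.≟ 1) →-dec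
      (all-vertices? λ b → (rawDist raw₀ b ℕ.≟ 1) →-dec ((rawDist a b ℕ.≟ 2) →-dec
      (any-vertex? λ c → (rawDist raw₀ c ℕ.≟ 1) ×-dec (rawDist a c ℕ.≟ 1) ×-dec (rawDist c b ℕ.≟ 1))))} tt

  schlaefli : ReflSpace
  schlaefli = Local.local gosset gosset₀ gosset-locally-connected

  schlaefli≅ : graph schlaefli ≅ Schlaefli
  schlaefli≅ = iso {graph schlaefli} {Schlaefli}
    (λ { (v , t) → v , G.adj-f (L.nbr⇒ {v} t) }) (λ { (v , e) → v , L.nbr⇐ {v} (G.f-adj e) })
    (λ { (v , e) → cong (v ,_) (irrelevant′ v _ e) }) (λ _ → subset-≡ L.isNbr refl)
    (λ {u} {v} → G.adj-f {proj₁ u} {proj₁ v}) (λ {u} {v} → G.f-adj {proj₁ u} {proj₁ v})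
    where
    module L = Local gosset gosset₀
    module G = Iso {graph gosset} {Gosset} gosset≅
    irrelevant′ : ∀ v (p q : adj Gosset gosset₀ v) → p ≡ q
    irrelevant′ (true , _)  = ℕₚ.≡-irrelevant
    irrelevant′ (false , _) = ℕₚ.≡-irrelevant

  local-schlaefli : ∀ {S x} {lc : Local.LocallyConnected S x} → Local.local S x lc ≃ schlaefli → S ≃ gosset
  local-schlaefli f = extend f gosset₀ proj₁ (λ { (v , t) → nbr⇒ {v} t }) (λ _ _ → refl)
    λ c e → (c , nbr⇐ {c} e) , refl
    where open Local gosset gosset₀

  -- The centre is {0,1} on sheet `true`; the leaves are {0,2} and {1,3} on the same sheet and {2,3}
  -- on the other. Across the sheets, meeting in one point means distance 2 and being disjoint means
  -- distance 1.
  gosset-claw : Σ Vertex λ e → Σ Vertex λ a → Σ Vertex λ b → Σ Vertex λ c →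
                (dist e a ≡ 1 × dist e b ≡ 1 × dist e c ≡ 1) × dist a b ≡ 2 × dist a c ≡ 2 × dist b c ≡ 2
  gosset-claw = gosset₀ ,
    (true  , (true  ∷ false ∷ true  ∷ false ∷ ∅ 4) , refl) ,
    (true  , (false ∷ true  ∷ false ∷ true  ∷ ∅ 4) , refl) ,
    (false , (false ∷ false ∷ true  ∷ true  ∷ ∅ 4) , refl) ,
    (refl , refl , refl) , refl , refl , refl

  -- Relative to {0,1} on sheet true, the neighbours of {6,7} on sheet false are the pairs {i,j} on
  -- sheet true and {j,q} on sheet false with i ∈ {0,1}, 2 ≤ j ≤ 5, q ∈ {6,7}.  As half-spin weights of
  -- D₃ × D₂ ⊂ D₅, the first three bits (even, or the complement of an even word) encode j, and the
  -- fourth encodes i or q.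
  encode : Bits 5 → Raw
  encode (a ∷ b ∷ c ∷ e ∷ _) = not o ,
    (not o ∧ not e) ∷ (not o ∧ e) ∷ not (p ∨ q) ∷ (p ∧ q) ∷ (p ∧ not q) ∷ (not p ∧ q) ∷ (o ∧ not e) ∷ (o ∧ e) ∷ []
    where
    o = a xor b xor c
    p = a xor b
    q = a xor c

  -- The last bit is the parity of the other four; `encode` ignores it because it is redundant on
  -- even words.
  decode : Raw → Bits 5
  decode (s , i₀ ∷ i₁ ∷ j₂ ∷ j₃ ∷ j₄ ∷ j₅ ∷ q₆ ∷ q₇ ∷ []) = a ∷ (a xor p) ∷ (a xor q) ∷ e ∷ (e xor not s) ∷ []
    where
    p = j₃ ∨ j₄
    q = j₃ ∨ j₅
    a = not s xor p xor q
    e = i₁ ∨ q₇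

  module _ where
    private
      w₀ : Vertex
      w₀ = false , (false ∷ false ∷ false ∷ false ∷ false ∷ false ∷ true ∷ true ∷ []) , refl

      encode-weight : ∀ s → ∣ proj₂ (encode s) ∣ ≡ 2
      encode-weight = toWitness {a? = all-Bits? λ s → ∣ proj₂ (encode s) ∣ ℕ.≟ 2} tt

      vertex : Bits 5 → Vertex
      vertex s = proj₁ (encode s) , proj₂ (encode s) , encode-weight s

      vertex₀ : ∀ s → dist gosset₀ (vertex s) ≡ 1
      vertex₀ = toWitness {a? = all-Bits? λ s → rawDist raw₀ (encode s) ℕ.≟ 1} tt

      vertex-nbr : ∀ s → dist w₀ (vertex s) ≡ 1
      vertex-nbr = toWitness {a? = all-Bits? λ s → rawDist (raw w₀) (encode s) ℕ.≟ 1} tt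

      vertex-iso : ∀ s → ∣ s ∣ % 2 ≡ 0 → ∀ t → ∣ t ∣ % 2 ≡ 0 → dist (vertex s) (vertex t) ≡ ⌊ h s t /2⌋
      vertex-iso = toWitness {a? = all-Bits? λ s → (∣ s ∣ % 2 ℕ.≟ 0) →-dec (all-Bits? λ t → (∣ t ∣ % 2 ℕ.≟ 0) →-dec
        (rawDist (encode s) (encode t) ℕ.≟ ⌊ h s t /2⌋))} tt

      vertex-surj : ∀ v → dist gosset₀ v ≡ 1 → dist w₀ v ≡ 1 →
                    ∣ decode (raw v) ∣ % 2 ≡ 0 × proj₁ (encode (decode (raw v))) ≡ proj₁ (raw v) ×
                    proj₂ (encode (decode (raw v))) ≡ proj₂ (raw v)
      vertex-surj = toWitness {a? = all-vertices? λ v → (rawDist raw₀ v ℕ.≟ 1) →-dec ((rawDist (raw w₀) v ℕ.≟ 1) →-dec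
        ((∣ decode v ∣ % 2 ℕ.≟ 0) ×-dec (proj₁ (encode (decode v)) Boolₚ.≟ proj₁ v) ×-dec
         Vecₚ.≡-dec Boolₚ._≟_ (proj₂ (encode (decode v))) (proj₂ v)))} tt

      vertex-≡ : ∀ {u v} → proj₁ (raw u) ≡ proj₁ (raw v) → proj₂ (raw u) ≡ proj₂ (raw v) → u ≡ v
      vertex-≡ {b , s , p} {_ , _ , q} refl refl = cong (λ e → b , s , e) (ℕₚ.≡-irrelevant p q)

    local-halvedCube₅ : ∀ {S x} {lc : Local.LocallyConnected S x} → Local.local S x lc ≃ halvedCube 5 → S ≃ schlaefli
    local-halvedCube₅ f = extend f (w₀ , nbr⇐ {w₀} refl) (λ { (s , _) → vertex s , nbr⇐ {vertex s} (vertex₀ s) })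
      (λ { (s , _) → vertex-nbr s }) (λ { (s , p) (t , q) → vertex-iso s p t q })
      λ { (v , t) e → let p , q , r = vertex-surj v (nbr⇒ {v} t) e in (decode (raw v) , p) , subset-≡ isNbr (vertex-≡ q r) }
      where open Local gosset gosset₀

  module _ where
    other₄ : ∀ (i : Fin 4) → Σ (Fin 4) λ j → i ≢ j
    other₄ zero    = suc zero , λ ()
    other₄ (suc i) = zero , λ ()

    private
      index : Bool → Bool → Fin 4
      index false false = zero
      index false true  = suc zero
      index true  false = suc (suc zero)
      index true  true  = suc (suc (suc zero))

      -- Antipodes are complements.
      to₄ : Bits 4 → Fin 4 × Bool
      to₄ (a ∷ b ∷ c ∷ _) = index (a xor b) (a xor c) , a

      word₄ : Bool → Bool → Bool → Bits 4
      word₄ p q a = a ∷ (a xor p) ∷ (a xor q) ∷ (a xor p xor q) ∷ []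

      from₄ : Fin 4 × Bool → Bits 4
      from₄ (zero , a)                = word₄ false false a
      from₄ (suc zero , a)            = word₄ false true a
      from₄ (suc (suc zero) , a)      = word₄ true false a
      from₄ (suc (suc (suc zero)) , a) = word₄ true true a

      from₄-even : ∀ i a → ∣ from₄ (i , a) ∣ % 2 ≡ 0
      from₄-even = toWitness {a? = Finₚ.all? λ i → all-Bool? λ a → ∣ from₄ (i , a) ∣ % 2 ℕ.≟ 0} tt

      to-from₄ : ∀ i a → to₄ (from₄ (i , a)) ≡ (i , a)
      to-from₄ i a = cong₂ _,_ (p i a) (q i a)
        where
        p : ∀ i a → proj₁ (to₄ (from₄ (i , a))) ≡ i
        p = toWitness {a? = Finₚ.all? λ i → all-Bool? λ a → proj₁ (to₄ (from₄ (i , a))) Finₚ.≟ i} tt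
        q : ∀ i a → proj₂ (to₄ (from₄ (i , a))) ≡ a
        q = toWitness {a? = Finₚ.all? λ i → all-Bool? λ a → proj₂ (to₄ (from₄ (i , a))) Boolₚ.≟ a} tt

      to₄-d : ∀ s → ∣ s ∣ % 2 ≡ 0 → ∀ t → ∣ t ∣ % 2 ≡ 0 → CP.dist 4 other₄ (to₄ s) (to₄ t) ≡ ⌊ h s t /2⌋
      to₄-d = toWitness {a? = all-Bits? λ s → (∣ s ∣ % 2 ℕ.≟ 0) →-dec (all-Bits? λ t → (∣ t ∣ % 2 ℕ.≟ 0) →-dec
        (CP.dist 4 other₄ (to₄ s) (to₄ t) ℕ.≟ ⌊ h s t /2⌋))} tt

    -- An instance of triality: the half-spin weights of D4, like its vector weights, form a
    -- cross-polytope.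
    halvedCube₄ : halvedCube 4 ≃ CP.cocktailParty 4 other₄
    halvedCube₄ = record
      { to      = λ { (s , _) → to₄ s }
      ; from    = λ { (i , a) → from₄ (i , a) , from₄-even i a }
      ; to-from = λ { (i , a) → to-from₄ i a }
      ; to-d    = λ { (s , p) (t , q) → to₄-d s p t q }
      }

-- Classification by induction on the number of points

module Classification where
  open ReflectionSpaces
  open Subspaces
  open Decomposition
  open Hamming
  open Codes
  open CocktailParties
  open GossetSpace using (gosset)
  open LocalGraphs
  open Exceptional
  open import Data.Nat as ℕ using (ℕ; zero; suc; _+_; _≤_; z≤n; s≤s; ⌊_/2⌋; _%_)
  import Data.Nat.Tactic.RingSolver as ℕ-Solver
  open import Data.List as List using (List; []; _∷_; length)

  record Claw (S : ReflSpace) : Set where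
    field
      {e a b c} : Pt S
      ea : d S e a ≡ 1
      eb : d S e b ≡ 1
      ec : d S e c ≡ 1
      ab : d S a b ≡ 2
      ac : d S a c ≡ 2
      bc : d S b c ≡ 2

  claw-≃ : ∀ {S T} → S ≃ T → Claw T → Claw S
  claw-≃ {S} {T} f w = record
    { ea = pull ea ; eb = pull eb ; ec = pull ec ; ab = pull ab ; ac = pull ac ; bc = pull bc }
    where
    open Claw w
    open _≃_ f
    pull : ∀ {u v n} → d T u v ≡ n → d S (from u) (from v) ≡ n
    pull {u} {v} = trans (from-d u v)

  local-clawless : ∀ S x lc → ¬ Claw (Local.local S x lc)
  local-clawless S x lc w = no-claw (nbr⇒ {proj₁ e} (proj₂ e)) (nbr⇒ {proj₁ a} (proj₂ a)) (nbr⇒ {proj₁ b} (proj₂ b))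
    (nbr⇒ {proj₁ c} (proj₂ c)) ea eb ec ab ac bc
    where
    open Local S x
    open Claw w

  -- The leaves exchange three different elements of `e` for three different non-elements, which
  -- takes three of each; `w` is the part common to all four words.
  johnson-claw : ∀ {m n k} (w : Bits m) → 6 + m ≡ n → 3 + ∣ w ∣ ≡ k → Claw (johnson n k)
  johnson-claw {m} w refl refl = record
    { e = true ∷ true ∷ true ∷ false ∷ false ∷ false ∷ w , refl
    ; a = false ∷ true ∷ true ∷ true ∷ false ∷ false ∷ w , refl
    ; b = true ∷ false ∷ true ∷ false ∷ true ∷ false ∷ w , refl
    ; c = true ∷ true ∷ false ∷ false ∷ false ∷ true ∷ w , refl
    ; ea = tail 2 ; eb = tail 2 ; ec = tail 2 ; ab = tail 4 ; ac = tail 4 ; bc = tail 4 }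
    where
    tail : ∀ j → ⌊ j + h w w /2⌋ ≡ ⌊ j /2⌋
    tail j = cong ⌊_/2⌋ (trans (cong (j +_) (h-refl w)) (ℕₚ.+-identityʳ j))

  -- Three disjoint pairs around the empty word, which take six coordinates.
  halvedCube-claw : ∀ {m n} → 6 + m ≡ n → Claw (halvedCube n)
  halvedCube-claw {m} refl = record
    { e = false ∷ false ∷ false ∷ false ∷ false ∷ false ∷ ∅ m , even 0
    ; a = true ∷ true ∷ false ∷ false ∷ false ∷ false ∷ ∅ m , even 2
    ; b = false ∷ false ∷ true ∷ true ∷ false ∷ false ∷ ∅ m , even 2
    ; c = false ∷ false ∷ false ∷ false ∷ true ∷ true ∷ ∅ m , even 2
    ; ea = tail 2 ; eb = tail 2 ; ec = tail 2 ; ab = tail 4 ; ac = tail 4 ; bc = tail 4 }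
    where
    even : ∀ j → (j + ∣ ∅ m ∣) % 2 ≡ j % 2
    even j = cong (_% 2) (trans (cong (j +_) (∣∅∣ m)) (ℕₚ.+-identityʳ j))
    tail : ∀ j → ⌊ j + h (∅ m) (∅ m) /2⌋ ≡ ⌊ j /2⌋
    tail j = cong ⌊_/2⌋ (trans (cong (j +_) (h-refl (∅ m))) (ℕₚ.+-identityʳ j))

  word-of-weight : ∀ j k → Σ (Bits (j + k)) λ s → ∣ s ∣ ≡ k
  word-of-weight zero zero = [] , refl
  word-of-weight zero (suc k) with word-of-weight zero k
  ... | s , e = true ∷ s , cong suc e
  word-of-weight (suc j) k with word-of-weight j k
  ... | s , e = false ∷ s , e

  Complete : ReflSpace → Set
  Complete S = ∀ u v → d S u v ≤ 1

  record Indexing (A : Set) (P : A → Set) : Set where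
    field
      {size}    : ℕ
      at        : Fin size → A
      injective : ∀ {i j} → at i ≡ at j → i ≡ j
      index     : ∀ v → P v → Σ (Fin size) λ i → at i ≡ v

  -- Repetitions are dropped because the size has to be exact: it becomes a parameter of a Johnson
  -- graph.
  indexing : ∀ {A : Set} → (∀ (u v : A) → Dec (u ≡ v)) → (l : List A) → Indexing A (_∈ l)
  indexing _≟_ [] = record { size = 0 ; at = λ () ; injective = λ { {()} } ; index = λ _ () }
  indexing _≟_ (v ∷ l) with indexing _≟_ l
  ... | I with Finₚ.any? (λ i → Indexing.at I i ≟ v)
  ...   | yes (i , e) = record { at = at ; injective = injective ; index = λ { w (here refl) → i , e ; w (there p) → index w p } }
    where open Indexing I
  ...   | no new = record { at = at′ ; injective = inj ; index = λ { w (here refl) → zero , refl ; w (there p) → let i , e = index w p in suc i , e } }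
    where
    open Indexing I
    at′ : Fin (suc size) → _
    at′ zero    = v
    at′ (suc i) = at i
    inj : ∀ {i j} → at′ i ≡ at′ j → i ≡ j
    inj {zero} {zero} e = refl
    inj {zero} {suc j} e = contradiction (j , sym e) new
    inj {suc i} {zero} e = contradiction (i , e) new
    inj {suc i} {suc j} e = cong suc (injective e)

  record Coordinates (S : ReflSpace) : Set where
    field
      {size}    : ℕ
      at        : Fin size → Pt S
      coord     : Pt S → Fin size
      coord-at  : ∀ i → coord (at i) ≡ i
      d-coord   : ∀ u v → d S u v ≡ equal (coord u) (coord v)

  coordinates : ∀ {S} (l : List (Pt S)) → (∀ v → v ∈ l) → Complete S → Coordinates S
  coordinates {S} l full complete = record
    { at = at ; coord = coord ; coord-at = λ i → injective (proj₂ (index (at i) (full (at i)))) ; d-coord = d-coord }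
    where
    open Indexing (indexing (Space._≟_ S) l)
    coord : Pt S → Fin size
    coord v = proj₁ (index v (full v))
    d-coord : ∀ u v → d S u v ≡ equal (coord u) (coord v)
    d-coord u v with coord u Finₚ.≟ coord v
    ... | yes e = trans (cong (d S u) (sym u≡v)) (d-refl S u)
      where
      u≡v : u ≡ v
      u≡v = trans (sym (proj₂ (index u (full u)))) (trans (cong at e) (proj₂ (index v (full v))))
    ... | no ne with d S u v in duv | complete u v
    ...   | zero        | _       = contradiction (cong coord (d-zero S duv)) ne
    ...   | suc zero    | _       = refl
    ...   | suc (suc _) | s≤s ()

  data Model : Set where
    cocktail-party : (n : ℕ) → (∀ (i : Fin n) → Σ (Fin n) λ j → i ≢ j) → Model
    johnson-space  : (n k : ℕ) → Model
    halved-cube    : (n : ℕ) → Model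
    schlaefli-space gosset-space : Model

  ⟦_⟧ : Model → ReflSpace
  ⟦ cocktail-party n o ⟧ = CP.cocktailParty n o
  ⟦ johnson-space n k ⟧  = johnson n k
  ⟦ halved-cube n ⟧      = halvedCube n
  ⟦ schlaefli-space ⟧    = schlaefli
  ⟦ gosset-space ⟧       = gosset

  -- The two edges in `split` witness that neither factor is a single point; an edge in one factor
  -- is what forces the other to be complete in a clawless product.
  data Classified (S : ReflSpace) : Set₁ where
    model : ∀ m → S ≃ ⟦ m ⟧ → Classified S
    split : ∀ {A B} {a a′ : Pt A} {b b′ : Pt B} → d A a a′ ≡ 1 → d B b b′ ≡ 1 →
            Classified A → Classified B → S ≃ product A B → Classified S

  -- Two points at distance 2 in A give, with an edge of B, a claw in A × B.
  module _ {A B : ReflSpace} where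
    complete-factorˡ : ∀ {b b′} → d B b b′ ≡ 1 → ¬ Claw (product A B) → Complete A
    complete-factorˡ {b} {b′} bb′ clawless u v with d A u v in e
    ... | zero = z≤n
    ... | suc zero = s≤s z≤n
    ... | suc (suc k) with geodesic A e
    ...   | w , uw , wv with geodesic A wv
    ...     | z , wz , zv = contradiction (record
      { e = w , b ; a = u , b ; b = z , b ; c = w , b′
      ; ea = cong₂ _+_ (trans (d-sym A w u) uw) (d-refl B b)
      ; eb = cong₂ _+_ wz (d-refl B b)
      ; ec = cong₂ _+_ (d-refl A w) bb′
      ; ab = cong₂ _+_ uz (d-refl B b)
      ; ac = cong₂ _+_ uw bb′
      ; bc = cong₂ _+_ (trans (d-sym A z w) wz) bb′ }) clawless
      where
      uz : d A u z ≡ 2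
      uz = ℕₚ.≤-antisym (subst (λ m → d A u z ≤ m) (cong suc wz) (d-lip A uw z))
        (ℕₚ.+-cancelʳ-≤ k 2 (d A u z) (subst₂ _≤_ e (cong (d A u z +_) zv) (Space.δ-triangle A u z v)))

  product-comm : ∀ {A B} → product A B ≃ product B A
  product-comm {A} {B} = record
    { to = λ { (u , v) → v , u } ; from = λ { (v , u) → u , v } ; to-from = λ _ → refl
    ; to-d = λ { (u , v) (u′ , v′) → ℕₚ.+-comm (d B v v′) (d A u u′) } }

  half≤weight : ∀ {n k} (s t : Bits n) → ∣ s ∣ ≡ k → ∣ t ∣ ≡ k → ⌊ h s t /2⌋ ≤ k
  half≤weight {n} {k} s t p q = subst (⌊ h s t /2⌋ ≤_) (sym (ℕₚ.n≡⌊n+n/2⌋ k))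
    (ℕₚ.⌊n/2⌋-mono (subst (h s t ≤_) (cong₂ _+_ (trans (h-∅ s) p) (trans (∅-h t) q)) (h-triangle s (∅ n) t)))

  half≤coweight : ∀ {j n k} (s t : Bits n) → j + k ≡ n → ∣ s ∣ ≡ k → ∣ t ∣ ≡ k → ⌊ h s t /2⌋ ≤ j
  half≤coweight {j} {n} {k} s t e p q = subst (λ m → ⌊ m /2⌋ ≤ j) (h-∁-∁ s t) (half≤weight (∁ s) (∁ t) (co s p) (co t q))
    where
    co : ∀ s → ∣ s ∣ ≡ k → ∣ ∁ s ∣ ≡ j
    co s p = ℕₚ.+-cancelʳ-≡ k ∣ ∁ s ∣ j (trans (cong (∣ ∁ s ∣ +_) (sym p)) (trans (∁-card s) (sym e)))

  h≤length : ∀ {n} (s t : Bits n) → h s t ≤ n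
  h≤length s t = subst (h s t ≤_) (h-∁ s t) (ℕₚ.m≤n+m (h s t) (h (∁ s) t))

  johnson-complete : ∀ {n} k → k ≤ 1 → Complete (johnson n k)
  johnson-complete k le (s , p) (t , q) = ℕₚ.≤-trans (half≤weight s t p q) le

  johnson-cocomplete : ∀ {n} j k → j + k ≡ n → j ≤ 1 → Complete (johnson n k)
  johnson-cocomplete j k e le (s , p) (t , q) = ℕₚ.≤-trans (half≤coweight s t e p q) le

  halvedCube-complete : ∀ n → n ≤ 3 → Complete (halvedCube n)
  halvedCube-complete n le (s , _) (t , _) = ℕₚ.⌊n/2⌋-mono {h s t} {3} (ℕₚ.≤-trans (h≤length s t) le)

  module _ (S : ReflSpace) (x : Pt S) (lc : Local.LocallyConnected S x)
           (l : List (Pt (Local.local S x lc))) (full : ∀ v → v ∈ l) where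
    private
      identity : Local.local S x lc ≃ Local.local S x lc
      identity = record { to = λ v → v ; from = λ v → v ; to-from = λ _ → refl ; to-d = λ _ _ → refl }

    -- A complete graph is a grid with a single column, and J(size+1,size) is the complete graph on
    -- `size + 1` points.
    complete-local : Complete (Local.local S x lc) → Classified S
    complete-local complete = model (johnson-space (size + 1) size) (local-grid {S} {x} {lc} identity (λ v → coord v , zero {0})
      (λ { (i , zero) → at i , cong (_, zero) (coord-at i) })
      λ u v → trans (d-coord u v) (sym (ℕₚ.+-identityʳ _)))
      where open Coordinates (coordinates {Local.local S x lc} l full complete)

    complete-≃ : ∀ {M} → Local.local S x lc ≃ M → Complete M → Classified S
    complete-≃ f complete = complete-local λ u v → subst (_≤ 1) (to-d u v) (complete (to u) (to v))
      where open _≃_ f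

    private
      clawless : ∀ {M} → Local.local S x lc ≃ M → ¬ Claw M
      clawless f w = local-clawless S x lc (claw-≃ f w)

    -- The absence of claws makes both factors complete, so the local space is a grid. The factors
    -- are enumerated by projecting `l`, with `b` and `a` as fixed second and first coordinates.
    local-product : ∀ {A B} {a a′ : Pt A} {b b′ : Pt B} → d A a a′ ≡ 1 → d B b b′ ≡ 1 → Local.local S x lc ≃ product A B → Classified S
    local-product {A} {B} {a} {b = b} aa′ bb′ f = model (johnson-space (CA.size + CB.size) CA.size) (local-grid {S} {x} {lc} f
      (λ { (u , v) → CA.coord u , CB.coord v })
      (λ { (i , j) → (CA.at i , CB.at j) , cong₂ _,_ (CA.coord-at i) (CB.coord-at j) })
      λ { (u , v) (u′ , v′) → cong₂ _+_ (CA.d-coord u u′) (CB.d-coord v v′) })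
      where
      open _≃_ f
      module CA = Coordinates (coordinates {A} (List.map (proj₁ ∘ to) l)
        (λ u → subst (_∈ List.map (proj₁ ∘ to) l) (cong proj₁ (to-from (u , b))) (∈-map⁺ (proj₁ ∘ to) (full (from (u , b)))))
        (complete-factorˡ {A} {B} bb′ (clawless f)))
      module CB = Coordinates (coordinates {B} (List.map (proj₂ ∘ to) l)
        (λ v → subst (_∈ List.map (proj₂ ∘ to) l) (cong proj₂ (to-from (a , v))) (∈-map⁺ (proj₂ ∘ to) (full (from (a , v)))))
        (complete-factorˡ {B} {A} aa′ (clawless (≃-trans f (product-comm {A} {B})))))

    -- The parameters `k` and `j`, the latter standing for n - k, decide the case: one of them at
    -- most 1 gives a complete graph, one equal to 2 the local graph of a halved cube, and both at
    -- least 3 a claw.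
    local-johnson : ∀ {n} j k → j + k ≡ n → Local.local S x lc ≃ johnson n k → Classified S
    local-johnson {n} j k e f with k ℕ.≤? 1 | j ℕ.≤? 1 | k ℕ.≟ 2 | j ℕ.≟ 2
    ... | yes k≤1 | _       | _        | _        = complete-≃ f (johnson-complete k k≤1)
    ... | no _    | yes j≤1 | _        | _        = complete-≃ f (johnson-cocomplete j k e j≤1)
    ... | no _    | no _    | yes refl | _        = model (halved-cube n) (local-pairs {S} {x} {lc} {n} f)
    ... | no _    | no _    | no _     | yes refl = model (halved-cube n) (local-copairs {S} {x} {lc} {n} {k} (trans (ℕₚ.+-comm k 2) e) f)
    ... | no k≰1  | no j≰1  | no k≢2   | no j≢2   = contradiction
      (johnson-claw (proj₁ w) (trans (sizes (proj₁ j₃) (proj₁ k₃)) (trans (cong₂ _+_ (proj₂ j₃) (proj₂ k₃)) e))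
        (trans (cong (3 +_) (proj₂ w)) (proj₂ k₃)))
      (clawless f)
      where
      j₃ : Σ ℕ λ o → 3 + o ≡ j
      j₃ = ℕₚ.m≤n⇒∃[o]m+o≡n (ℕₚ.≤∧≢⇒< (ℕₚ.≰⇒> j≰1) (≢-sym j≢2))
      k₃ : Σ ℕ λ o → 3 + o ≡ k
      k₃ = ℕₚ.m≤n⇒∃[o]m+o≡n (ℕₚ.≤∧≢⇒< (ℕₚ.≰⇒> k≰1) (≢-sym k≢2))
      w = word-of-weight (proj₁ j₃) (proj₁ k₃)
      sizes : ∀ j k → 6 + (j + k) ≡ (3 + j) + (3 + k)
      sizes = ℕ-Solver.solve-∀

    local-halvedCube : ∀ n → Local.local S x lc ≃ halvedCube n → Classified S
    local-halvedCube n f with n ℕ.≤? 3 | n ℕ.≟ 4 | n ℕ.≟ 5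
    ... | yes n≤3 | _        | _        = complete-≃ f (halvedCube-complete n n≤3)
    ... | no _    | yes refl | _        = model (cocktail-party 5 (other-suc zero))
      (local-cocktail {S} {x} {lc} {4} {other₄} (≃-trans f halvedCube₄) (other-suc zero))
    ... | no _    | no _     | yes refl = model schlaefli-space (local-halvedCube₅ {S} {x} {lc} f)
    ... | no n≰3  | no n≢4   | no n≢5   = contradiction
      (halvedCube-claw (proj₂ (ℕₚ.m≤n⇒∃[o]m+o≡n (ℕₚ.≤∧≢⇒< (ℕₚ.≤∧≢⇒< (ℕₚ.≰⇒> n≰3) (≢-sym n≢4)) (≢-sym n≢5)))))
      (clawless f)

    -- The point `v` rules out degenerate parameters: it makes the number of antipodal pairs
    -- positive, and as a word it splits `n` into `k` and the weight of its complement.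
    classify-local : Pt (Local.local S x lc) → Classified (Local.local S x lc) → Classified S
    classify-local v (model (cocktail-party n o) f) =
      model (cocktail-party (suc n) o′) (local-cocktail {S} {x} {lc} {n} {o} f o′)
      where o′ = other-suc (proj₁ (_≃_.to f v))
    classify-local v (model (johnson-space n k) f) = local-johnson ∣ ∁ (proj₁ s) ∣ k
      (trans (cong (∣ ∁ (proj₁ s) ∣ +_) (sym (proj₂ s))) (∁-card (proj₁ s))) f
      where s = _≃_.to f v
    classify-local v (model (halved-cube n) f)  = local-halvedCube n f
    classify-local v (model schlaefli-space f)  = model gosset-space (local-schlaefli {S} {x} {lc} f)
    classify-local v (model gosset-space f)     =
      let e , a , b , c , (ea , eb , ec) , ab , ac , bc = gosset-claw
      in contradiction (record { e = e ; a = a ; b = b ; c = c ; ea = ea ; eb = eb ; ec = ec ; ab = ab ; ac = ac ; bc = bc }) (clawless {gosset} f)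
    classify-local v (split aa′ bb′ _ _ f)      = local-product aa′ bb′ f

  module _ (S : ReflSpace) (x : Pt S) (l : List (Pt S)) (full : ∀ v → v ∈ l) where
    open Space S
    open Local S x

    path₂? : ∀ a b → Dec (Path₂ a b)
    path₂? a b = map′ satisfied (λ { (c , p) → lose (full c) p })
      (any? (λ c → (δ x c ℕ.≟ 1) ×-dec (δ a c ℕ.≟ 1) ×-dec (δ c b ℕ.≟ 1)) l)

    record Disconnection : Set where
      field
        {a b} : P
        xa    : δ x a ≡ 1
        xb    : δ x b ≡ 1
        ab    : δ a b ≡ 2
        apart : ¬ Path₂ a b

    locally-connected? : LocallyConnected ⊎ Disconnection
    locally-connected? with any? (λ a → any? (λ b → (δ x a ℕ.≟ 1) ×-dec (δ x b ℕ.≟ 1) ×-dec (δ a b ℕ.≟ 2) ×-dec ¬? (path₂? a b)) l) l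
    ... | yes w with satisfied w
    ...   | a , w′ with satisfied w′
    ...     | b , xa , xb , ab , apart = inj₂ (record { xa = xa ; xb = xb ; ab = ab ; apart = apart })
    locally-connected? | no none = inj₁ λ a b xa xb ab → path a b xa xb ab (path₂? a b)
      where
      path : ∀ a b → δ x a ≡ 1 → δ x b ≡ 1 → δ a b ≡ 2 → Dec (Path₂ a b) → Path₂ a b
      path a b xa xb ab (yes p) = p
      path a b xa xb ab (no ¬p) = contradiction (lose (full a) (lose (full b) (xa , xb , ab , ¬p))) none

    -- The component of a in the local graph at x has diameter at most 2.
    module Component (D : Disconnection) where
      open Disconnection D public

      Joined : P → Set
      Joined c = δ a c ≤ 1 ⊎ Path₂ a c

      joined? : ∀ c → Dec (Joined c)
      joined? c = (δ a c ℕ.≤? 1) ⊎-dec path₂? a c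

      joined : P → Bool
      joined c = isYes (joined? c)

      distance : ∀ {u v} → δ x u ≡ 1 → δ x v ≡ 1 → u ≡ v ⊎ δ u v ≡ 1 ⊎ δ u v ≡ 2
      distance {u} {v} p q with δ u v in e | nbr-δ≤2 p q
      ... | 0 | _ = inj₁ (δ-zero e)
      ... | 1 | _ = inj₂ (inj₁ refl)
      ... | 2 | _ = inj₂ (inj₂ refl)
      ... | suc (suc (suc _)) | s≤s (s≤s ())

      -- A path of length three from `a` is cut down to length two by `shorten`, so adjacency never
      -- leads out of the points joined to `a`.
      joined-step : ∀ {c f} → δ x c ≡ 1 → δ x f ≡ 1 → δ c f ≡ 1 → Joined c → Joined f
      joined-step {c} {f} xc xf cf j with distance xa xf
      ... | inj₁ refl = inj₁ (subst (_≤ 1) (sym (δ-refl a)) z≤n)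
      ... | inj₂ (inj₁ af) = inj₁ (ℕₚ.≤-reflexive af)
      ... | inj₂ (inj₂ af) with distance xa xc | j
      ...   | inj₁ refl | _ = inj₁ (ℕₚ.≤-reflexive cf)
      ...   | inj₂ (inj₁ ac) | _ = inj₂ (c , xc , ac , cf)
      ...   | inj₂ (inj₂ ac) | inj₁ le = contradiction (subst (_≤ 1) ac le) λ { (s≤s ()) }
      ...   | inj₂ (inj₂ ac) | inj₂ (e , xe , ae , ec) with distance xe xf
      ...     | inj₁ refl = inj₁ (ℕₚ.≤-reflexive ae)
      ...     | inj₂ (inj₁ ef) = inj₂ (e , xe , ae , ef)
      ...     | inj₂ (inj₂ ef) = inj₂ (shorten xa xe xc xf ae ec cf ac af ef)

      joined⇒ : ∀ {c} → joined c ≡ true → Joined c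
      joined⇒ {c} e = toWitness {a? = joined? c} (subst T (sym e) _)

      joined⇐ : ∀ {c} → Joined c → joined c ≡ true
      joined⇐ {c} j with joined? c
      ... | yes _ = refl
      ... | no ¬j = contradiction j ¬j

      separated : ∀ c f → δ x c ≡ 1 → δ x f ≡ 1 → joined c ≡ true → joined f ≡ false → δ c f ≡ 2
      separated c f xc xf jc jf with distance xc xf
      ... | inj₁ refl = contradiction (trans (sym jc) jf) λ ()
      ... | inj₂ (inj₁ cf) = contradiction (trans (sym (joined⇐ (joined-step xc xf cf (joined⇒ jc)))) jf) λ ()
      ... | inj₂ (inj₂ cf) = cf

      a-joined : joined a ≡ true
      a-joined = joined⇐ (inj₁ (subst (_≤ 1) (sym (δ-refl a)) z≤n))

      b-unjoined : joined b ≡ false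
      b-unjoined with joined? b
      ... | yes (inj₁ le) = contradiction (subst (_≤ 1) ab le) λ { (s≤s ()) }
      ... | yes (inj₂ p)  = contradiction p apart
      ... | no _ = refl

      open Splitting S l full x joined separated public

  -- `k` bounds the number of points. The local space at `x` omits `x`, and each part omits a
  -- neighbour of `x` of the other colour, so both cases descend.
  classify : ∀ k S (l : List (Pt S)) → (∀ v → v ∈ l) → length l ≤ k → Pt S → Classified S
  classify zero S [] full le x with full x
  ... | ()
  classify (suc k) S l full le x with locally-connected? S x l full
  ... | inj₁ lc with restrict (Local.isNbr S x) l in eq
  -- Without neighbours the local space is empty and vacuously complete; size 0 yields the one-point
  -- graph J(1,0).
  ...   | [] = complete-local S x lc (restrict isNbr l) (λ v → restrict-complete isNbr v (full (proj₁ v)))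
               (λ u v → contradiction (subst (u ∈_) eq (restrict-complete isNbr u (full (proj₁ u)))) λ ())
    where open Local S x
  ...   | v ∷ _ = classify-local S x lc (restrict isNbr l) full′ v
               (classify k (Local.local S x lc) (restrict isNbr l) full′ smaller v)
    where
    open Local S x
    full′ : ∀ v → v ∈ restrict isNbr l
    full′ v = restrict-complete isNbr v (full (proj₁ v))
    smaller : length (restrict isNbr l) ≤ k
    smaller = ℕₚ.≤-pred (ℕₚ.≤-trans (restrict-< isNbr (full x)
      λ t → contradiction (trans (sym (nbr⇒ {x} t)) (d-refl S x)) λ ()) le)
  classify (suc k) S l full le x | inj₂ D = split
    {a = x , base∈ true} {a , nbr∈ xa a-joined} {x , base∈ false} {b , nbr∈ xb b-unjoined} xa xb
    (component true (nbr∉ xb b-unjoined)) (component false (nbr∉ xa a-joined)) split-iso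
    where
    open Component S x l full D renaming (split to split-iso)
    component : ∀ c {v} → ¬ T (part c v) → Classified (Part c)
    component c {v} out = classify k (Part c) (restrict (part c) l)
      (λ v → restrict-complete (part c) v (full (proj₁ v)))
      (ℕₚ.≤-pred (ℕₚ.≤-trans (restrict-< (part c) (full v) out) le))
      (x , base∈ c)

-- Translation between the list of graphs and reflection spaces, and the equivalence

open ReflectionSpaces
open Subspaces
open GraphsOfSpaces
open ReflectiveGraphs
open Codes
open CocktailParties
open GossetSpace using (gosset; gosset≅)
open Exceptional using (schlaefli; schlaefli≅)
open Classification
open import Data.Nat using (zero; suc; _+_)
open import Data.List as List using (List; allFin)

graph-product : ∀ A B → graph (product A B) ≅ (graph A □ graph B)
graph-product A B = iso {graph (product A B)} {graph A □ graph B} (λ p → p) (λ p → p) (λ _ → refl) (λ _ → refl)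
  (λ {p} {q} → to p q) (λ {p} {q} → from p q)
  where
  to : ∀ p q → d (product A B) p q ≡ 1 → adj (graph A □ graph B) p q
  to (u , v) (u′ , v′) e with d A u u′ in du | d B v v′ in dv
  ... | 0           | _           = inj₂ (d-zero A du , e)
  ... | 1           | 0           = inj₁ (refl , d-zero B dv)
  ... | 1           | suc _       = contradiction e λ ()
  ... | suc (suc _) | _           = contradiction e λ ()
  from : ∀ p q → adj (graph A □ graph B) p q → d (product A B) p q ≡ 1
  from (u , v) (u′ , .v) (inj₁ (e , refl)) = cong₂ _+_ e (d-refl B v)
  from (u , v) (.u , v′) (inj₂ (refl , e)) = cong₂ _+_ (d-refl A u) e

□-cong : ∀ {G G′ H H′} → G ≅ G′ → H ≅ H′ → (G □ H) ≅ (G′ □ H′)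
□-cong {G} {G′} {H} {H′} i j = iso {G □ H} {G′ □ H′}
  (λ { (u , v) → I.f u , J.f v }) (λ { (u , v) → I.g u , J.g v })
  (λ { (u , v) → cong₂ _,_ (I.fg u) (J.fg v) }) (λ { (u , v) → cong₂ _,_ (I.gf u) (J.gf v) })
  (λ { (inj₁ (e , p)) → inj₁ (I.adj-f e , cong J.f p) ; (inj₂ (p , e)) → inj₂ (cong I.f p , J.adj-f e) })
  (λ { (inj₁ (e , p)) → inj₁ (I.f-adj e , trans (sym (J.gf _)) (trans (cong J.g p) (J.gf _)))
     ; (inj₂ (p , e)) → inj₂ (trans (sym (I.gf _)) (trans (cong I.g p) (I.gf _)) , J.f-adj e) })
  where
  module I = Iso {G} {G′} i
  module J = Iso {H} {H′} j

model-InList : ∀ m → InList (graph ⟦ m ⟧)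
model-InList (cocktail-party n o) = basic (inj₁ (n , CP.cocktailParty≅ n o))
model-InList (johnson-space n k)  = basic (inj₂ (inj₁ (n , k , johnson≅ n k)))
model-InList (halved-cube n)      = basic (inj₂ (inj₂ (inj₁ (n , halvedCube≅ n))))
model-InList schlaefli-space      = basic (inj₂ (inj₂ (inj₂ (inj₁ schlaefli≅))))
model-InList gosset-space         = basic (inj₂ (inj₂ (inj₂ (inj₂ gosset≅))))

classified-InList : ∀ {S} → Classified S → InList (graph S)
classified-InList {S} (model m f) = InList-≅ {graph S} {graph ⟦ m ⟧} (≃⇒≅ f) (model-InList m)
classified-InList {S} (split {A} {B} _ _ a b f) = prod (classified-InList a) (classified-InList b)
  (≅-trans {graph S} {graph (product A B)} {graph A □ graph B} (≃⇒≅ f) (graph-product A B))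

connected-≅ : ∀ {G H} → G ≅ H → Connected G → Connected H
connected-≅ {G} {H} i (x , walk) = f x , λ u v → let k , w = walk (g u) (g v) in
  k , subst₂ (Reach H k) (fg u) (fg v) (reach-map {G} {H} f adj-f w)
  where open Iso {G} {H} i

module _ {G H : Graph} where
  reach-proj₁ : ∀ {k p q} → Reach (G □ H) k p q → Reach G k (proj₁ p) (proj₁ q)
  reach-proj₁ here = here
  reach-proj₁ (step (inj₁ (e , _)) w)    = step e (reach-proj₁ w)
  reach-proj₁ (step (inj₂ (refl , _)) w) = reach-suc (reach-proj₁ w)

  reach-proj₂ : ∀ {k p q} → Reach (G □ H) k p q → Reach H k (proj₂ p) (proj₂ q)
  reach-proj₂ here = here
  reach-proj₂ (step (inj₂ (_ , e)) w)    = step e (reach-proj₂ w)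
  reach-proj₂ (step (inj₁ (_ , refl)) w) = reach-suc (reach-proj₂ w)

  -- Connectedness has to reach the factors, where it excludes a factor CP(1).
  connected-□ : Connected (G □ H) → Connected G × Connected H
  connected-□ ((x , y) , walk) =
    (x , λ u v → let k , w = walk (u , y) (v , y) in k , reach-proj₁ w) ,
    (y , λ u v → let k , w = walk (x , u) (x , v) in k , reach-proj₂ w)

-- CP(1) is the disconnected graph on two vertices.
cocktail-party-others : ∀ m → Connected (CocktailParty m) → ∀ (i : Fin m) → Σ (Fin m) λ j → i ≢ j
cocktail-party-others (suc zero) (_ , walk) _ = contradiction (proj₂ (walk (zero , true) (zero , false))) isolated
  where
  isolated : ∀ {k} → ¬ Reach (CocktailParty 1) k (zero , true) (zero , false)
  isolated (step {z = zero , _} e _) = e refl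
cocktail-party-others (suc (suc m)) _ zero    = suc zero , λ ()
cocktail-party-others (suc (suc m)) _ (suc i) = zero , λ ()

-- A product is handled through its factors, since products of reflection spaces are reflection
-- spaces; the basic graphs are matched with the spaces constructed for them.
InList⇒space : ∀ {G} → InList G → Connected G → Σ ReflSpace λ S → G ≅ graph S
InList⇒space {G} (basic (inj₁ (m , i))) c =
  CP.cocktailParty m o , ≅-trans {G} {CocktailParty m} {graph (CP.cocktailParty m o)} i
    (≅-sym {graph (CP.cocktailParty m o)} {CocktailParty m} (CP.cocktailParty≅ m o))
  where o = cocktail-party-others m (connected-≅ {G} {CocktailParty m} i c)
InList⇒space {G} (basic (inj₂ (inj₁ (n , k , i)))) c =
  johnson n k , ≅-trans {G} {Johnson n k} {graph (johnson n k)} i (≅-sym {graph (johnson n k)} {Johnson n k} (johnson≅ n k))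
InList⇒space {G} (basic (inj₂ (inj₂ (inj₁ (n , i))))) c =
  halvedCube n , ≅-trans {G} {HalvedCube n} {graph (halvedCube n)} i (≅-sym {graph (halvedCube n)} {HalvedCube n} (halvedCube≅ n))
InList⇒space {G} (basic (inj₂ (inj₂ (inj₂ (inj₁ i))))) c =
  schlaefli , ≅-trans {G} {Schlaefli} {graph schlaefli} i (≅-sym {graph schlaefli} {Schlaefli} schlaefli≅)
InList⇒space {G} (basic (inj₂ (inj₂ (inj₂ (inj₂ i))))) c =
  gosset , ≅-trans {G} {Gosset} {graph gosset} i (≅-sym {graph gosset} {Gosset} gosset≅)
InList⇒space {G} (prod {H₁ = H} {K} p q i) c with connected-□ {H} {K} (connected-≅ {G} {H □ K} i c)
... | cH , cK with InList⇒space p cH | InList⇒space q cK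
...   | A , j | B , k = product A B , ≅-trans {G} {H □ K} {graph (product A B)} i
  (≅-trans {H □ K} {graph A □ graph B} {graph (product A B)} (□-cong {H} {graph A} {K} {graph B} j k)
    (≅-sym {graph (product A B)} {graph A □ graph B} (graph-product A B)))

theorem4p3 : (G : Graph) → Simple G → Finite G → Connected G →
    (Reflective G → InList G) × (InList G → Reflective G)
theorem4p3 G simple finite connected = reflective⇒ , reflective⇐
  where
  reflective⇒ : Reflective G → InList G
  reflective⇒ reflective = InList-≅ {G} {graph R.space}
    (iso {G} {graph R.space} (λ v → v) (λ v → v) (λ _ → refl) (λ _ → refl) R.adj⇒δ R.δ⇒adj)
    (classified-InList (classify _ R.space l l-complete ℕₚ.≤-refl (proj₁ connected)))
    where
    module R = Reflections G simple finite connected reflective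
    module F = Inverse (proj₂ finite)
    l : List (V G)
    l = List.map F.from (allFin (proj₁ finite))
    l-complete : ∀ v → v ∈ l
    l-complete v = subst (_∈ l) (F.strictlyInverseʳ v) (∈-map⁺ F.from (∈-allFin (F.to v)))
  reflective⇐ : InList G → Reflective G
  reflective⇐ listed = let S , i = InList⇒space listed connected in toReflective S {G} i
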